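{- Let $k,\ell>0$ be real numbers and define $q_n=t_n-k$ and $r_n=t_n+\ell$ for all $n\ge0$. For complex $s$ with $\Re(s)>1$ put $\lambda(s;k,\ell)=2^s-\bigl(2^s(k-\ell)+(k+\ell)\bigr)$. Then for each $s$ with $\Re(s)>1$: (1) if $\lambda(s;k,\ell)=0$, then $\displaystyle\sum_{n\ge1}\frac{q_{n-1}}{n^s}=\frac{1-2^s}{1+2^s}\sum_{n\ge1}\frac{r_n}{n^s}$; (2) if $\lambda(s;k,\ell)=2^s$, then $\displaystyle(2^s+1)\sum_{n\ge1}\frac{q_{n-1}}{n^s}+(2^s-1)\sum_{n\ge1}\frac{r_n}{n^s}=2^s\zeta(s)$; (3) if $\lambda(s;k,\ell)=2^s-2$, then $\displaystyle(2^s+1)\sum_{n\ge1}\frac{q_{n-1}}{n^s}+(2^s-1)\sum_{n\ge1}\frac{r_n}{n^s}=2^s\eta(s)$.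
   Context: For $n\ge 0$, let $t_n\in\{0,1\}$ denote the sum of the binary digits of $n$ reduced modulo $2$ (so $t_0=0$; this is the Thue–Morse sequence). $\zeta(s)=\sum_{n\ge1}n^{ -s}$ is the Riemann zeta function and $\eta(s)=\sum_{n\ge1}(-1)^{n-1}n^{ -s}$ is the Dirichlet eta (alternating zeta) function, both for $\Re(s)>1$. -}

module Defs where

open import Data.Fin.Base using (toℕ)
import Data.Integer.Base as ℤ
import Data.Integer.Properties as ℤP
open import Data.Digit using (toDigits)
open import Data.List.Base using (map)
open import Data.Nat.ListAction using (sum)
open import Data.Nat.Base as ℕ using (ℕ; zero; suc; NonZero)
import Data.Nat.Properties as ℕP
open import Data.Nat.Coprimality using (1-coprimeTo) renaming (sym to coprime-sym)
open import Data.Nat.DivMod using (_%_)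
open import Data.Product.Base using (∃-syntax; _×_; _,_; proj₁; proj₂)
open import Data.Rational.Base as ℚ
  using (ℚ; mkℚ; 0ℚ; 1ℚ; ½; _+_; _*_; -_; _-_; ∣_∣; _≤_; _<_; *≤*; *<*; toℚᵘ)
open import Data.Rational.Properties as ℚP
open import Data.Rational.Solver using (module +-*-Solver)
import Data.Rational.Unnormalised.Base as ℚᵘ
import Data.Rational.Unnormalised.Properties as ℚᵘP
open import Data.Sum.Base using (inj₁; inj₂)
open import Relation.Binary.PropositionalEquality
  using (_≡_; refl; sym; trans; cong; cong₂; subst; subst₂)

fromℕ : ℕ → ℚ
fromℕ n = mkℚ (ℤ.+ n) 0 (coprime-sym (1-coprimeTo n))

1/1+_ : ℕ → ℚ
1/1+ n = mkℚ (ℤ.+ 1) n (1-coprimeTo (suc n))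

infix 9 1/1+_

open +-*-Solver using (solve; _:=_; _:+_; _:*_; _:-_; :-_; con)

0≤* : ∀ {p q} → 0ℚ ≤ p → 0ℚ ≤ q → 0ℚ ≤ p * q
0≤* {p} {q} hp hq = ≤-trans (≤-reflexive (sym (*-zeroʳ p)))
  (*-monoˡ-≤-nonNeg p {{ℚ.nonNegative hp}} hq)

*-mono : ∀ {p q r s} → 0ℚ ≤ p → 0ℚ ≤ s → p ≤ q → r ≤ s → p * r ≤ q * s
*-mono {p} {q} {r} {s} hp hs p≤q r≤s = ≤-trans
  (*-monoˡ-≤-nonNeg p {{ℚ.nonNegative hp}} r≤s)
  (*-monoʳ-≤-nonNeg s {{ℚ.nonNegative hs}} p≤q)

0≤+ : ∀ {p q} → 0ℚ ≤ p → 0ℚ ≤ q → 0ℚ ≤ p + q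
0≤+ hp hq = +-mono-≤ hp hq

p≤p+q : ∀ {p q} → 0ℚ ≤ q → p ≤ p + q
p≤p+q {p} hq = ≤-trans (≤-reflexive (sym (+-identityʳ p))) (+-monoʳ-≤ p hq)

q≤p+q : ∀ {p q} → 0ℚ ≤ p → q ≤ p + q
q≤p+q {p} {q} hp = ≤-trans (≤-reflexive (sym (+-identityˡ q))) (+-monoˡ-≤ q hp)

p≤q+r⇒p-q≤r : ∀ {p q r} → p ≤ q + r → p - q ≤ r
p≤q+r⇒p-q≤r {p} {q} {r} h = ≤-trans (+-monoˡ-≤ (- q) h)
  (≤-reflexive (solve 2 (λ q r → (q :+ r) :- q := r) refl q r))

p≤q⇒0≤q-p : ∀ {p q} → p ≤ q → 0ℚ ≤ q - p
p≤q⇒0≤q-p {p} h = ≤-trans (≤-reflexive (sym (+-inverseʳ p))) (+-monoˡ-≤ (- p) h)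

∣-∣-bound : ∀ {p q c} → p - q ≤ c → q - p ≤ c → ∣ p - q ∣ ≤ c
∣-∣-bound {p} {q} h₁ h₂ with ∣p∣≡p∨∣p∣≡-p (p - q)
... | inj₁ eq = ≤-trans (≤-reflexive eq) h₁
... | inj₂ eq = ≤-trans (≤-reflexive (trans eq
                  (solve 2 (λ p q → :- (p :- q) := q :- p) refl p q))) h₂

∣p-q∣≡∣q-p∣ : ∀ p q → ∣ p - q ∣ ≡ ∣ q - p ∣
∣p-q∣≡∣q-p∣ p q = trans (sym (∣-p∣≡∣p∣ (p - q)))
  (cong ∣_∣ (solve 2 (λ p q → :- (p :- q) := q :- p) refl p q))

½+½ : ∀ p → ½ * p + ½ * p ≡ p
½+½ p = trans (sym (*-distribʳ-+ p ½ ½)) (*-identityˡ p)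

0<½ε : ∀ {ε} → 0ℚ < ε → 0ℚ < ½ * ε
0<½ε {ε} h = positive⁻¹ (½ * ε) {{pos*pos⇒pos ½ ε {{ℚ.positive h}}}}

0≤1/1+ : ∀ n → 0ℚ ≤ 1/1+ n
0≤1/1+ n = nonNegative⁻¹ (1/1+ n)

0≤fromℕ : ∀ n → 0ℚ ≤ fromℕ n
0≤fromℕ n = nonNegative⁻¹ (fromℕ n)

1/1+-inverse : ∀ n → fromℕ (suc n) * 1/1+ n ≡ 1ℚ
1/1+-inverse n = toℚᵘ-injective (ℚᵘP.≃-trans (toℚᵘ-homo-* (fromℕ (suc n)) (1/1+ n))
  (ℚᵘ.*≡* (trans (ℤP.*-identityʳ _) (trans (ℤP.*-identityʳ _)
    (cong ℤ.+_ (trans (sym (ℕP.+-identityʳ (suc n)))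
      (sym (trans (ℕP.*-identityˡ _) (cong suc (trans (ℕP.+-identityʳ _) (sym (ℕP.+-identityʳ n))))))))))))

1/1+-antitone : ∀ {m n} → m ℕ.≤ n → 1/1+ n ≤ 1/1+ m
1/1+-antitone {m} {n} m≤n = *≤* (ℤ.+≤+ (subst₂ ℕ._≤_
  (sym (ℕP.*-identityˡ (suc m))) (sym (ℕP.*-identityˡ (suc n))) (ℕ.s≤s m≤n)))

fromℕ-suc : ∀ M → fromℕ M < fromℕ (suc M)
fromℕ-suc M = *<* (subst₂ ℤ._<_ (sym (ℤP.*-identityʳ (ℤ.+ M))) (sym (ℤP.*-identityʳ (ℤ.+ suc M)))
  (ℤ.+<+ (ℕP.n<1+n M)))

fromℕ-1+ : ∀ n → 1ℚ + fromℕ n ≡ fromℕ (suc n)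
fromℕ-1+ n = toℚᵘ-injective (ℚᵘP.≃-trans (toℚᵘ-homo-+ 1ℚ (fromℕ n))
  (ℚᵘ.*≡* (cong (λ i → (ℤ.+ 1 ℤ.+ i) ℤ.* ℤ.+ 1) (ℤP.*-identityʳ (ℤ.+ n)))))

archimedean-small : ∀ ε → 0ℚ < ε → ∃[ N ] 1/1+ N < ε
archimedean-small (mkℚ ℤ.+0 d c) (*<* (ℤ.+<+ ()))
archimedean-small (mkℚ ℤ.+[1+ a ] d c) h = suc d , *<* (ℤ.+<+ (ℕP.≤-trans
  (ℕ.s≤s (ℕP.≤-reflexive (ℕP.*-identityˡ (suc d)))) (ℕP.m≤m+n (suc (suc d)) _)))
archimedean-small (mkℚ ℤ.-[1+ a ] d c) (*<* ())

archimedean-large : ∀ p → ∃[ M ] p ≤ fromℕ M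
archimedean-large p@(mkℚ (ℤ.+ a) d c) = a , *≤* (subst₂ ℤ._≤_ (ℤP.pos-* a 1) (ℤP.pos-* a (suc d))
  (ℤ.+≤+ (ℕP.≤-trans (ℕP.≤-reflexive (ℕP.*-identityʳ a)) (ℕP.m≤m*n a (suc d)))))
archimedean-large p@(mkℚ ℤ.-[1+ a ] d c) = 0 , nonPositive⁻¹ p

Vanishing : (ℕ → ℕ → ℚ) → Set
Vanishing d = ∀ ε → 0ℚ < ε → ∃[ N ] (∀ m n → N ℕ.≤ m → N ℕ.≤ n → d m n < ε)

IsCauchy : (ℕ → ℚ) → Set
IsCauchy x = Vanishing (λ m n → ∣ x m - x n ∣)

vanishing-+ : ∀ {d e} → Vanishing d → Vanishing e → Vanishing (λ m n → d m n + e m n)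
vanishing-+ {d} {e} vd ve ε 0<ε with vd (½ * ε) (0<½ε 0<ε) | ve (½ * ε) (0<½ε 0<ε)
... | N₁ , h₁ | N₂ , h₂ = N₁ ℕ.⊔ N₂ , λ m n p q →
  subst (d m n + e m n <_) (½+½ ε)
    (+-mono-< (h₁ m n (ℕP.≤-trans (ℕP.m≤m⊔n N₁ N₂) p) (ℕP.≤-trans (ℕP.m≤m⊔n N₁ N₂) q))
              (h₂ m n (ℕP.≤-trans (ℕP.m≤n⊔m N₁ N₂) p) (ℕP.≤-trans (ℕP.m≤n⊔m N₁ N₂) q)))

vanishing-≤ : ∀ {d e} K → (∀ m n → K ℕ.≤ m → K ℕ.≤ n → d m n ≤ e m n) →
              Vanishing e → Vanishing d
vanishing-≤ K d≤e ve ε 0<ε with ve ε 0<ε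
... | N , h = K ℕ.⊔ N , λ m n p q → ≤-<-trans
  (d≤e m n (ℕP.≤-trans (ℕP.m≤m⊔n K N) p) (ℕP.≤-trans (ℕP.m≤m⊔n K N) q))
  (h m n (ℕP.≤-trans (ℕP.m≤n⊔m K N) p) (ℕP.≤-trans (ℕP.m≤n⊔m K N) q))

vanishing-* : ∀ {d c} → 0ℚ ≤ c → Vanishing d → Vanishing (λ m n → c * d m n)
vanishing-* {d} {c} 0≤c vd ε 0<ε with archimedean-large c
... | M , c≤M with vd (1/1+ M * ε) 0<δ
  where
  0<δ : 0ℚ < 1/1+ M * ε
  0<δ = positive⁻¹ (1/1+ M * ε) {{pos*pos⇒pos (1/1+ M) ε {{ℚ.positive 0<ε}}}}
...   | N , h = N , λ m n p q → begin-strict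
  c * d m n                         ≤⟨ *-monoˡ-≤-nonNeg c {{ℚ.nonNegative 0≤c}} (<⇒≤ (h m n p q)) ⟩
  c * δ                             ≤⟨ *-monoʳ-≤-nonNeg δ {{ℚ.nonNegative (<⇒≤ 0<δ)}} c≤M ⟩
  fromℕ M * δ                       <⟨ *-monoˡ-<-pos δ {{ℚ.positive 0<δ}} (fromℕ-suc M) ⟩
  fromℕ (suc M) * (1/1+ M * ε)      ≡⟨ sym (*-assoc (fromℕ (suc M)) (1/1+ M) ε) ⟩
  fromℕ (suc M) * 1/1+ M * ε        ≡⟨ cong (_* ε) (1/1+-inverse M) ⟩
  1ℚ * ε                            ≡⟨ *-identityˡ ε ⟩
  ε                                 ∎
  where
  open ≤-Reasoning
  δ = 1/1+ M * ε
  0<δ : 0ℚ < δ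
  0<δ = positive⁻¹ δ {{pos*pos⇒pos (1/1+ M) ε {{ℚ.positive 0<ε}}}}

vanishing-1/1+ : Vanishing (λ m n → 1/1+ m + 1/1+ n)
vanishing-1/1+ = vanishing-+
  (λ ε 0<ε → let (N , h) = archimedean-small ε 0<ε in
     N , λ m n N≤m N≤n → ≤-<-trans (1/1+-antitone N≤m) h)
  (λ ε 0<ε → let (N , h) = archimedean-small ε 0<ε in
     N , λ m n N≤m N≤n → ≤-<-trans (1/1+-antitone N≤n) h)

∣-∣-diff-+ : ∀ a b c d → ∣ (a + b) - (c + d) ∣ ≤ ∣ a - c ∣ + ∣ b - d ∣
∣-∣-diff-+ a b c d = ≤-trans
  (≤-reflexive (cong ∣_∣ (solve 4 (λ a b c d →
    (a :+ b) :- (c :+ d) := (a :- c) :+ (b :- d)) refl a b c d)))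
  (∣p+q∣≤∣p∣+∣q∣ (a - c) (b - d))

∣-∣-diff-* : ∀ {A D} a b c d → ∣ a ∣ ≤ A → ∣ d ∣ ≤ D →
             ∣ a * b - c * d ∣ ≤ A * ∣ b - d ∣ + D * ∣ a - c ∣
∣-∣-diff-* {A} {D} a b c d ha hd = begin
  ∣ a * b - c * d ∣                         ≡⟨ cong ∣_∣ (solve 4 (λ a b c d →
                                                 a :* b :- c :* d := a :* (b :- d) :+ d :* (a :- c))
                                                 refl a b c d) ⟩
  ∣ a * (b - d) + d * (a - c) ∣             ≤⟨ ∣p+q∣≤∣p∣+∣q∣ (a * (b - d)) (d * (a - c)) ⟩
  ∣ a * (b - d) ∣ + ∣ d * (a - c) ∣         ≡⟨ cong₂ _+_ (∣p*q∣≡∣p∣*∣q∣ a (b - d)) (∣p*q∣≡∣p∣*∣q∣ d (a - c)) ⟩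
  ∣ a ∣ * ∣ b - d ∣ + ∣ d ∣ * ∣ a - c ∣     ≤⟨ +-mono-≤
      (*-monoʳ-≤-nonNeg ∣ b - d ∣ {{∣-∣-nonNeg (b - d)}} ha)
      (*-monoʳ-≤-nonNeg ∣ a - c ∣ {{∣-∣-nonNeg (a - c)}} hd) ⟩
  A * ∣ b - d ∣ + D * ∣ a - c ∣             ∎
  where open ≤-Reasoning

cauchy-bounded : ∀ {x} → IsCauchy x → ∃[ B ] (∀ n → ∣ x n ∣ ≤ B)
cauchy-bounded {x} cx with cx 1ℚ (positive⁻¹ 1ℚ)
... | N , h = S N + (∣ x N ∣ + 1ℚ) , bound
  where
  S : ℕ → ℚ
  S zero    = 0ℚ
  S (suc n) = S n + ∣ x n ∣

  0≤S : ∀ n → 0ℚ ≤ S n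
  0≤S zero    = ≤-refl
  0≤S (suc n) = 0≤+ (0≤S n) (0≤∣p∣ (x n))

  below : ∀ n m → n ℕ.< m → ∣ x n ∣ ≤ S m
  below n (suc m) (ℕ.s≤s n≤m) with ℕP.m≤n⇒m<n∨m≡n n≤m
  ... | inj₁ n<m  = ≤-trans (below n m n<m) (p≤p+q (0≤∣p∣ (x m)))
  ... | inj₂ refl = q≤p+q (0≤S n)

  bound : ∀ n → ∣ x n ∣ ≤ S N + (∣ x N ∣ + 1ℚ)
  bound n with ℕP.<-≤-connex n N
  ... | inj₁ n<N = ≤-trans (below n N n<N) (p≤p+q (0≤+ (0≤∣p∣ (x N)) (nonNegative⁻¹ 1ℚ)))
  ... | inj₂ N≤n = begin
    ∣ x n ∣                          ≡⟨ cong ∣_∣ (solve 2 (λ a b → a := b :+ (a :- b)) refl (x n) (x N)) ⟩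
    ∣ x N + (x n - x N) ∣            ≤⟨ ∣p+q∣≤∣p∣+∣q∣ (x N) (x n - x N) ⟩
    ∣ x N ∣ + ∣ x n - x N ∣          ≤⟨ +-monoʳ-≤ ∣ x N ∣ (<⇒≤ (h n N N≤n ℕP.≤-refl)) ⟩
    ∣ x N ∣ + 1ℚ                     ≤⟨ q≤p+q (0≤S N) ⟩
    S N + (∣ x N ∣ + 1ℚ)             ∎
    where open ≤-Reasoning

record ℝ : Set where
  constructor mkℝ
  field
    seq    : ℕ → ℚ
    cauchy : IsCauchy seq

open ℝ public

infix  4 _≈ʳ_ _<ʳ_
infixl 6 _+ʳ_ _-ʳ_
infixl 7 _*ʳ_
infix  8 -ʳ_

_≈ʳ_ : ℝ → ℝ → Set
x ≈ʳ y = ∀ ε → 0ℚ < ε → ∃[ N ] (∀ n → N ℕ.≤ n → ∣ seq x n - seq y n ∣ < ε)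

_<ʳ_ : ℝ → ℝ → Set
x <ʳ y = ∃[ ε ] 0ℚ < ε × ∃[ N ] (∀ n → N ℕ.≤ n → seq x n + ε ≤ seq y n)

fromℚ : ℚ → ℝ
fromℚ p = mkℝ (λ _ → p) λ ε 0<ε → 0 , λ m n _ _ →
  subst (_< ε) (sym (cong ∣_∣ (+-inverseʳ p))) 0<ε

0ʳ 1ʳ : ℝ
0ʳ = fromℚ 0ℚ
1ʳ = fromℚ 1ℚ

_+ʳ_ : ℝ → ℝ → ℝ
x +ʳ y = mkℝ (λ n → seq x n + seq y n)
  (vanishing-≤ 0 (λ m n _ _ → ∣-∣-diff-+ (seq x m) (seq y m) (seq x n) (seq y n))
    (vanishing-+ (cauchy x) (cauchy y)))

-ʳ_ : ℝ → ℝ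
-ʳ x = mkℝ (λ n → - seq x n)
  (vanishing-≤ 0 (λ m n _ _ → ≤-reflexive (trans
      (cong ∣_∣ (solve 2 (λ a b → :- a :- :- b := b :- a) refl (seq x m) (seq x n)))
      (∣p-q∣≡∣q-p∣ (seq x n) (seq x m))))
    (cauchy x))

_-ʳ_ : ℝ → ℝ → ℝ
x -ʳ y = x +ʳ (-ʳ y)

cauchy-* : ∀ {x y} → IsCauchy x → IsCauchy y → IsCauchy (λ n → x n * y n)
cauchy-* {x} {y} cx cy with cauchy-bounded cx | cauchy-bounded cy
... | A , hA | B , hB =
  vanishing-≤ 0 (λ m n _ _ → ∣-∣-diff-* (x m) (y m) (x n) (y n) (hA m) (hB n))
    (vanishing-+ (vanishing-* (≤-trans (0≤∣p∣ (x 0)) (hA 0)) cy)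
                 (vanishing-* (≤-trans (0≤∣p∣ (y 0)) (hB 0)) cx))

_*ʳ_ : ℝ → ℝ → ℝ
x *ʳ y = mkℝ (λ n → seq x n * seq y n) (cauchy-* {seq x} {seq y} (cauchy x) (cauchy y))

record ℂ : Set where
  constructor _+i_
  field
    re : ℝ
    im : ℝ

open ℂ public

infix  5 _+i_
infix  4 _≈ᶜ_
infixl 6 _+ᶜ_ _-ᶜ_
infixl 7 _*ᶜ_
infix  8 -ᶜ_

_≈ᶜ_ : ℂ → ℂ → Set
z ≈ᶜ w = re z ≈ʳ re w × im z ≈ʳ im w

fromℝ : ℝ → ℂ
fromℝ x = x +i 0ʳ

0ᶜ 1ᶜ 2ᶜ : ℂ
0ᶜ = fromℝ 0ʳ
1ᶜ = fromℝ 1ʳ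
2ᶜ = fromℝ (fromℚ (fromℕ 2))

_+ᶜ_ _*ᶜ_ _-ᶜ_ : ℂ → ℂ → ℂ
z +ᶜ w = (re z +ʳ re w) +i (im z +ʳ im w)
z *ᶜ w = (re z *ʳ re w -ʳ im z *ʳ im w) +i (re z *ʳ im w +ʳ im z *ʳ re w)
z -ᶜ w = (re z -ʳ re w) +i (im z -ʳ im w)

-ᶜ_ : ℂ → ℂ
-ᶜ z = (-ʳ re z) +i (-ʳ im z)

∣_∣² : ℂ → ℝ
∣ z ∣² = re z *ʳ re z +ʳ im z *ʳ im z

ℚ[i] : Set
ℚ[i] = ℚ × ℚ

infixl 6 _⊕_ _⊖_
infixl 7 _⊗_ _·_

_⊕_ _⊖_ _⊗_ : ℚ[i] → ℚ[i] → ℚ[i]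
(a , b) ⊕ (c , d) = a + c , b + d
(a , b) ⊖ (c , d) = a - c , b - d
(a , b) ⊗ (c , d) = a * c - b * d , a * d + b * c

_·_ : ℚ → ℚ[i] → ℚ[i]
c · (a , b) = c * a , c * b

-- expTerm z k = zᵏ / k!  and  expSum z n = ∑_{k<n} zᵏ / k!
expTerm : ℚ[i] → ℕ → ℚ[i]
expTerm z zero    = 1ℚ , 0ℚ
expTerm z (suc k) = 1/1+ k · (expTerm z k ⊗ z)

expSum : ℚ[i] → ℕ → ℚ[i]
expSum z zero    = 0ℚ , 0ℚ
expSum z (suc n) = expSum z n ⊕ expTerm z n

approx : ℂ → ℕ → ℚ[i]
approx z n = seq (re z) n , seq (im z) n

-- Taking the n-th partial sum at the n-th approximation makes the
-- exponential a single sequence; it converges because the partial sums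
-- are Lipschitz on bounded sets uniformly in n.
expSeq : ℂ → ℕ → ℚ[i]
expSeq z n = expSum (approx z n) n

-- The ℓ¹ norm: unlike the modulus it is rational-valued, and it is still
-- submultiplicative.
‖_‖ : ℚ[i] → ℚ
‖ (a , b) ‖ = ∣ a ∣ + ∣ b ∣

0≤‖‖ : ∀ z → 0ℚ ≤ ‖ z ‖
0≤‖‖ (a , b) = 0≤+ (0≤∣p∣ a) (0≤∣p∣ b)

‖⊕‖ : ∀ z w → ‖ z ⊕ w ‖ ≤ ‖ z ‖ + ‖ w ‖
‖⊕‖ (a , b) (c , d) = ≤-trans (+-mono-≤ (∣p+q∣≤∣p∣+∣q∣ a c) (∣p+q∣≤∣p∣+∣q∣ b d))
  (≤-reflexive (solve 4 (λ a b c d → (a :+ c) :+ (b :+ d) := (a :+ b) :+ (c :+ d))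
    refl (∣ a ∣) (∣ b ∣) (∣ c ∣) (∣ d ∣)))

‖⊗‖ : ∀ z w → ‖ z ⊗ w ‖ ≤ ‖ z ‖ * ‖ w ‖
‖⊗‖ (a , b) (c , d) = begin
  ∣ a * c - b * d ∣ + ∣ a * d + b * c ∣
    ≤⟨ +-mono-≤ (∣p-q∣≤∣p∣+∣q∣ (a * c) (b * d)) (∣p+q∣≤∣p∣+∣q∣ (a * d) (b * c)) ⟩
  (∣ a * c ∣ + ∣ b * d ∣) + (∣ a * d ∣ + ∣ b * c ∣)
    ≡⟨ cong₂ _+_ (cong₂ _+_ (∣p*q∣≡∣p∣*∣q∣ a c) (∣p*q∣≡∣p∣*∣q∣ b d))
                 (cong₂ _+_ (∣p*q∣≡∣p∣*∣q∣ a d) (∣p*q∣≡∣p∣*∣q∣ b c)) ⟩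
  (∣ a ∣ * ∣ c ∣ + ∣ b ∣ * ∣ d ∣) + (∣ a ∣ * ∣ d ∣ + ∣ b ∣ * ∣ c ∣)
    ≡⟨ solve 4 (λ a b c d → (a :* c :+ b :* d) :+ (a :* d :+ b :* c) := (a :+ b) :* (c :+ d))
         refl (∣ a ∣) (∣ b ∣) (∣ c ∣) (∣ d ∣) ⟩
  (∣ a ∣ + ∣ b ∣) * (∣ c ∣ + ∣ d ∣) ∎
  where open ≤-Reasoning

‖·‖ : ∀ {c} z → 0ℚ ≤ c → ‖ c · z ‖ ≡ c * ‖ z ‖
‖·‖ {c} (a , b) 0≤c = trans
  (cong₂ _+_ (trans (∣p*q∣≡∣p∣*∣q∣ c a) (cong (_* ∣ a ∣) (0≤p⇒∣p∣≡p 0≤c)))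
             (trans (∣p*q∣≡∣p∣*∣q∣ c b) (cong (_* ∣ b ∣) (0≤p⇒∣p∣≡p 0≤c))))
  (sym (*-distribˡ-+ c (∣ a ∣) (∣ b ∣)))

‖⊖‖-sym : ∀ z w → ‖ z ⊖ w ‖ ≡ ‖ w ⊖ z ‖
‖⊖‖-sym (a , b) (c , d) = cong₂ _+_ (∣p-q∣≡∣q-p∣ a c) (∣p-q∣≡∣q-p∣ b d)

-- majTerm B k = Bᵏ / k!  and  majSum B n = ∑_{k<n} Bᵏ / k!
majTerm majSum : ℚ → ℕ → ℚ
majTerm B zero    = 1ℚ
majTerm B (suc k) = 1/1+ k * (majTerm B k * B)
majSum B zero    = 0ℚ
majSum B (suc n) = majSum B n + majTerm B n

module Majorant (M : ℕ) where

  B : ℚ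
  B = fromℕ M

  0≤B : 0ℚ ≤ B
  0≤B = 0≤fromℕ M

  0≤majTerm : ∀ k → 0ℚ ≤ majTerm B k
  0≤majTerm zero    = nonNegative⁻¹ 1ℚ
  0≤majTerm (suc k) = 0≤* (0≤1/1+ k) (0≤* (0≤majTerm k) 0≤B)

  0≤majSum : ∀ n → 0ℚ ≤ majSum B n
  0≤majSum zero    = ≤-refl
  0≤majSum (suc n) = 0≤+ (0≤majSum n) (0≤majTerm n)

  ratio : ∀ {k} → 2 ℕ.* M ℕ.≤ k → 1/1+ k * B ≤ ½
  ratio {k} h = toℚᵘ-cancel-≤ (ℚᵘP.≤-trans (ℚᵘP.≤-reflexive (toℚᵘ-homo-* (1/1+ k) B))
    (ℚᵘ.*≤* (subst₂ ℤ._≤_ (trans (ℤP.pos-* M 2) (cong (ℤ._* ℤ.+ 2) (sym (ℤP.*-identityˡ (ℤ.+ M)))))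
                          (sym (ℤP.*-identityˡ _))
      (ℤ.+≤+ (ℕP.≤-trans (ℕP.≤-reflexive (ℕP.*-comm M 2))
               (ℕP.≤-trans h (ℕP.≤-trans (ℕP.n≤1+n k) (ℕP.≤-reflexive (sym (ℕP.*-identityʳ (suc k)))))))))))

  K : ℕ
  K = 2 ℕ.* M

  halving : ∀ {k} → K ℕ.≤ k → majTerm B (suc k) ≤ ½ * majTerm B k
  halving {k} h = ≤-trans
    (≤-reflexive (solve 3 (λ a b c → a :* (b :* c) := (a :* c) :* b) refl (1/1+ k) (majTerm B k) B))
    (*-monoʳ-≤-nonNeg (majTerm B k) {{ℚ.nonNegative (0≤majTerm k)}} (ratio h))

  D : ℚ
  D = fromℕ (suc K) * majTerm B K

  0≤D : 0ℚ ≤ D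
  0≤D = 0≤* (0≤fromℕ (suc K)) (0≤majTerm K)

  ½1/1+ : ∀ k → ½ * 1/1+ k ≤ 1/1+ suc k
  ½1/1+ k = toℚᵘ-cancel-≤ (ℚᵘP.≤-trans (ℚᵘP.≤-reflexive (toℚᵘ-homo-* ½ (1/1+ k)))
    (ℚᵘ.*≤* (ℤ.+≤+ (subst₂ ℕ._≤_ (sym (ℕP.*-identityˡ (suc (suc k)))) (sym (ℕP.*-identityˡ _))
      (ℕ.s≤s (ℕP.≤-trans (ℕP.≤-reflexive (ℕP.+-comm 1 k)) (ℕP.+-monoʳ-≤ k (ℕ.s≤s ℕ.z≤n))))))))

  majTerm-decay : ∀ j → majTerm B (j ℕ.+ K) ≤ D * 1/1+ (j ℕ.+ K)
  majTerm-decay zero = ≤-reflexive (sym (trans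
    (solve 3 (λ a b c → (a :* b) :* c := (a :* c) :* b) refl (fromℕ (suc K)) (majTerm B K) (1/1+ K))
    (trans (cong (_* majTerm B K) (1/1+-inverse K)) (*-identityˡ (majTerm B K)))))
  majTerm-decay (suc j) = begin
    majTerm B (suc (j ℕ.+ K))       ≤⟨ halving (ℕP.m≤n+m K j) ⟩
    ½ * majTerm B (j ℕ.+ K)         ≤⟨ *-monoˡ-≤-nonNeg ½ (majTerm-decay j) ⟩
    ½ * (D * 1/1+ (j ℕ.+ K))        ≡⟨ solve 3 (λ a b c → a :* (b :* c) := b :* (a :* c)) refl ½ D (1/1+ (j ℕ.+ K)) ⟩
    D * (½ * 1/1+ (j ℕ.+ K))        ≤⟨ *-monoˡ-≤-nonNeg D {{ℚ.nonNegative 0≤D}} (½1/1+ (j ℕ.+ K)) ⟩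
    D * 1/1+ (suc (j ℕ.+ K))        ∎
    where open ≤-Reasoning

  majTerm-≤ : ∀ {n} → K ℕ.≤ n → majTerm B n ≤ D * 1/1+ n
  majTerm-≤ {n} h = subst (λ k → majTerm B k ≤ D * 1/1+ k) (ℕP.m∸n+n≡m h) (majTerm-decay (n ℕ.∸ K))

  majSum-mono : ∀ n j → majSum B n ≤ majSum B (j ℕ.+ n)
  majSum-mono n zero    = ≤-refl
  majSum-mono n (suc j) = ≤-trans (majSum-mono n j) (p≤p+q (0≤majTerm (j ℕ.+ n)))

  majSum-tail : ∀ {n} → K ℕ.≤ n → ∀ j →
    majSum B (j ℕ.+ n) + fromℕ 2 * majTerm B (j ℕ.+ n) ≤ majSum B n + fromℕ 2 * majTerm B n
  majSum-tail h zero = ≤-refl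
  majSum-tail {n} h (suc j) = ≤-trans
    (≤-trans
      (+-monoʳ-≤ (majSum B (suc j ℕ.+ n))
        (*-monoˡ-≤-nonNeg (fromℕ 2) (halving (ℕP.≤-trans h (ℕP.m≤n+m n j)))))
      (≤-reflexive (trans
        (cong₂ (λ a b → majSum B (j ℕ.+ n) + a + b)
          (sym (*-identityˡ u)) (sym (*-assoc (fromℕ 2) ½ u)))
        (trans (+-assoc (majSum B (j ℕ.+ n)) (1ℚ * u) (1ℚ * u))
          (cong (majSum B (j ℕ.+ n) +_) (sym (*-distribʳ-+ u 1ℚ 1ℚ)))))))
    (majSum-tail h j)
    where u = majTerm B (j ℕ.+ n)

  majSum-gap : ∀ {n} → K ℕ.≤ n → ∀ j →
    ∣ majSum B (j ℕ.+ n) - majSum B n ∣ ≤ fromℕ 2 * D * 1/1+ n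
  majSum-gap {n} h j = ≤-trans
    (≤-reflexive (0≤p⇒∣p∣≡p (p≤q⇒0≤q-p (majSum-mono n j))))
    (p≤q+r⇒p-q≤r {majSum B (j ℕ.+ n)} {majSum B n} (≤-trans (p≤p+q {majSum B (j ℕ.+ n)} (0≤* (0≤fromℕ 2) (0≤majTerm (j ℕ.+ n))))
      (≤-trans (majSum-tail h j) (+-monoʳ-≤ (majSum B n) (≤-trans
        (*-monoˡ-≤-nonNeg (fromℕ 2) (majTerm-≤ h))
        (≤-reflexive (sym (*-assoc (fromℕ 2) D (1/1+ n)))))))))

  2D : ℚ
  2D = fromℕ 2 * D

  0≤2D : 0ℚ ≤ 2D
  0≤2D = 0≤* (0≤fromℕ 2) 0≤D

  majSum-close : ∀ m n → K ℕ.≤ m → K ℕ.≤ n →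
    ∣ majSum B m - majSum B n ∣ ≤ 2D * (1/1+ m + 1/1+ n)
  majSum-close m n hm hn with ℕP.≤-total n m
  ... | inj₁ n≤m = ≤-trans
    (subst (λ k → ∣ majSum B k - majSum B n ∣ ≤ 2D * 1/1+ n) (ℕP.m∸n+n≡m n≤m) (majSum-gap hn (m ℕ.∸ n)))
    (*-monoˡ-≤-nonNeg 2D {{ℚ.nonNegative 0≤2D}} (q≤p+q (0≤1/1+ m)))
  ... | inj₂ m≤n = ≤-trans (≤-reflexive (∣p-q∣≡∣q-p∣ (majSum B m) (majSum B n))) (≤-trans
    (subst (λ k → ∣ majSum B k - majSum B m ∣ ≤ 2D * 1/1+ m) (ℕP.m∸n+n≡m m≤n) (majSum-gap hm (n ℕ.∸ m)))
    (*-monoˡ-≤-nonNeg 2D {{ℚ.nonNegative 0≤2D}} (p≤p+q (0≤1/1+ n))))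

  majSum-cauchy : IsCauchy (majSum B)
  majSum-cauchy = vanishing-≤ K majSum-close (vanishing-* 0≤2D vanishing-1/1+)

  term-bound : ∀ z k → ‖ z ‖ ≤ B → ‖ expTerm z k ‖ ≤ majTerm B k
  term-bound z zero    _ = ≤-refl
  term-bound z (suc k) h = begin
    ‖ 1/1+ k · (expTerm z k ⊗ z) ‖     ≡⟨ ‖·‖ (expTerm z k ⊗ z) (0≤1/1+ k) ⟩
    1/1+ k * ‖ expTerm z k ⊗ z ‖       ≤⟨ *-monoˡ-≤-nonNeg (1/1+ k) (≤-trans (‖⊗‖ (expTerm z k) z)
                                            (*-mono (0≤‖‖ (expTerm z k)) 0≤B (term-bound z k h) h)) ⟩
    1/1+ k * (majTerm B k * B)         ∎
    where open ≤-Reasoning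

  sum-gap : ∀ z n j → ‖ z ‖ ≤ B →
    ‖ expSum z (j ℕ.+ n) ⊖ expSum z n ‖ ≤ majSum B (j ℕ.+ n) - majSum B n
  sum-gap z n zero h = ≤-reflexive (trans
    (cong₂ (λ a b → ∣ a ∣ + ∣ b ∣) (+-inverseʳ (proj₁ (expSum z n))) (+-inverseʳ (proj₂ (expSum z n))))
    (sym (+-inverseʳ (majSum B n))))
  sum-gap z n (suc j) h = begin
    ‖ (S ⊕ t) ⊖ T ‖      ≡⟨ cong ‖_‖ (cong₂ _,_ (swap (proj₁ S) (proj₁ t) (proj₁ T)) (swap (proj₂ S) (proj₂ t) (proj₂ T))) ⟩
    ‖ (S ⊖ T) ⊕ t ‖      ≤⟨ ‖⊕‖ (S ⊖ T) t ⟩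
    ‖ S ⊖ T ‖ + ‖ t ‖    ≤⟨ +-mono-≤ (sum-gap z n j h) (term-bound z (j ℕ.+ n) h) ⟩
    majSum B (j ℕ.+ n) - majSum B n + majTerm B (j ℕ.+ n)
                         ≡⟨ sym (swap (majSum B (j ℕ.+ n)) (majTerm B (j ℕ.+ n)) (majSum B n)) ⟩
    majSum B (suc j ℕ.+ n) - majSum B n ∎
    where
    open ≤-Reasoning
    S = expSum z (j ℕ.+ n)
    T = expSum z n
    t = expTerm z (j ℕ.+ n)
    swap : ∀ a b c → (a + b) - c ≡ (a - c) + b
    swap = solve 3 (λ a b c → (a :+ b) :- c := (a :- c) :+ b) refl

  sum-close : ∀ z m n → ‖ z ‖ ≤ B → K ℕ.≤ m → K ℕ.≤ n →
    ‖ expSum z m ⊖ expSum z n ‖ ≤ 2D * (1/1+ m + 1/1+ n)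
  sum-close z m n h hm hn = ≤-trans (step m n) (majSum-close m n hm hn)
    where
    up : ∀ {m n} → n ℕ.≤ m → ‖ expSum z m ⊖ expSum z n ‖ ≤ ∣ majSum B m - majSum B n ∣
    up {m} {n} n≤m = subst (λ k → ‖ expSum z k ⊖ expSum z n ‖ ≤ ∣ majSum B k - majSum B n ∣)
      (ℕP.m∸n+n≡m n≤m)
      (≤-trans (sum-gap z n (m ℕ.∸ n) h)
        (≤-reflexive (sym (0≤p⇒∣p∣≡p (p≤q⇒0≤q-p (majSum-mono n (m ℕ.∸ n)))))))
    step : ∀ m n → ‖ expSum z m ⊖ expSum z n ‖ ≤ ∣ majSum B m - majSum B n ∣
    step m n with ℕP.≤-total n m
    ... | inj₁ n≤m = up n≤m
    ... | inj₂ m≤n = subst₂ _≤_ (‖⊖‖-sym (expSum z n) (expSum z m)) (∣p-q∣≡∣q-p∣ (majSum B n) (majSum B m)) (up m≤n)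

  term-lipschitz : ∀ z w k → ‖ z ‖ ≤ B → ‖ w ‖ ≤ B →
    ‖ expTerm z (suc k) ⊖ expTerm w (suc k) ‖ ≤ majTerm B k * ‖ z ⊖ w ‖
  term-lipschitz (a , b) (c , d) zero _ _ = ≤-reflexive (trans
    (cong₂ (λ p q → ∣ p ∣ + ∣ q ∣) (first a b c d) (second a b c d))
    (sym (*-identityˡ _)))
    where
    first : ∀ a b c d → 1ℚ * (1ℚ * a - 0ℚ * b) - 1ℚ * (1ℚ * c - 0ℚ * d) ≡ a - c
    first = solve 4 (λ a b c d → con 1ℚ :* (con 1ℚ :* a :- con 0ℚ :* b) :- con 1ℚ :* (con 1ℚ :* c :- con 0ℚ :* d) := a :- c) refl
    second : ∀ a b c d → 1ℚ * (1ℚ * b + 0ℚ * a) - 1ℚ * (1ℚ * d + 0ℚ * c) ≡ b - d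
    second = solve 4 (λ a b c d → con 1ℚ :* (con 1ℚ :* b :+ con 0ℚ :* a) :- con 1ℚ :* (con 1ℚ :* d :+ con 0ℚ :* c) := b :- d) refl
  term-lipschitz z@(a , b) w@(c , d) (suc k) hz hw = begin
    ‖ r · (u ⊗ z) ⊖ r · (v ⊗ w) ‖
      ≡⟨ cong ‖_‖ (cong₂ _,_ (re-eq r (proj₁ u) (proj₂ u) (proj₁ v) (proj₂ v) a b c d)
                             (im-eq r (proj₁ u) (proj₂ u) (proj₁ v) (proj₂ v) a b c d)) ⟩
    ‖ r · ((u ⊖ v) ⊗ z ⊕ v ⊗ (z ⊖ w)) ‖
      ≡⟨ ‖·‖ ((u ⊖ v) ⊗ z ⊕ v ⊗ (z ⊖ w)) (0≤1/1+ (suc k)) ⟩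
    r * ‖ (u ⊖ v) ⊗ z ⊕ v ⊗ (z ⊖ w) ‖
      ≤⟨ *-monoˡ-≤-nonNeg r (≤-trans (‖⊕‖ ((u ⊖ v) ⊗ z) (v ⊗ (z ⊖ w)))
           (+-mono-≤ (‖⊗‖ (u ⊖ v) z) (‖⊗‖ v (z ⊖ w)))) ⟩
    r * (‖ u ⊖ v ‖ * ‖ z ‖ + ‖ v ‖ * ‖ z ⊖ w ‖)
      ≤⟨ *-monoˡ-≤-nonNeg r (+-mono-≤
           (*-mono (0≤‖‖ (u ⊖ v)) 0≤B (term-lipschitz z w k hz hw) hz)
           (*-monoʳ-≤-nonNeg δ {{ℚ.nonNegative (0≤‖‖ (z ⊖ w))}} (term-bound w (suc k) hw))) ⟩
    r * (majTerm B k * δ * B + 1/1+ k * (majTerm B k * B) * δ)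
      ≡⟨ solve 5 (λ r t δ B s → r :* (t :* δ :* B :+ s :* (t :* B) :* δ)
                             := (r :* (con 1ℚ :+ s)) :* (t :* B) :* δ) refl r (majTerm B k) δ B (1/1+ k) ⟩
    r * (1ℚ + 1/1+ k) * (majTerm B k * B) * δ
      ≡⟨ cong (λ q → q * (majTerm B k * B) * δ) coefficient ⟩
    1/1+ k * (majTerm B k * B) * δ ∎
    where
    open ≤-Reasoning
    r = 1/1+ suc k
    u = expTerm z (suc k)
    v = expTerm w (suc k)
    δ = ‖ z ⊖ w ‖
    re-eq : ∀ r u₁ u₂ v₁ v₂ a b c d →
      r * (u₁ * a - u₂ * b) - r * (v₁ * c - v₂ * d)
      ≡ r * (((u₁ - v₁) * a - (u₂ - v₂) * b) + (v₁ * (a - c) - v₂ * (b - d)))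
    re-eq = solve 9 (λ r u₁ u₂ v₁ v₂ a b c d →
      r :* (u₁ :* a :- u₂ :* b) :- r :* (v₁ :* c :- v₂ :* d)
      := r :* (((u₁ :- v₁) :* a :- (u₂ :- v₂) :* b) :+ (v₁ :* (a :- c) :- v₂ :* (b :- d)))) refl
    im-eq : ∀ r u₁ u₂ v₁ v₂ a b c d →
      r * (u₁ * b + u₂ * a) - r * (v₁ * d + v₂ * c)
      ≡ r * (((u₁ - v₁) * b + (u₂ - v₂) * a) + (v₁ * (b - d) + v₂ * (a - c)))
    im-eq = solve 9 (λ r u₁ u₂ v₁ v₂ a b c d →
      r :* (u₁ :* b :+ u₂ :* a) :- r :* (v₁ :* d :+ v₂ :* c)
      := r :* (((u₁ :- v₁) :* b :+ (u₂ :- v₂) :* a) :+ (v₁ :* (b :- d) :+ v₂ :* (a :- c)))) refl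
    -- (1/(k+2)) (1 + 1/(k+1)) = 1/(k+1)
    coefficient : r * (1ℚ + 1/1+ k) ≡ 1/1+ k
    coefficient = trans (cong (r *_) sum-eq)
      (trans (sym (*-assoc r (fromℕ (suc (suc k))) (1/1+ k)))
        (trans (cong (_* 1/1+ k) (trans (*-comm r (fromℕ (suc (suc k)))) (1/1+-inverse (suc k))))
          (*-identityˡ (1/1+ k))))
      where
      sum-eq : 1ℚ + 1/1+ k ≡ fromℕ (suc (suc k)) * 1/1+ k
      sum-eq = trans (cong (_+ 1/1+ k) (sym (1/1+-inverse k)))
        (trans (solve 2 (λ a b → a :* b :+ b := (con 1ℚ :+ a) :* b) refl (fromℕ (suc k)) (1/1+ k))
          (cong (_* 1/1+ k) (fromℕ-1+ (suc k))))

  sum-lipschitz : ∀ z w n → ‖ z ‖ ≤ B → ‖ w ‖ ≤ B →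
    ‖ expSum z (suc n) ⊖ expSum w (suc n) ‖ ≤ majSum B n * ‖ z ⊖ w ‖
  sum-lipschitz z w zero _ _ = ≤-reflexive (sym (*-zeroˡ ‖ z ⊖ w ‖))
  sum-lipschitz z w (suc n) hz hw = begin
    ‖ (S ⊕ s) ⊖ (T ⊕ t) ‖       ≡⟨ cong ‖_‖ (cong₂ _,_ (regroup (proj₁ S) (proj₁ s) (proj₁ T) (proj₁ t))
                                                       (regroup (proj₂ S) (proj₂ s) (proj₂ T) (proj₂ t))) ⟩
    ‖ (S ⊖ T) ⊕ (s ⊖ t) ‖       ≤⟨ ‖⊕‖ (S ⊖ T) (s ⊖ t) ⟩
    ‖ S ⊖ T ‖ + ‖ s ⊖ t ‖       ≤⟨ +-mono-≤ (sum-lipschitz z w n hz hw) (term-lipschitz z w n hz hw) ⟩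
    majSum B n * ‖ z ⊖ w ‖ + majTerm B n * ‖ z ⊖ w ‖
                                ≡⟨ sym (*-distribʳ-+ ‖ z ⊖ w ‖ (majSum B n) (majTerm B n)) ⟩
    majSum B (suc n) * ‖ z ⊖ w ‖ ∎
    where
    open ≤-Reasoning
    S = expSum z (suc n)
    T = expSum w (suc n)
    s = expTerm z (suc n)
    t = expTerm w (suc n)
    regroup : ∀ a b c d → (a + b) - (c + d) ≡ (a - c) + (b - d)
    regroup = solve 4 (λ a b c d → (a :+ b) :- (c :+ d) := (a :- c) :+ (b :- d)) refl

expSeq-vanishing : ∀ z → Vanishing (λ m n → ‖ expSeq z m ⊖ expSeq z n ‖)
expSeq-vanishing z
  with cauchy-bounded {seq (re z)} (cauchy (re z)) | cauchy-bounded {seq (im z)} (cauchy (im z))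
... | A₁ , h₁ | A₂ , h₂ with archimedean-large (A₁ + A₂)
... | M , A≤M with cauchy-bounded (Majorant.majSum-cauchy M)
... | C , hC = vanishing-≤ (suc K) bound
    (vanishing-+
      (vanishing-* 0≤C (vanishing-+ (cauchy (re z)) (cauchy (im z))))
      (vanishing-* 0≤2D vanishing-1/1+))
  where
  open Majorant M
  open ≤-Reasoning

  0≤C : 0ℚ ≤ C
  0≤C = ≤-trans (0≤∣p∣ (majSum B 0)) (hC 0)

  norm-bound : ∀ n → ‖ approx z n ‖ ≤ B
  norm-bound n = ≤-trans (+-mono-≤ (h₁ n) (h₂ n)) A≤M

  bound : ∀ m n → suc K ℕ.≤ m → suc K ℕ.≤ n →
    ‖ expSeq z m ⊖ expSeq z n ‖
    ≤ C * ‖ approx z m ⊖ approx z n ‖ + 2D * (1/1+ m + 1/1+ n)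
  bound m@(suc m′) n hm hn = begin
    ‖ E ⊖ G ‖                   ≡⟨ cong ‖_‖ (cong₂ _,_ (insert (proj₁ E) (proj₁ F) (proj₁ G))
                                                       (insert (proj₂ E) (proj₂ F) (proj₂ G))) ⟩
    ‖ (E ⊖ F) ⊕ (F ⊖ G) ‖       ≤⟨ ‖⊕‖ (E ⊖ F) (F ⊖ G) ⟩
    ‖ E ⊖ F ‖ + ‖ F ⊖ G ‖       ≤⟨ +-mono-≤
        (≤-trans (sum-lipschitz (approx z m) (approx z n) m′ (norm-bound m) (norm-bound n))
          (*-monoʳ-≤-nonNeg δ {{ℚ.nonNegative (0≤‖‖ (approx z m ⊖ approx z n))}}
            (≤-trans (≤-reflexive (sym (0≤p⇒∣p∣≡p (0≤majSum m′)))) (hC m′))))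
        (sum-close (approx z n) m n (norm-bound n) (ℕP.≤-trans (ℕP.n≤1+n K) hm) (ℕP.≤-trans (ℕP.n≤1+n K) hn)) ⟩
    C * δ + 2D * (1/1+ m + 1/1+ n) ∎
    where
    E = expSum (approx z m) m
    F = expSum (approx z n) m
    G = expSum (approx z n) n
    δ = ‖ approx z m ⊖ approx z n ‖
    insert : ∀ a b c → a - c ≡ (a - b) + (b - c)
    insert = solve 3 (λ a b c → a :- c := (a :- b) :+ (b :- c)) refl

exp : ℂ → ℂ
exp z =
  mkℝ (λ n → proj₁ (expSeq z n))
    (vanishing-≤ 0 (λ m n _ _ → p≤p+q {∣ proj₁ (expSeq z m) - proj₁ (expSeq z n) ∣} (0≤∣p∣ _)) (expSeq-vanishing z))
  +i
  mkℝ (λ n → proj₂ (expSeq z n))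
    (vanishing-≤ 0 (λ m n _ _ → q≤p+q {∣ proj₁ (expSeq z m) - proj₁ (expSeq z n) ∣} (0≤∣p∣ _)) (expSeq-vanishing z))

-- harmonic a L = ∑_{j=a+1}^{a+L} 1/j
harmonic : ℕ → ℕ → ℚ
harmonic a zero    = 0ℚ
harmonic a (suc L) = harmonic a L + 1/1+ (a ℕ.+ L)

-- The right Riemann sum of ∫₁ⁿ dx/x with mesh 1/m, where m = suc i:
-- ∑_{j=m+1}^{nm} (1/m)·1/(j/m). Its limit as m → ∞ is log n.
logSeq : ℕ → ℕ → ℚ
logSeq n i = harmonic (suc i) ((n ℕ.∸ 1) ℕ.* suc i)

fromℕ-* : ∀ m n → fromℕ m * fromℕ n ≡ fromℕ (m ℕ.* n)
fromℕ-* m n = toℚᵘ-injective (ℚᵘP.≃-trans (toℚᵘ-homo-* (fromℕ m) (fromℕ n))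
  (ℚᵘ.*≡* (cong (ℤ._* ℤ.+ 1) (sym (ℤP.pos-* m n)))))

harmonic-split : ∀ a L M → harmonic a (L ℕ.+ M) ≡ harmonic a L + harmonic (a ℕ.+ L) M
harmonic-split a L zero = trans (cong (harmonic a) (ℕP.+-identityʳ L)) (sym (+-identityʳ (harmonic a L)))
harmonic-split a L (suc M) = trans (cong (harmonic a) (ℕP.+-suc L M))
  (trans (cong₂ _+_ (harmonic-split a L M) (cong 1/1+_ (sym (ℕP.+-assoc a L M))))
    (+-assoc (harmonic a L) (harmonic (a ℕ.+ L) M) (1/1+ (a ℕ.+ L ℕ.+ M))))

fromℕ-suc-* : ∀ n c → fromℕ n * c + c ≡ fromℕ (suc n) * c
fromℕ-suc-* n c = trans
  (solve 2 (λ a c → a :* c :+ c := (con 1ℚ :+ a) :* c) refl (fromℕ n) c)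
  (cong (_* c) (fromℕ-1+ n))

harmonic-≤ : ∀ a L {c} → (∀ i → i ℕ.< L → 1/1+ (a ℕ.+ i) ≤ c) → harmonic a L ≤ fromℕ L * c
harmonic-≤ a zero    {c} h = ≤-reflexive (sym (*-zeroˡ c))
harmonic-≤ a (suc L) {c} h = ≤-trans
  (+-mono-≤ (harmonic-≤ a L (λ i i<L → h i (ℕP.m≤n⇒m≤1+n i<L))) (h L ℕP.≤-refl))
  (≤-reflexive (fromℕ-suc-* L c))

harmonic-≥ : ∀ a L {c} → (∀ i → i ℕ.< L → c ≤ 1/1+ (a ℕ.+ i)) → fromℕ L * c ≤ harmonic a L
harmonic-≥ a zero    {c} h = ≤-reflexive (*-zeroˡ c)
harmonic-≥ a (suc L) {c} h = ≤-trans
  (≤-reflexive (sym (fromℕ-suc-* L c)))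
  (+-mono-≤ (harmonic-≥ a L (λ i i<L → h i (ℕP.m≤n⇒m≤1+n i<L))) (h L ℕP.≤-refl))

module Refinement (k′ : ℕ) where

  k : ℕ
  k = suc k′

  block-term : ∀ a → fromℕ k * 1/1+ (a ℕ.* k ℕ.+ k′) ≡ 1/1+ a
  block-term a = trans (sym (*-identityˡ (fromℕ k * t)))
    (trans (cong (_* (fromℕ k * t)) (sym (trans (*-comm (1/1+ a) (fromℕ (suc a))) (1/1+-inverse a))))
    (trans (solve 4 (λ p q r t → p :* q :* (r :* t) := p :* (q :* r :* t)) refl (1/1+ a) (fromℕ (suc a)) (fromℕ k) t)
    (trans (cong (1/1+ a *_) (trans (cong (_* t) (trans (fromℕ-* (suc a) k) (cong fromℕ size)))
      (1/1+-inverse (a ℕ.* k ℕ.+ k′))))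
    (*-identityʳ (1/1+ a)))))
    where
    t = 1/1+ (a ℕ.* k ℕ.+ k′)
    size : suc a ℕ.* k ≡ suc (a ℕ.* k ℕ.+ k′)
    size = cong suc (ℕP.+-comm k′ (a ℕ.* k))

  block-≥ : ∀ b → 1/1+ b ≤ harmonic (b ℕ.* k) k
  block-≥ b = ≤-trans (≤-reflexive (sym (block-term b)))
    (harmonic-≥ (b ℕ.* k) k (λ i i<k → 1/1+-antitone (ℕP.+-monoʳ-≤ (b ℕ.* k) (ℕ.s≤s⁻¹ i<k))))

  block-≤ : ∀ b → harmonic (suc b ℕ.* k) k ≤ 1/1+ b
  block-≤ b = ≤-trans
    (harmonic-≤ (suc b ℕ.* k) k (λ i _ → 1/1+-antitone
      (ℕP.≤-trans (ℕP.≤-reflexive (ℕP.+-comm (b ℕ.* k) k′))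
        (ℕP.≤-trans (ℕP.n≤1+n _) (ℕP.m≤m+n (suc b ℕ.* k) i)))))
    (≤-reflexive (block-term b))

  refine-suc : ∀ a L → harmonic (a ℕ.* k) (suc L ℕ.* k)
                       ≡ harmonic (a ℕ.* k) (L ℕ.* k) + harmonic ((a ℕ.+ L) ℕ.* k) k
  refine-suc a L = trans (cong (harmonic (a ℕ.* k)) (ℕP.+-comm k (L ℕ.* k)))
    (trans (harmonic-split (a ℕ.* k) (L ℕ.* k) k)
      (cong (λ b → harmonic (a ℕ.* k) (L ℕ.* k) + harmonic b k) (sym (ℕP.*-distribʳ-+ k a L))))

  refine-≥ : ∀ a L → harmonic a L ≤ harmonic (a ℕ.* k) (L ℕ.* k)
  refine-≥ a zero    = ≤-refl
  refine-≥ a (suc L) = ≤-trans (+-mono-≤ (refine-≥ a L) (block-≥ (a ℕ.+ L)))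
    (≤-reflexive (sym (refine-suc a L)))

  refine-≤ : ∀ a L → harmonic (suc a ℕ.* k) (L ℕ.* k) ≤ harmonic (suc a) L + (1/1+ a - 1/1+ (a ℕ.+ L))
  refine-≤ a zero = ≤-reflexive (sym (trans (+-identityˡ _)
    (trans (cong (λ b → 1/1+ a - 1/1+ b) (ℕP.+-identityʳ a)) (+-inverseʳ (1/1+ a)))))
  refine-≤ a (suc L) = begin
    harmonic (suc a ℕ.* k) (suc L ℕ.* k)
      ≡⟨ refine-suc (suc a) L ⟩
    harmonic (suc a ℕ.* k) (L ℕ.* k) + harmonic (suc (a ℕ.+ L) ℕ.* k) k
      ≤⟨ +-mono-≤ (refine-≤ a L) (block-≤ (a ℕ.+ L)) ⟩
    harmonic (suc a) L + (1/1+ a - 1/1+ (a ℕ.+ L)) + 1/1+ (a ℕ.+ L)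
      ≡⟨ solve 4 (λ h p q r → h :+ (p :- q) :+ q := h :+ r :+ (p :- r)) refl
           (harmonic (suc a) L) (1/1+ a) (1/1+ (a ℕ.+ L)) (1/1+ suc (a ℕ.+ L)) ⟩
    harmonic (suc a) (suc L) + (1/1+ a - 1/1+ suc (a ℕ.+ L))
      ≡⟨ cong (λ b → harmonic (suc a) (suc L) + (1/1+ a - 1/1+ b)) (sym (ℕP.+-suc a L)) ⟩
    harmonic (suc a) (suc L) + (1/1+ a - 1/1+ (a ℕ.+ suc L)) ∎
    where open ≤-Reasoning

logSeq-step : ∀ n i p → logSeq n i ≤ logSeq n p + 1/1+ p
logSeq-step n i p = begin
  harmonic (suc i) (N ℕ.* suc i)                           ≤⟨ Refinement.refine-≥ p (suc i) (N ℕ.* suc i) ⟩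
  harmonic (suc i ℕ.* suc p) (N ℕ.* suc i ℕ.* suc p)       ≡⟨ cong₂ harmonic (ℕP.*-comm (suc i) (suc p)) swap ⟩
  harmonic (suc p ℕ.* suc i) (N ℕ.* suc p ℕ.* suc i)       ≤⟨ Refinement.refine-≤ i p (N ℕ.* suc p) ⟩
  logSeq n p + (1/1+ p - 1/1+ (p ℕ.+ N ℕ.* suc p))         ≤⟨ +-monoʳ-≤ (logSeq n p) drop ⟩
  logSeq n p + 1/1+ p                                      ∎
  where
  open ≤-Reasoning
  N = n ℕ.∸ 1
  swap : N ℕ.* suc i ℕ.* suc p ≡ N ℕ.* suc p ℕ.* suc i
  swap = trans (ℕP.*-assoc N (suc i) (suc p))
    (trans (cong (N ℕ.*_) (ℕP.*-comm (suc i) (suc p))) (sym (ℕP.*-assoc N (suc p) (suc i))))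
  drop : 1/1+ p - 1/1+ (p ℕ.+ N ℕ.* suc p) ≤ 1/1+ p
  drop = p≤q+r⇒p-q≤r {1/1+ p} {1/1+ (p ℕ.+ N ℕ.* suc p)} (q≤p+q (0≤1/1+ (p ℕ.+ N ℕ.* suc p)))

log : (n : ℕ) .{{_ : NonZero n}} → ℝ
log n = mkℝ (logSeq n) (vanishing-≤ 0
  (λ i p _ _ → ∣-∣-bound {logSeq n i} {logSeq n p}
    (≤-trans (p≤q+r⇒p-q≤r {logSeq n i} {logSeq n p} (logSeq-step n i p)) (q≤p+q (0≤1/1+ i)))
    (≤-trans (p≤q+r⇒p-q≤r {logSeq n p} {logSeq n i} (logSeq-step n p i)) (p≤p+q (0≤1/1+ p))))
  vanishing-1/1+)

infixr 9 _^ᶜ_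

_^ᶜ_ : (n : ℕ) .{{_ : NonZero n}} → ℂ → ℂ
n ^ᶜ s = exp (s *ᶜ fromℝ (log n))

-- ∣ zₙ - w ∣ < ε, squared to avoid the square root.
_⟶_ : (ℕ → ℂ) → ℂ → Set
z ⟶ w = ∀ ε → 0ℚ < ε → ∃[ N ] (∀ n → N ℕ.≤ n → ∣ z n -ᶜ w ∣² <ʳ fromℚ (ε * ε))

infix 4 _⟶_

-- ∑₁ f N = f 1 + ⋯ + f N, where f is only given on positive indices
∑₁ : ((n : ℕ) .{{_ : NonZero n}} → ℂ) → ℕ → ℂ
∑₁ f zero    = 0ᶜ
∑₁ f (suc n) = ∑₁ f n +ᶜ f (suc n)

-- ∑_{n≥1} aₙ n⁻ˢ converges to S; the value of a at 0 is irrelevant.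
DirichletSeries : (ℕ → ℝ) → ℂ → ℂ → Set
DirichletSeries a s S = ∑₁ (λ n → fromℝ (a n) *ᶜ n ^ᶜ (-ᶜ s)) ⟶ S

-- sign n = (-1)ⁿ
sign : ℕ → ℝ
sign zero    = 1ʳ
sign (suc n) = -ʳ sign n

IsZeta IsEta : ℂ → ℂ → Set
IsZeta = DirichletSeries (λ _ → 1ʳ)
IsEta  = DirichletSeries (λ n → sign (n ℕ.∸ 1))

-- c = a / b, where b is nonzero in the constructively positive sense.
IsQuotient : ℂ → ℂ → ℂ → Set
IsQuotient a b c = 0ʳ <ʳ ∣ b ∣² × c *ᶜ b ≈ᶜ a

thueMorse : ℕ → ℕ
thueMorse n = sum (map toℕ (proj₁ (toDigits 2 n))) % 2

t : ℕ → ℝ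
t n = fromℚ (fromℕ (thueMorse n))

q : ℝ → ℕ → ℝ
q k n = t n -ʳ k

r : ℝ → ℕ → ℝ
r ℓ n = t n +ʳ ℓ

Λ : ℂ → ℝ → ℝ → ℂ
Λ s k ℓ = 2 ^ᶜ s -ᶜ (2 ^ᶜ s *ᶜ fromℝ (k -ʳ ℓ) +ᶜ fromℝ (k +ʳ ℓ))

-- Since t₂ₙ = tₙ and t₂ₙ₊₁ = 1 - tₙ, the partial sums of the three series satisfy
--   Q_{2N+1} + R_{2N+1} + 2⁻ˢ (Q_N - R_N) = (1 - k + ℓ) Z_{2N+1} - (k + ℓ) 2⁻ˢ Z_N,
-- so in the limit (2ˢ + 1) Q + (2ˢ - 1) R = λ(s; k, ℓ) ζ, and likewise 2ˢ η = (2ˢ - 2) ζ.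
-- The three cases are the values 0, 2ˢ and 2ˢ - 2 of λ(s; k, ℓ); in the first one
-- 1 + 2ˢ is invertible because ∣2ˢ∣ ≥ 3/2.
-- Convergence comes from log (n + 1) - log n ≥ 1/(n + 1) and ∣exp z∣ ≥ 1 + re z: the terms
-- satisfy ∣(n + 1)⁻ˢ∣ (1 + (1 + θ)/(n + 1)) ≤ ∣n⁻ˢ∣ for a rational θ > 0, which is Kummer's test.

module Submission where

open import Defs
open import Algebra.Bundles using (CommutativeRing)
import Algebra.Solver.Ring.AlmostCommutativeRing as ACR
import Algebra.Solver.Ring.Simple as RingSolver
open import Data.Digit using (Expansion; fromDigits; toDigits)
open import Data.Fin.Base as Fin using (Fin; toℕ)
open import Data.List.Base using ([]; _∷_; map)
open import Data.Nat.Base as ℕ using (ℕ; zero; suc; _∸_; NonZero)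
open import Data.Nat.DivMod using (_%_; m%n<n)
open import Data.Nat.ListAction using (sum)
import Data.Nat.Properties as ℕP
open import Data.Product.Base using (∃-syntax; _×_; _,_; proj₁; proj₂)
open import Data.Product.Properties using (≡-dec)
open import Data.Rational.Base as ℚ
  using (ℚ; 0ℚ; 1ℚ; ½; _+_; _*_; -_; _-_; ∣_∣; _≤_; _<_)
open import Data.Rational.Properties hiding (≃-sym)
open import Data.Rational.Solver using (module +-*-Solver)
open import Data.Sum.Base using (inj₁; inj₂)
open import Function.Base using (_∘_)
open import Relation.Binary.Bundles using (Setoid)
open import Relation.Binary.PropositionalEquality
  using (_≡_; refl; sym; trans; cong; cong₂; subst; subst₂; isEquivalence; module ≡-Reasoning)
import Relation.Binary.Reasoning.Setoid as SetoidReasoning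
open import Relation.Nullary.Negation using (contradiction)

open +-*-Solver using (solve; _:=_; _:+_; _:*_; _:-_; :-_; con)

-- Every number is a sequence of rationals and all arithmetic acts index by index, so a polynomial
-- identity between complex numbers already holds in `ℚ[i]` at each index, where a ring solver
-- settles it. Estimates are needed only where representatives truly differ: additivity of the
-- exponential, log 2n = log 2 + log n, and limits of series. The four sums have to be produced, and
-- a real number carries no fixed rate of convergence, so each limit is built from a diagonal choice
-- of approximations. Staying within the rationals also shapes the convergence proof. A comparison
-- with the powers n^-(1+θ) would bring real powers back in, whereas a recursion for ratios yields a
-- rational majorant whose sums telescope. Moduli occur only squared: ∣exp z∣² = exp (2 re z)
-- follows from additivity and conjugation, with neither square roots nor trigonometry.

neg : ℚ[i] → ℚ[i]
neg (a , b) = - a , - b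

0ᵢ 1ᵢ : ℚ[i]
0ᵢ = 0ℚ , 0ℚ
1ᵢ = 1ℚ , 0ℚ

conj : ℚ[i] → ℚ[i]
conj (a , b) = a , - b

⊕-⊗-commutativeRing : CommutativeRing _ _
⊕-⊗-commutativeRing = record
  { Carrier = ℚ[i] ; _≈_ = _≡_ ; _+_ = _⊕_ ; _*_ = _⊗_ ; -_ = neg ; 0# = 0ᵢ ; 1# = 1ᵢ
  ; isCommutativeRing = record
    { isRing = record
      { +-isAbelianGroup = record
        { isGroup = record
          { isMonoid = record
            { isSemigroup = record
              { isMagma = record { isEquivalence = isEquivalence ; ∙-cong = cong₂ _⊕_ }
              ; assoc = λ { (a , b) (c , d) (e , f) → cong₂ _,_ (+-assoc a c e) (+-assoc b d f) }
              }
            ; identity = (λ { (a , b) → cong₂ _,_ (+-identityˡ a) (+-identityˡ b) })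
                       , (λ { (a , b) → cong₂ _,_ (+-identityʳ a) (+-identityʳ b) })
            }
          ; inverse = (λ { (a , b) → cong₂ _,_ (+-inverseˡ a) (+-inverseˡ b) })
                    , (λ { (a , b) → cong₂ _,_ (+-inverseʳ a) (+-inverseʳ b) })
          ; ⁻¹-cong = cong neg
          }
        ; comm = λ { (a , b) (c , d) → cong₂ _,_ (+-comm a c) (+-comm b d) }
        }
      ; *-cong = cong₂ _⊗_
      ; *-assoc = λ { (a , b) (c , d) (e , f) → cong₂ _,_
          (solve 6 (λ a b c d e f → (a :* c :- b :* d) :* e :- (a :* d :+ b :* c) :* f
             := a :* (c :* e :- d :* f) :- b :* (c :* f :+ d :* e)) refl a b c d e f)
          (solve 6 (λ a b c d e f → (a :* c :- b :* d) :* f :+ (a :* d :+ b :* c) :* e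
             := a :* (c :* f :+ d :* e) :+ b :* (c :* e :- d :* f)) refl a b c d e f) }
      ; *-identity = (λ { (a , b) → cong₂ _,_
                         (solve 2 (λ a b → con 1ℚ :* a :- con 0ℚ :* b := a) refl a b)
                         (solve 2 (λ a b → con 1ℚ :* b :+ con 0ℚ :* a := b) refl a b) })
                   , (λ { (a , b) → cong₂ _,_
                         (solve 2 (λ a b → a :* con 1ℚ :- b :* con 0ℚ := a) refl a b)
                         (solve 2 (λ a b → a :* con 0ℚ :+ b :* con 1ℚ := b) refl a b) })
      ; distrib = (λ { (a , b) (c , d) (e , f) → cong₂ _,_
                      (solve 6 (λ a b c d e f → a :* (c :+ e) :- b :* (d :+ f)
                         := (a :* c :- b :* d) :+ (a :* e :- b :* f)) refl a b c d e f)
                      (solve 6 (λ a b c d e f → a :* (d :+ f) :+ b :* (c :+ e)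
                         := (a :* d :+ b :* c) :+ (a :* f :+ b :* e)) refl a b c d e f) })
                , (λ { (a , b) (c , d) (e , f) → cong₂ _,_
                      (solve 6 (λ a b c d e f → (c :+ e) :* a :- (d :+ f) :* b
                         := (c :* a :- d :* b) :+ (e :* a :- f :* b)) refl a b c d e f)
                      (solve 6 (λ a b c d e f → (c :+ e) :* b :+ (d :+ f) :* a
                         := (c :* b :+ d :* a) :+ (e :* b :+ f :* a)) refl a b c d e f) })
      }
    ; *-comm = λ { (a , b) (c , d) → cong₂ _,_
        (solve 4 (λ a b c d → a :* c :- b :* d := c :* a :- d :* b) refl a b c d)
        (solve 4 (λ a b c d → a :* d :+ b :* c := c :* b :+ d :* a) refl a b c d) }
    }
  }

module ℚ[i]-Solver =
  RingSolver (ACR.fromCommutativeRing ⊕-⊗-commutativeRing) (≡-dec _≟_ _≟_)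

open ℚ[i]-Solver using () renaming
  (solve to solveᵢ; _:=_ to _⊜_; _:+_ to _⊞_; _:*_ to _⊠_; _:-_ to _⊟_; :-_ to ⊟_; con to conᵢ)

-- Null sequences, and sequences in `ℚ[i]` up to null differences

Eventually : (ℕ → Set) → Set
Eventually P = ∃[ N ] (∀ n → N ℕ.≤ n → P n)

always : ∀ {P} → (∀ n → P n) → Eventually P
always h = 0 , λ n _ → h n

eventually-map : ∀ {P Q} → (∀ n → P n → Q n) → Eventually P → Eventually Q
eventually-map f (N , h) = N , λ n N≤n → f n (h n N≤n)

eventually-map₂ : ∀ {P Q R} → (∀ n → P n → Q n → R n) → Eventually P → Eventually Q → Eventually R
eventually-map₂ f (M , g) (N , h) = M ℕ.⊔ N , λ n M⊔N≤n →
  f n (g n (ℕP.≤-trans (ℕP.m≤m⊔n M N) M⊔N≤n)) (h n (ℕP.≤-trans (ℕP.m≤n⊔m M N) M⊔N≤n))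

eventually-const : ∀ {P : Set} → Eventually (λ _ → P) → P
eventually-const (N , h) = h N ℕP.≤-refl

Null : (ℕ → ℚ) → Set
Null u = ∀ ε → 0ℚ < ε → Eventually (λ n → u n < ε)

vanishing⇒null : ∀ {u} → Vanishing (λ m _ → u m) → Null u
vanishing⇒null h ε 0<ε = let (N , g) = h ε 0<ε in N , λ n N≤n → g n n N≤n N≤n

null⇒vanishing : ∀ {u} → Null u → Vanishing (λ m _ → u m)
null⇒vanishing h ε 0<ε = let (N , g) = h ε 0<ε in N , λ m _ N≤m _ → g m N≤m

null-+ : ∀ {u v} → Null u → Null v → Null (λ n → u n + v n)
null-+ hu hv = vanishing⇒null (vanishing-+ (null⇒vanishing hu) (null⇒vanishing hv))

null-* : ∀ {u c} → 0ℚ ≤ c → Null u → Null (λ n → c * u n)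
null-* 0≤c hu = vanishing⇒null (vanishing-* 0≤c (null⇒vanishing hu))

null-≤ : ∀ {u v} → Eventually (λ n → u n ≤ v n) → Null v → Null u
null-≤ u≤v hv ε 0<ε = eventually-map₂ (λ _ → ≤-<-trans) u≤v (hv ε 0<ε)

null-1/1+ : Null 1/1+_
null-1/1+ = null-≤ (always (λ n → p≤p+q {1/1+ n} (0≤1/1+ n)))
  λ ε 0<ε → let (N , h) = vanishing-1/1+ ε 0<ε in N , λ n N≤n → h n n N≤n N≤n

infix 4 _~_

_~_ : (ℕ → ℚ[i]) → (ℕ → ℚ[i]) → Set
u ~ v = Null (λ n → ‖ u n ⊖ v n ‖)

‖0‖ : ∀ z → ‖ z ⊖ z ‖ ≡ 0ℚ
‖0‖ (a , b) = trans (cong₂ (λ x y → ∣ x ∣ + ∣ y ∣) (+-inverseʳ a) (+-inverseʳ b)) (+-identityʳ 0ℚ)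

‖⊖‖-triangle : ∀ x y z → ‖ x ⊖ z ‖ ≤ ‖ x ⊖ y ‖ + ‖ y ⊖ z ‖
‖⊖‖-triangle x y z = ≤-trans
  (≤-reflexive (cong ‖_‖ (solveᵢ 3 (λ x y z → x ⊟ z ⊜ (x ⊟ y) ⊞ (y ⊟ z)) refl x y z)))
  (‖⊕‖ (x ⊖ y) (y ⊖ z))

‖proj₁‖ : ∀ z → ∣ proj₁ z ∣ ≤ ‖ z ‖
‖proj₁‖ z = p≤p+q (0≤∣p∣ (proj₂ z))

‖proj₂‖ : ∀ z → ∣ proj₂ z ∣ ≤ ‖ z ‖
‖proj₂‖ z = q≤p+q (0≤∣p∣ (proj₁ z))

~-pointwise : ∀ {u v} → Eventually (λ n → u n ≡ v n) → u ~ v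
~-pointwise {u} {v} (N , h) ε 0<ε = N , λ n N≤n →
  subst (_< ε) (sym (trans (cong (λ w → ‖ w ⊖ v n ‖) (h n N≤n)) (‖0‖ (v n)))) 0<ε

~-sym : ∀ {u v} → u ~ v → v ~ u
~-sym {u} {v} = null-≤ (always (λ n → ≤-reflexive (‖⊖‖-sym (v n) (u n))))

~-trans : ∀ {u v w} → u ~ v → v ~ w → u ~ w
~-trans {u} {v} {w} p q = null-≤ (always (λ n → ‖⊖‖-triangle (u n) (v n) (w n))) (null-+ p q)

Bounded : (ℕ → ℚ[i]) → Set
Bounded u = ∃[ B ] 0ℚ ≤ B × (∀ n → ‖ u n ‖ ≤ B)

approx-bounded : ∀ z → Bounded (approx z)
approx-bounded z with cauchy-bounded {seq (re z)} (cauchy (re z)) | cauchy-bounded {seq (im z)} (cauchy (im z))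
... | A , hA | B , hB = A + B , ≤-trans (0≤‖‖ (approx z 0)) (bound 0) , bound
  where
  bound : ∀ n → ‖ approx z n ‖ ≤ A + B
  bound n = +-mono-≤ (hA n) (hB n)

~-⊕ : ∀ {u u′ v v′} → u ~ u′ → v ~ v′ → (λ n → u n ⊕ v n) ~ (λ n → u′ n ⊕ v′ n)
~-⊕ {u} {u′} {v} {v′} p q = null-≤ (always (λ n → ≤-trans
    (≤-reflexive (cong ‖_‖ (solveᵢ 4 (λ a b c d → (a ⊞ b) ⊟ (c ⊞ d) ⊜ (a ⊟ c) ⊞ (b ⊟ d)) refl (u n) (v n) (u′ n) (v′ n))))
    (‖⊕‖ (u n ⊖ u′ n) (v n ⊖ v′ n))))
  (null-+ p q)

~-⊗ : ∀ {u u′ v v′} → Bounded u → Bounded v′ → u ~ u′ → v ~ v′ → (λ n → u n ⊗ v n) ~ (λ n → u′ n ⊗ v′ n)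
~-⊗ {u} {u′} {v} {v′} (A , 0≤A , hA) (B , 0≤B , hB) p q = null-≤ (always bound)
  (null-+ (null-* 0≤A q) (null-* 0≤B p))
  where
  open ≤-Reasoning
  bound : ∀ n → ‖ u n ⊗ v n ⊖ u′ n ⊗ v′ n ‖ ≤ A * ‖ v n ⊖ v′ n ‖ + B * ‖ u n ⊖ u′ n ‖
  bound n = begin
    ‖ u n ⊗ v n ⊖ u′ n ⊗ v′ n ‖
      ≡⟨ cong ‖_‖ (solveᵢ 4 (λ a b c d → a ⊠ b ⊟ c ⊠ d ⊜ a ⊠ (b ⊟ d) ⊞ d ⊠ (a ⊟ c)) refl (u n) (v n) (u′ n) (v′ n)) ⟩
    ‖ u n ⊗ (v n ⊖ v′ n) ⊕ v′ n ⊗ (u n ⊖ u′ n) ‖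
      ≤⟨ ‖⊕‖ (u n ⊗ (v n ⊖ v′ n)) (v′ n ⊗ (u n ⊖ u′ n)) ⟩
    ‖ u n ⊗ (v n ⊖ v′ n) ‖ + ‖ v′ n ⊗ (u n ⊖ u′ n) ‖
      ≤⟨ +-mono-≤ (‖⊗‖ (u n) (v n ⊖ v′ n)) (‖⊗‖ (v′ n) (u n ⊖ u′ n)) ⟩
    ‖ u n ‖ * ‖ v n ⊖ v′ n ‖ + ‖ v′ n ‖ * ‖ u n ⊖ u′ n ‖
      ≤⟨ +-mono-≤ (*-monoʳ-≤-nonNeg ‖ v n ⊖ v′ n ‖ {{ℚ.nonNegative (0≤‖‖ (v n ⊖ v′ n))}} (hA n))
                  (*-monoʳ-≤-nonNeg ‖ u n ⊖ u′ n ‖ {{ℚ.nonNegative (0≤‖‖ (u n ⊖ u′ n))}} (hB n)) ⟩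
    A * ‖ v n ⊖ v′ n ‖ + B * ‖ u n ⊖ u′ n ‖ ∎

‖conj‖ : ∀ z → ‖ conj z ‖ ≡ ‖ z ‖
‖conj‖ (a , b) = cong (∣ a ∣ +_) (∣-p∣≡∣p∣ b)

conj-⊕ : ∀ z w → conj (z ⊕ w) ≡ conj z ⊕ conj w
conj-⊕ (a , b) (c , d) = cong (a + c ,_) (neg-distrib-+ b d)

conj-⊖ : ∀ z w → conj (z ⊖ w) ≡ conj z ⊖ conj w
conj-⊖ (a , b) (c , d) = cong (a - c ,_) (neg-distrib-+ b (- d))

conj-⊗ : ∀ z w → conj (z ⊗ w) ≡ conj z ⊗ conj w
conj-⊗ (a , b) (c , d) = cong₂ _,_
  (solve 4 (λ a b c d → a :* c :- b :* d := a :* c :- (:- b) :* (:- d)) refl a b c d)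
  (solve 4 (λ a b c d → :- (a :* d :+ b :* c) := a :* (:- d) :+ (:- b) :* c) refl a b c d)

-- Complex numbers up to null differences

infix 4 _≃_

-- ≈ᶜ unfolds too far for its arguments to be inferred; the record keeps them visible.
record _≃_ (z w : ℂ) : Set where
  constructor mk≃
  field ≃⇒~ : approx z ~ approx w

open _≃_

≈ᶜ⇒≃ : ∀ {z w} → z ≈ᶜ w → z ≃ w
≈ᶜ⇒≃ (p , q) = mk≃ (null-+ p q)

≃⇒≈ᶜ : ∀ {z w} → z ≃ w → z ≈ᶜ w
≃⇒≈ᶜ {z} {w} (mk≃ h) = null-≤ (always (λ n → ‖proj₁‖ (approx z n ⊖ approx w n))) h
                     , null-≤ (always (λ n → ‖proj₂‖ (approx z n ⊖ approx w n))) h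

pointwise : ∀ {z w} → (∀ n → approx z n ≡ approx w n) → z ≃ w
pointwise {z} {w} h = mk≃ (~-pointwise {approx z} {approx w} (always h))

≃-setoid : Setoid _ _
≃-setoid = record
  { Carrier = ℂ ; _≈_ = _≃_
  ; isEquivalence = record
    { refl  = λ {z} → mk≃ (~-pointwise {approx z} (always (λ _ → refl)))
    ; sym   = λ {z w} p → mk≃ (~-sym {approx z} {approx w} (≃⇒~ p))
    ; trans = λ {x y z} p q → mk≃ (~-trans {approx x} {approx y} {approx z} (≃⇒~ p) (≃⇒~ q))
    }
  }

open Setoid ≃-setoid using () renaming (refl to ≃-refl; sym to ≃-sym; trans to ≃-trans)
module ≃-Reasoning = SetoidReasoning ≃-setoid

+ᶜ-cong : ∀ {z z′ w w′} → z ≃ z′ → w ≃ w′ → z +ᶜ w ≃ z′ +ᶜ w′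
+ᶜ-cong {z} {z′} {w} {w′} p q = mk≃
  (~-⊕ {approx z} {approx z′} {approx w} {approx w′} (≃⇒~ p) (≃⇒~ q))

*ᶜ-cong : ∀ {z z′ w w′} → z ≃ z′ → w ≃ w′ → z *ᶜ w ≃ z′ *ᶜ w′
*ᶜ-cong {z} {z′} {w} {w′} p q = mk≃
  (~-⊗ {approx z} {approx z′} {approx w} {approx w′} (approx-bounded z) (approx-bounded w′)
    (≃⇒~ p) (≃⇒~ q))

conjᶜ : ℂ → ℂ
conjᶜ z = re z +i -ʳ im z

conjᶜ-cong : ∀ {z w} → z ≃ w → conjᶜ z ≃ conjᶜ w
conjᶜ-cong {z} {w} (mk≃ h) = mk≃ (null-≤ (always (λ n → ≤-reflexive (trans
  (cong ‖_‖ (sym (conj-⊖ (approx z n) (approx w n)))) (‖conj‖ (approx z n ⊖ approx w n))))) h)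

expSum-conj : ∀ z n → expSum (conj z) n ≡ conj (expSum z n)
expSum-conj z zero    = refl
expSum-conj z (suc n) = trans (cong₂ _⊕_ (expSum-conj z n) (term n))
  (sym (conj-⊕ (expSum z n) (expTerm z n)))
  where
  conj-· : ∀ c w → c · conj w ≡ conj (c · w)
  conj-· c (a , b) = cong (c * a ,_) (sym (neg-distribʳ-* c b))
  term : ∀ k → expTerm (conj z) k ≡ conj (expTerm z k)
  term zero    = refl
  term (suc k) = trans (cong (λ w → 1/1+ k · (w ⊗ conj z)) (term k))
    (trans (cong (1/1+ k ·_) (sym (conj-⊗ (expTerm z k) z))) (conj-· (1/1+ k) (expTerm z k ⊗ z)))

-- A common integral bound for the approximations puts them in the domain of Majorant.
approx-boundedℕ : ∀ z w → ∃[ M ] (∀ n → ‖ approx z n ‖ ≤ fromℕ M) × (∀ n → ‖ approx w n ‖ ≤ fromℕ M)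
approx-boundedℕ z w =
  let (A , 0≤A , hA) = approx-bounded z
      (B , 0≤B , hB) = approx-bounded w
      (M , A+B≤M) = archimedean-large (A + B)
  in M , (λ n → ≤-trans (hA n) (≤-trans (p≤p+q 0≤B) A+B≤M))
       , (λ n → ≤-trans (hB n) (≤-trans (q≤p+q 0≤A) A+B≤M))

majSum-bounded : ∀ M → ∃[ C ] 0ℚ ≤ C × (∀ n → majSum (fromℕ M) n ≤ C)
majSum-bounded M =
  let (C , hC) = cauchy-bounded (Majorant.majSum-cauchy M)
      h = λ n → ≤-trans (≤-reflexive (sym (0≤p⇒∣p∣≡p (Majorant.0≤majSum M n)))) (hC n)
  in C , h 0 , h

-- Partial sums of equal length are Lipschitz on a ball with a constant independent of the length,
-- so a null perturbation of the argument perturbs the values by a null sequence.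
expSeq-cong : ∀ {z w} → z ≃ w → expSeq z ~ expSeq w
expSeq-cong {z} {w} (mk≃ h) =
  let (M , hz , hw) = approx-boundedℕ z w
      (C , 0≤C , hC) = majSum-bounded M
  in null-≤ (1 , bound M C hz hw hC) (null-* 0≤C h)
  where
  bound : ∀ M C → (∀ n → ‖ approx z n ‖ ≤ fromℕ M) → (∀ n → ‖ approx w n ‖ ≤ fromℕ M) →
    (∀ n → majSum (fromℕ M) n ≤ C) →
    ∀ n → 1 ℕ.≤ n → ‖ expSeq z n ⊖ expSeq w n ‖ ≤ C * ‖ approx z n ⊖ approx w n ‖
  bound M C hz hw hC n@(suc n′) _ = ≤-trans
    (Majorant.sum-lipschitz M (approx z n) (approx w n) n′ (hz n) (hw n))
    (*-monoʳ-≤-nonNeg ‖ approx z n ⊖ approx w n ‖ {{ℚ.nonNegative (0≤‖‖ (approx z n ⊖ approx w n))}} (hC n′))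

-- Additivity of the exponential

sumᵢ : (ℕ → ℚ[i]) → ℕ → ℚ[i]
sumᵢ f zero    = 0ᵢ
sumᵢ f (suc n) = sumᵢ f n ⊕ f n

-- conv f g k = ∑_{i+j=k} fᵢ gⱼ
conv : (f g : ℕ → ℚ[i]) → ℕ → ℚ[i]
conv f g zero    = f 0 ⊗ g 0
conv f g (suc k) = f 0 ⊗ g (suc k) ⊕ conv (f ∘ suc) g k

sumᵢ-cong : ∀ {f g} n → (∀ i → f i ≡ g i) → sumᵢ f n ≡ sumᵢ g n
sumᵢ-cong zero    h = refl
sumᵢ-cong (suc n) h = cong₂ _⊕_ (sumᵢ-cong n h) (h n)

sumᵢ-first : ∀ f n → sumᵢ f (suc n) ≡ f 0 ⊕ sumᵢ (f ∘ suc) n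
sumᵢ-first f zero    = solveᵢ 1 (λ a → conᵢ 0ᵢ ⊞ a ⊜ a ⊞ conᵢ 0ᵢ) refl (f 0)
sumᵢ-first f (suc n) = trans (cong (_⊕ f (suc n)) (sumᵢ-first f n))
  (solveᵢ 3 (λ a b c → (a ⊞ b) ⊞ c ⊜ a ⊞ (b ⊞ c)) refl (f 0) (sumᵢ (f ∘ suc) n) (f (suc n)))

conv-cong : ∀ {f f′ g g′} k → (∀ i → f i ≡ f′ i) → (∀ i → g i ≡ g′ i) → conv f g k ≡ conv f′ g′ k
conv-cong zero    p q = cong₂ _⊗_ (p 0) (q 0)
conv-cong (suc k) p q = cong₂ _⊕_ (cong₂ _⊗_ (p 0) (q (suc k))) (conv-cong k (p ∘ suc) q)

conv-last : ∀ f g k → conv f g (suc k) ≡ conv f (g ∘ suc) k ⊕ f (suc k) ⊗ g 0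
conv-last f g zero    = refl
conv-last f g (suc k) = trans (cong (f 0 ⊗ g (suc (suc k)) ⊕_) (conv-last (f ∘ suc) g k))
  (solveᵢ 3 (λ a b c → a ⊞ (b ⊞ c) ⊜ (a ⊞ b) ⊞ c) refl
    (f 0 ⊗ g (suc (suc k))) (conv (f ∘ suc) (g ∘ suc) k) (f (suc (suc k)) ⊗ g 0))

conv-⊕ˡ : ∀ f f′ g k → conv (λ i → f i ⊕ f′ i) g k ≡ conv f g k ⊕ conv f′ g k
conv-⊕ˡ f f′ g zero    = solveᵢ 3 (λ a b c → (a ⊞ b) ⊠ c ⊜ a ⊠ c ⊞ b ⊠ c) refl (f 0) (f′ 0) (g 0)
conv-⊕ˡ f f′ g (suc k) = trans (cong ((f 0 ⊕ f′ 0) ⊗ g (suc k) ⊕_) (conv-⊕ˡ (f ∘ suc) (f′ ∘ suc) g k))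
  (solveᵢ 5 (λ a b c d e → (a ⊞ b) ⊠ c ⊞ (d ⊞ e) ⊜ (a ⊠ c ⊞ d) ⊞ (b ⊠ c ⊞ e)) refl
    (f 0) (f′ 0) (g (suc k)) (conv (f ∘ suc) g k) (conv (f′ ∘ suc) g k))

conv-⊗ˡ : ∀ z f g k → conv (λ i → z ⊗ f i) g k ≡ z ⊗ conv f g k
conv-⊗ˡ z f g zero    = solveᵢ 3 (λ a b c → (a ⊠ b) ⊠ c ⊜ a ⊠ (b ⊠ c)) refl z (f 0) (g 0)
conv-⊗ˡ z f g (suc k) = trans (cong ((z ⊗ f 0) ⊗ g (suc k) ⊕_) (conv-⊗ˡ z (f ∘ suc) g k))
  (solveᵢ 4 (λ a b c d → (a ⊠ b) ⊠ c ⊞ a ⊠ d ⊜ a ⊠ (b ⊠ c ⊞ d)) refl z (f 0) (g (suc k)) (conv (f ∘ suc) g k))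

conv-⊗ʳ : ∀ z f g k → conv f (λ i → z ⊗ g i) k ≡ z ⊗ conv f g k
conv-⊗ʳ z f g zero    = solveᵢ 3 (λ a b c → b ⊠ (a ⊠ c) ⊜ a ⊠ (b ⊠ c)) refl z (f 0) (g 0)
conv-⊗ʳ z f g (suc k) = trans (cong (f 0 ⊗ (z ⊗ g (suc k)) ⊕_) (conv-⊗ʳ z (f ∘ suc) g k))
  (solveᵢ 4 (λ a b c d → b ⊠ (a ⊠ c) ⊞ a ⊠ d ⊜ a ⊠ (b ⊠ c ⊞ d)) refl z (f 0) (g (suc k)) (conv (f ∘ suc) g k))

ι : ℚ → ℚ[i]
ι c = c , 0ℚ

ι-⊗ : ∀ c z → ι c ⊗ z ≡ c · z
ι-⊗ c (a , b) = cong₂ _,_ (solve 3 (λ c a b → c :* a :- con 0ℚ :* b := c :* a) refl c a b)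
                          (solve 3 (λ c a b → c :* b :+ con 0ℚ :* a := c :* b) refl c a b)

ι-suc : ∀ n → ι (fromℕ (suc n)) ≡ 1ᵢ ⊕ ι (fromℕ n)
ι-suc n = cong (_, 0ℚ) (sym (fromℕ-1+ n))

-- The Euler operator: a derivation for the convolution, for which zᵏ / k! is an eigensequence up to a shift.
δ : (ℕ → ℚ[i]) → ℕ → ℚ[i]
δ f i = ι (fromℕ i) ⊗ f i

-- The weight k = i + j of each product splits over its two factors. Peeling off the head of `f`
-- lowers i by one, and the extra copy of `C` that this leaves over is absorbed by `shift`.
conv-δ : ∀ f g k → ι (fromℕ k) ⊗ conv f g k ≡ conv (δ f) g k ⊕ conv f (δ g) k
conv-δ f g zero    = solveᵢ 2 (λ a b → conᵢ 0ᵢ ⊠ (a ⊠ b) ⊜ (conᵢ 0ᵢ ⊠ a) ⊠ b ⊞ a ⊠ (conᵢ 0ᵢ ⊠ b)) refl (f 0) (g 0)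
conv-δ f g (suc k) = begin
  ι (fromℕ (suc k)) ⊗ (f 0 ⊗ g (suc k) ⊕ C)
    ≡⟨ cong (_⊗ (f 0 ⊗ g (suc k) ⊕ C)) (ι-suc k) ⟩
  (1ᵢ ⊕ ι (fromℕ k)) ⊗ (f 0 ⊗ g (suc k) ⊕ C)
    ≡⟨ solveᵢ 4 (λ n a b c → (conᵢ 1ᵢ ⊞ n) ⊠ (a ⊠ b ⊞ c) ⊜ (conᵢ 1ᵢ ⊞ n) ⊠ (a ⊠ b) ⊞ c ⊞ n ⊠ c)
         refl (ι (fromℕ k)) (f 0) (g (suc k)) C ⟩
  (1ᵢ ⊕ ι (fromℕ k)) ⊗ (f 0 ⊗ g (suc k)) ⊕ C ⊕ ι (fromℕ k) ⊗ C
    ≡⟨ cong₂ (λ n y → n ⊗ (f 0 ⊗ g (suc k)) ⊕ C ⊕ y) (sym (ι-suc k)) (conv-δ f′ g k) ⟩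
  ι (fromℕ (suc k)) ⊗ (f 0 ⊗ g (suc k)) ⊕ C ⊕ (D ⊕ E)
    ≡⟨ solveᵢ 6 (λ n a b c d e → n ⊠ (a ⊠ b) ⊞ c ⊞ (d ⊞ e)
         ⊜ ((conᵢ 0ᵢ ⊠ a) ⊠ b ⊞ (c ⊞ d)) ⊞ (a ⊠ (n ⊠ b) ⊞ e)) refl (ι (fromℕ (suc k))) (f 0) (g (suc k)) C D E ⟩
  (δ f 0 ⊗ g (suc k) ⊕ (C ⊕ D)) ⊕ (f 0 ⊗ δ g (suc k) ⊕ E)
    ≡⟨ cong (λ y → (δ f 0 ⊗ g (suc k) ⊕ y) ⊕ (f 0 ⊗ δ g (suc k) ⊕ E))
         (trans (sym (conv-⊕ˡ f′ (δ f′) g k)) (conv-cong k shift (λ _ → refl))) ⟩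
  conv (δ f) g (suc k) ⊕ conv f (δ g) (suc k) ∎
  where
  open ≡-Reasoning
  f′ = f ∘ suc
  C = conv f′ g k
  D = conv (δ f′) g k
  E = conv f′ (δ g) k
  shift : ∀ i → f′ i ⊕ δ f′ i ≡ δ f (suc i)
  shift i = trans (solveᵢ 2 (λ n a → a ⊞ n ⊠ a ⊜ (conᵢ 1ᵢ ⊞ n) ⊠ a) refl (ι (fromℕ i)) (f′ i))
    (cong (_⊗ f′ i) (sym (ι-suc i)))

δ-expTerm : ∀ z k → δ (expTerm z) (suc k) ≡ z ⊗ expTerm z k
δ-expTerm z k = begin
  ι (fromℕ (suc k)) ⊗ (1/1+ k · (e ⊗ z))      ≡⟨ cong (ι (fromℕ (suc k)) ⊗_) (sym (ι-⊗ (1/1+ k) (e ⊗ z))) ⟩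
  ι (fromℕ (suc k)) ⊗ (ι (1/1+ k) ⊗ (e ⊗ z))  ≡⟨ solveᵢ 4 (λ n r e z → n ⊠ (r ⊠ (e ⊠ z)) ⊜ (n ⊠ r) ⊠ (z ⊠ e)) refl
                                                    (ι (fromℕ (suc k))) (ι (1/1+ k)) e z ⟩
  (ι (fromℕ (suc k)) ⊗ ι (1/1+ k)) ⊗ (z ⊗ e)  ≡⟨ cong (_⊗ (z ⊗ e)) (trans (ι-⊗ (fromℕ (suc k)) (ι (1/1+ k)))
                                                    (cong₂ _,_ (1/1+-inverse k) (*-zeroʳ (fromℕ (suc k))))) ⟩
  1ᵢ ⊗ (z ⊗ e)                                ≡⟨ solveᵢ 2 (λ z e → conᵢ 1ᵢ ⊠ (z ⊠ e) ⊜ z ⊠ e) refl z e ⟩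
  z ⊗ e                                       ∎
  where
  open ≡-Reasoning
  e = expTerm z k

-- By the Leibniz rule for the Euler operator, the convolution c of the two exponential series
-- satisfies (k + 1) c (k + 1) = (z + w) c k, which is the recursion defining `expTerm (z ⊕ w)`.
-- Binomial coefficients never appear.
conv-expTerm : ∀ z w k → conv (expTerm z) (expTerm w) k ≡ expTerm (z ⊕ w) k
conv-expTerm z w zero    = refl
conv-expTerm z w (suc k) = begin
  c (suc k)
    ≡⟨ solveᵢ 1 (λ a → a ⊜ conᵢ 1ᵢ ⊠ a) refl (c (suc k)) ⟩
  1ᵢ ⊗ c (suc k)
    ≡⟨ cong (_⊗ c (suc k)) (sym (trans (ι-⊗ (1/1+ k) (ι (fromℕ (suc k))))
         (cong₂ _,_ (trans (*-comm (1/1+ k) (fromℕ (suc k))) (1/1+-inverse k)) (*-zeroʳ (1/1+ k))))) ⟩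
  (ι (1/1+ k) ⊗ ι (fromℕ (suc k))) ⊗ c (suc k)
    ≡⟨ solveᵢ 3 (λ a b c → (a ⊠ b) ⊠ c ⊜ a ⊠ (b ⊠ c)) refl (ι (1/1+ k)) (ι (fromℕ (suc k))) (c (suc k)) ⟩
  ι (1/1+ k) ⊗ (ι (fromℕ (suc k)) ⊗ c (suc k))
    ≡⟨ ι-⊗ (1/1+ k) (ι (fromℕ (suc k)) ⊗ c (suc k)) ⟩
  1/1+ k · (ι (fromℕ (suc k)) ⊗ c (suc k))
    ≡⟨ cong (1/1+ k ·_) euler ⟩
  1/1+ k · (c k ⊗ (z ⊕ w))
    ≡⟨ cong (λ e → 1/1+ k · (e ⊗ (z ⊕ w))) (conv-expTerm z w k) ⟩
  expTerm (z ⊕ w) (suc k) ∎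
  where
  open ≡-Reasoning
  f = expTerm z
  g = expTerm w
  c = conv f g
  euler : ι (fromℕ (suc k)) ⊗ c (suc k) ≡ c k ⊗ (z ⊕ w)
  euler = begin
    ι (fromℕ (suc k)) ⊗ c (suc k)
      ≡⟨ conv-δ f g (suc k) ⟩
    (δ f 0 ⊗ g (suc k) ⊕ conv (δ f ∘ suc) g k) ⊕ conv f (δ g) (suc k)
      ≡⟨ cong₂ (λ x y → (δ f 0 ⊗ g (suc k) ⊕ x) ⊕ y)
           (trans (conv-cong k (δ-expTerm z) (λ _ → refl)) (conv-⊗ˡ z f g k))
           (trans (conv-last f (δ g) k) (cong (_⊕ f (suc k) ⊗ δ g 0)
             (trans (conv-cong k (λ _ → refl) (δ-expTerm w)) (conv-⊗ʳ w f g k)))) ⟩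
    ((0ᵢ ⊗ f 0) ⊗ g (suc k) ⊕ z ⊗ c k) ⊕ (w ⊗ c k ⊕ f (suc k) ⊗ (0ᵢ ⊗ g 0))
      ≡⟨ solveᵢ 7 (λ a b z w c d e → ((conᵢ 0ᵢ ⊠ a) ⊠ b ⊞ z ⊠ c) ⊞ (w ⊠ c ⊞ d ⊠ (conᵢ 0ᵢ ⊠ e)) ⊜ c ⊠ (z ⊞ w))
           refl (f 0) (g (suc k)) z w (c k) (f (suc k)) (g 0) ⟩
    c k ⊗ (z ⊕ w) ∎

-- The sum of fᵢ gⱼ over the pairs i, j < n with i + j ≥ n.
deficit : (f g : ℕ → ℚ[i]) → ℕ → ℚ[i]
deficit f g n = sumᵢ f n ⊗ sumᵢ g n ⊖ sumᵢ (conv f g) n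

deficit-suc : ∀ f g n → deficit f g (suc n) ≡ deficit (f ∘ suc) g n ⊕ sumᵢ (f ∘ suc) n ⊗ g n
deficit-suc f g n = trans
  (cong₂ (λ x y → x ⊗ sumᵢ g (suc n) ⊖ y) (sumᵢ-first f n) (triangle n))
  (solveᵢ 5 (λ a F G b T → (a ⊞ F) ⊠ (G ⊞ b) ⊟ (a ⊠ (G ⊞ b) ⊞ T) ⊜ (F ⊠ G ⊟ T) ⊞ F ⊠ b) refl
    (f 0) (sumᵢ (f ∘ suc) n) (sumᵢ g n) (g n) (sumᵢ (conv (f ∘ suc) g) n))
  where
  triangle : ∀ n → sumᵢ (conv f g) (suc n) ≡ f 0 ⊗ sumᵢ g (suc n) ⊕ sumᵢ (conv (f ∘ suc) g) n
  triangle zero    = solveᵢ 2 (λ a b → conᵢ 0ᵢ ⊞ a ⊠ b ⊜ a ⊠ (conᵢ 0ᵢ ⊞ b) ⊞ conᵢ 0ᵢ) refl (f 0) (g 0)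
  triangle (suc n) = trans (cong (_⊕ conv f g (suc n)) (triangle n))
    (solveᵢ 5 (λ a G T b c → (a ⊠ G ⊞ T) ⊞ (a ⊠ b ⊞ c) ⊜ a ⊠ (G ⊞ b) ⊞ (T ⊞ c)) refl
      (f 0) (sumᵢ g (suc n)) (sumᵢ (conv (f ∘ suc) g) n) (g (suc n)) (conv (f ∘ suc) g n))

-- weighted a f n = ∑_{i<n} (a + i + 1) ‖ fᵢ ‖
weighted : ℕ → (ℕ → ℚ[i]) → ℕ → ℚ
weighted a f zero    = 0ℚ
weighted a f (suc n) = weighted a f n + fromℕ (suc (a ℕ.+ n)) * ‖ f n ‖

fromℕ-+ : ∀ m n → fromℕ (m ℕ.+ n) ≡ fromℕ m + fromℕ n
fromℕ-+ zero    n = sym (+-identityˡ (fromℕ n))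
fromℕ-+ (suc m) n = trans (sym (fromℕ-1+ (m ℕ.+ n)))
  (trans (cong (1ℚ +_) (fromℕ-+ m n))
    (trans (sym (+-assoc 1ℚ (fromℕ m) (fromℕ n))) (cong (_+ fromℕ n) (fromℕ-1+ m))))

fromℕ-mono : ∀ {m n} → m ℕ.≤ n → fromℕ m ≤ fromℕ n
fromℕ-mono {m} {n} m≤n = ≤-trans (p≤p+q (0≤fromℕ (n ∸ m)))
  (≤-reflexive (trans (sym (fromℕ-+ m (n ∸ m))) (cong fromℕ (ℕP.m+[n∸m]≡n m≤n))))

0≤weighted : ∀ a f n → 0ℚ ≤ weighted a f n
0≤weighted a f zero    = ≤-refl
0≤weighted a f (suc n) = 0≤+ (0≤weighted a f n) (0≤* (0≤fromℕ (suc (a ℕ.+ n))) (0≤‖‖ (f n)))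

weighted-first : ∀ a f n → weighted a f (suc n) ≡ fromℕ (suc a) * ‖ f 0 ‖ + weighted (suc a) (f ∘ suc) n
weighted-first a f zero    = trans (+-comm 0ℚ (fromℕ (suc (a ℕ.+ 0)) * ‖ f 0 ‖))
  (cong (λ b → fromℕ (suc b) * ‖ f 0 ‖ + 0ℚ) (ℕP.+-identityʳ a))
weighted-first a f (suc n) = trans
  (cong₂ (λ x b → x + fromℕ (suc b) * ‖ f (suc n) ‖) (weighted-first a f n) (ℕP.+-suc a n))
  (+-assoc (fromℕ (suc a) * ‖ f 0 ‖) (weighted (suc a) (f ∘ suc) n) _)

sumᵢ-weighted : ∀ a f n → fromℕ (suc a) * ‖ sumᵢ f n ‖ ≤ weighted a f n
sumᵢ-weighted a f zero    = ≤-reflexive (*-zeroʳ (fromℕ (suc a)))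
sumᵢ-weighted a f (suc n) = begin
  fromℕ (suc a) * ‖ sumᵢ f n ⊕ f n ‖
    ≤⟨ *-monoˡ-≤-nonNeg (fromℕ (suc a)) (‖⊕‖ (sumᵢ f n) (f n)) ⟩
  fromℕ (suc a) * (‖ sumᵢ f n ‖ + ‖ f n ‖)
    ≡⟨ *-distribˡ-+ (fromℕ (suc a)) (‖ sumᵢ f n ‖) (‖ f n ‖) ⟩
  fromℕ (suc a) * ‖ sumᵢ f n ‖ + fromℕ (suc a) * ‖ f n ‖
    ≤⟨ +-mono-≤ (sumᵢ-weighted a f n) (*-monoʳ-≤-nonNeg (‖ f n ‖) {{ℚ.nonNegative (0≤‖‖ (f n))}}
         (fromℕ-mono (ℕ.s≤s (ℕP.m≤m+n a n)))) ⟩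
  weighted a f (suc n) ∎
  where open ≤-Reasoning

-- The weights enter because (i + 1)(j + 1) ≥ n + 1 whenever i + j ≥ n.
deficit-bound : ∀ a f g n → fromℕ (suc (a ℕ.+ n)) * ‖ deficit f g n ‖ ≤ weighted a f n * weighted 0 g n
deficit-bound a f g zero    = ≤-reflexive (*-zeroʳ (fromℕ (suc (a ℕ.+ 0))))
deficit-bound a f g (suc n) = begin
  m * ‖ deficit f g (suc n) ‖
    ≡⟨ cong (λ x → m * ‖ x ‖) (deficit-suc f g n) ⟩
  m * ‖ deficit f′ g n ⊕ F ⊗ g n ‖
    ≤⟨ *-monoˡ-≤-nonNeg m (≤-trans (‖⊕‖ (deficit f′ g n) (F ⊗ g n)) (+-monoʳ-≤ (‖ deficit f′ g n ‖) (‖⊗‖ F (g n)))) ⟩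
  m * (‖ deficit f′ g n ‖ + ‖ F ‖ * ‖ g n ‖)
    ≡⟨ solve 4 (λ m d F g → m :* (d :+ F :* g) := m :* d :+ (m :* F) :* g) refl m (‖ deficit f′ g n ‖) (‖ F ‖) (‖ g n ‖) ⟩
  m * ‖ deficit f′ g n ‖ + m * ‖ F ‖ * ‖ g n ‖
    ≤⟨ +-mono-≤ (≤-trans (≤-reflexive (cong (λ b → fromℕ (suc b) * ‖ deficit f′ g n ‖) (ℕP.+-suc a n)))
                         (deficit-bound (suc a) f′ g n))
                (*-monoʳ-≤-nonNeg (‖ g n ‖) {{ℚ.nonNegative (0≤‖‖ (g n))}} tail) ⟩
  W * weighted 0 g n + fromℕ (suc n) * W * ‖ g n ‖
    ≡⟨ solve 4 (λ W G n g → W :* G :+ n :* W :* g := W :* (G :+ n :* g)) refl W (weighted 0 g n) (fromℕ (suc n)) (‖ g n ‖) ⟩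
  W * weighted 0 g (suc n)
    ≤⟨ *-monoʳ-≤-nonNeg (weighted 0 g (suc n)) {{ℚ.nonNegative (0≤weighted 0 g (suc n))}}
         (≤-trans (q≤p+q (0≤* (0≤fromℕ (suc a)) (0≤‖‖ (f 0)))) (≤-reflexive (sym (weighted-first a f n)))) ⟩
  weighted a f (suc n) * weighted 0 g (suc n) ∎
  where
  open ≤-Reasoning
  m = fromℕ (suc (a ℕ.+ suc n))
  f′ = f ∘ suc
  F = sumᵢ f′ n
  W = weighted (suc a) f′ n
  -- Each use of `deficit-suc` drops the head of `f`, and the offset `a` keeps the original weights.
  -- Here g n has weight n + 1 and every remaining term of `f` has weight at least a + 2, which
  -- together cover a + n + 2.
  m≤ : suc (a ℕ.+ suc n) ℕ.≤ suc n ℕ.* suc (suc a)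
  m≤ = ℕP.≤-trans (ℕP.≤-reflexive (cong suc (ℕP.+-suc a n)))
    (ℕP.+-monoʳ-≤ (suc (suc a)) (ℕP.m≤m*n n (suc (suc a))))
  tail : m * ‖ F ‖ ≤ fromℕ (suc n) * W
  tail = begin
    m * ‖ F ‖                                      ≤⟨ *-monoʳ-≤-nonNeg (‖ F ‖) {{ℚ.nonNegative (0≤‖‖ F)}} (fromℕ-mono m≤) ⟩
    fromℕ (suc n ℕ.* suc (suc a)) * ‖ F ‖          ≡⟨ cong (_* ‖ F ‖) (sym (fromℕ-* (suc n) (suc (suc a)))) ⟩
    fromℕ (suc n) * fromℕ (suc (suc a)) * ‖ F ‖    ≡⟨ *-assoc (fromℕ (suc n)) (fromℕ (suc (suc a))) (‖ F ‖) ⟩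
    fromℕ (suc n) * (fromℕ (suc (suc a)) * ‖ F ‖)  ≤⟨ *-monoˡ-≤-nonNeg (fromℕ (suc n)) (sumᵢ-weighted (suc a) f′ n) ⟩
    fromℕ (suc n) * W                              ∎

expSum≡sumᵢ : ∀ z n → expSum z n ≡ sumᵢ (expTerm z) n
expSum≡sumᵢ z zero    = refl
expSum≡sumᵢ z (suc n) = cong (_⊕ expTerm z n) (expSum≡sumᵢ z n)

-- Since (k + 1) Bᵏ / k! = Bᵏ / k! + B · Bᵏ⁻¹ / (k - 1)!, the weighted majorant series is again a
-- combination of exponential sums, hence bounded.
weighted-expTerm : ∀ M z n → ‖ z ‖ ≤ fromℕ M →
  weighted 0 (expTerm z) (suc n) ≤ majSum (fromℕ M) (suc n) + fromℕ M * majSum (fromℕ M) n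
weighted-expTerm M z zero    h = ≤-reflexive (cong (1ℚ +_) (sym (*-zeroʳ (fromℕ M))))
weighted-expTerm M z (suc n) h = begin
  weighted 0 (expTerm z) (suc n) + N * ‖ expTerm z (suc n) ‖
    ≤⟨ +-mono-≤ (weighted-expTerm M z n h) (*-monoˡ-≤-nonNeg N (Majorant.term-bound M z (suc n) h)) ⟩
  S₁ + B * S₀ + N * m₁
    ≡⟨ cong (λ x → S₁ + B * S₀ + x * m₁) (sym (fromℕ-1+ (suc n))) ⟩
  S₁ + B * S₀ + (1ℚ + fromℕ (suc n)) * m₁
    ≡⟨ solve 5 (λ S B T k m → S :+ B :* T :+ (con 1ℚ :+ k) :* m := (S :+ m) :+ (B :* T :+ k :* m)) refl S₁ B S₀ (fromℕ (suc n)) m₁ ⟩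
  S₁ + m₁ + (B * S₀ + fromℕ (suc n) * (1/1+ n * (m₀ * B)))
    ≡⟨ cong (λ x → S₁ + m₁ + (B * S₀ + x)) (trans (sym (*-assoc (fromℕ (suc n)) (1/1+ n) (m₀ * B)))
         (trans (cong (_* (m₀ * B)) (1/1+-inverse n)) (*-identityˡ (m₀ * B)))) ⟩
  S₁ + m₁ + (B * S₀ + m₀ * B)
    ≡⟨ solve 4 (λ S B T m → S :+ (B :* T :+ m :* B) := S :+ B :* (T :+ m)) refl (S₁ + m₁) B S₀ m₀ ⟩
  majSum B (suc (suc n)) + B * majSum B (suc n) ∎
  where
  open ≤-Reasoning
  B = fromℕ M
  N = fromℕ (suc (suc n))
  S₀ = majSum B n
  S₁ = majSum B (suc n)
  m₀ = majTerm B n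
  m₁ = majTerm B (suc n)

-- The product of the two partial sums differs from the partial sum at z + w by a `deficit`.
-- Multiplied by n + 1 it is still bounded, because the weighted sums are, so it is O(1/(n + 1)).
expSeq-+ : ∀ z w → (λ n → expSeq z n ⊗ expSeq w n) ~ expSeq (z +ᶜ w)
expSeq-+ z w =
  let (M , hz , hw) = approx-boundedℕ z w
      (C , 0≤C , hC) = majSum-bounded M
      W = C + fromℕ M * C
      0≤W = 0≤+ 0≤C (0≤* (0≤fromℕ M) 0≤C)
  in null-≤ (1 , bound M C 0≤C hz hw hC) (null-* (0≤* 0≤W 0≤W) null-1/1+)
  where
  bound : ∀ M C → 0ℚ ≤ C → (∀ n → ‖ approx z n ‖ ≤ fromℕ M) → (∀ n → ‖ approx w n ‖ ≤ fromℕ M) →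
    (∀ n → majSum (fromℕ M) n ≤ C) → ∀ n → 1 ℕ.≤ n →
    ‖ expSeq z n ⊗ expSeq w n ⊖ expSum (approx z n ⊕ approx w n) n ‖
    ≤ (C + fromℕ M * C) * (C + fromℕ M * C) * 1/1+ n
  bound M C 0≤C hz hw hC n@(suc n′) _ = begin
    ‖ expSum x n ⊗ expSum y n ⊖ expSum (x ⊕ y) n ‖
      ≡⟨ cong ‖_‖ (cong₂ _⊖_ (cong₂ _⊗_ (expSum≡sumᵢ x n) (expSum≡sumᵢ y n))
           (trans (expSum≡sumᵢ (x ⊕ y) n) (sumᵢ-cong n (λ k → sym (conv-expTerm x y k))))) ⟩
    d
      ≡⟨ trans (sym (*-identityˡ d)) (cong (_* d) (sym (1/1+-inverse n))) ⟩
    fromℕ (suc n) * 1/1+ n * d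
      ≡⟨ solve 3 (λ a b c → a :* b :* c := a :* c :* b) refl (fromℕ (suc n)) (1/1+ n) d ⟩
    fromℕ (suc n) * d * 1/1+ n
      ≤⟨ *-monoʳ-≤-nonNeg (1/1+ n) (≤-trans (deficit-bound 0 (expTerm x) (expTerm y) n)
           (*-mono (0≤weighted 0 (expTerm x) n) (≤-trans (0≤weighted 0 (expTerm y) n) (W-bound y (hw n)))
             (W-bound x (hz n)) (W-bound y (hw n)))) ⟩
    (C + fromℕ M * C) * (C + fromℕ M * C) * 1/1+ n ∎
    where
    open ≤-Reasoning
    x = approx z n
    y = approx w n
    d = ‖ deficit (expTerm x) (expTerm y) n ‖
    W-bound : ∀ v → ‖ v ‖ ≤ fromℕ M → weighted 0 (expTerm v) n ≤ C + fromℕ M * C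
    W-bound v h = ≤-trans (weighted-expTerm M v n′ h)
      (+-mono-≤ (hC n) (*-monoˡ-≤-nonNeg (fromℕ M) (hC n′)))

expSeq-0 : expSeq 0ᶜ ~ approx 1ᶜ
expSeq-0 = ~-pointwise {expSeq 0ᶜ} {approx 1ᶜ} (1 , λ { (suc n) _ → expSum-0 n })
  where
  term : ∀ k → expTerm 0ᵢ (suc k) ≡ 0ᵢ
  term k = trans (sym (ι-⊗ (1/1+ k) (expTerm 0ᵢ k ⊗ 0ᵢ)))
    (solveᵢ 2 (λ a b → a ⊠ (b ⊠ conᵢ 0ᵢ) ⊜ conᵢ 0ᵢ) refl (ι (1/1+ k)) (expTerm 0ᵢ k))
  expSum-0 : ∀ n → expSum 0ᵢ (suc n) ≡ 1ᵢ
  expSum-0 zero    = refl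
  expSum-0 (suc n) = cong₂ _⊕_ (expSum-0 n) (term n)

-- Logarithms and powers of positive integers

double : ℕ → ℕ
double zero    = zero
double (suc n) = suc (suc (double n))

-- Going from n + 1 to n + 2 appends a block of m terms to the Riemann sum, none of them below 1/((n
-- + 2) m). The bound holds at every mesh, so no limit has to be taken.
logSeq-increment : ∀ n i → 1/1+ suc n ≤ logSeq (suc (suc n)) i - logSeq (suc n) i
logSeq-increment n i = ≤-trans (Refinement.block-≥ i (suc n)) (≤-reflexive (begin
  h                                                 ≡⟨ solve 2 (λ h l → h := (l :+ h) :- l) refl h (logSeq (suc n) i) ⟩
  logSeq (suc n) i + h - logSeq (suc n) i           ≡⟨ cong (_- logSeq (suc n) i) (sym (harmonic-split m (n ℕ.* m) m)) ⟩
  harmonic m (n ℕ.* m ℕ.+ m) - logSeq (suc n) i     ≡⟨ cong (λ L → harmonic m L - logSeq (suc n) i) (ℕP.+-comm (n ℕ.* m) m) ⟩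
  logSeq (suc (suc n)) i - logSeq (suc n) i         ∎))
  where
  open ≡-Reasoning
  m = suc i
  h = harmonic (suc n ℕ.* m) m

-- Doubling the mesh parameter makes the Riemann sums for log 2n = log 2 + log n agree exactly.
logSeq-double : ∀ n i → logSeq (double (suc n)) i ≡ logSeq 2 i + logSeq (suc n) (i ℕ.+ suc i)
logSeq-double n i = trans (harmonic-split m m (double n ℕ.* m))
  (cong₂ _+_ (cong (harmonic m) (sym (ℕP.*-identityˡ m))) (cong (harmonic (m ℕ.+ m)) (regroup n)))
  where
  m = suc i
  regroup : ∀ n → double n ℕ.* m ≡ n ℕ.* (m ℕ.+ m)
  regroup zero    = refl
  regroup (suc n) = trans (cong (λ x → m ℕ.+ (m ℕ.+ x)) (regroup n)) (sym (ℕP.+-assoc m m (n ℕ.* (m ℕ.+ m))))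

-- Unfolding exp or log in a conversion check would evaluate their moduli of convergence.
opaque
  Exp : ℂ → ℂ
  Exp = exp

  approx-Exp : ∀ z n → approx (Exp z) n ≡ expSeq z n
  approx-Exp z n = refl

  Exp-cong : ∀ {z w} → z ≃ w → Exp z ≃ Exp w
  Exp-cong p = mk≃ (expSeq-cong p)

  Exp-+ : ∀ z w → Exp z *ᶜ Exp w ≃ Exp (z +ᶜ w)
  Exp-+ z w = mk≃ (expSeq-+ z w)

  Exp-0 : Exp 0ᶜ ≃ 1ᶜ
  Exp-0 = mk≃ expSeq-0

  -- Log n = log (n + 1)
  Log : ℕ → ℂ
  Log n = fromℝ (log (suc n))

  approx-Log : ∀ n i → approx (Log n) i ≡ ι (logSeq (suc n) i)
  approx-Log n i = refl

  exp≡Exp : ∀ z → exp z ≡ Exp z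
  exp≡Exp z = refl

  log≡Log : ∀ n → fromℝ (log (suc n)) ≡ Log n
  log≡Log n = refl

  -- Once the Riemann sums are split exactly, the two sides at index i differ by log (n + 1) taken
  -- at the indices 2i + 1 and i, a difference that the Cauchy property makes small.
  Log-double : ∀ n → Log (suc (double n)) ≃ Log 1 +ᶜ Log n
  Log-double n = mk≃ λ ε 0<ε → let (N , h) = cauchy (log (suc n)) ε 0<ε in
    N , λ i N≤i → subst (_< ε) (sym (gap i)) (h (i ℕ.+ suc i) i (ℕP.≤-trans N≤i (ℕP.m≤m+n i (suc i))) N≤i)
    where
    gap : ∀ i → ‖ ι (logSeq (double (suc n)) i) ⊖ ι (logSeq 2 i + logSeq (suc n) i) ‖
                ≡ ∣ logSeq (suc n) (i ℕ.+ suc i) - logSeq (suc n) i ∣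
    gap i = trans (+-identityʳ ∣ logSeq (double (suc n)) i - (logSeq 2 i + logSeq (suc n) i) ∣) (cong ∣_∣ (trans
      (cong (_- (logSeq 2 i + logSeq (suc n) i)) (logSeq-double n i))
      (solve 3 (λ a b c → (a :+ b) :- (a :+ c) := b :- c) refl
        (logSeq 2 i) (logSeq (suc n) (i ℕ.+ suc i)) (logSeq (suc n) i))))

  -- pow n w = (n + 1)ʷ
  pow : ℕ → ℂ → ℂ
  pow n w = Exp (w *ᶜ Log n)

  pow≃Exp : ∀ n w → pow n w ≃ Exp (w *ᶜ Log n)
  pow≃Exp n w = ≃-refl

  Exp≡pow : ∀ n w → Exp (w *ᶜ Log n) ≡ pow n w
  Exp≡pow n w = refl

^ᶜ≡pow : ∀ n w → suc n ^ᶜ w ≡ pow n w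
^ᶜ≡pow n w = trans (exp≡Exp (w *ᶜ fromℝ (log (suc n))))
  (trans (cong (λ l → Exp (w *ᶜ l)) {fromℝ (log (suc n))} {Log n} (log≡Log n)) (Exp≡pow n w))

pow-double : ∀ n w → pow (suc (double n)) w ≃ pow 1 w *ᶜ pow n w
pow-double n w = begin
  pow (suc (double n)) w                   ≈⟨ pow≃Exp (suc (double n)) w ⟩
  Exp (w *ᶜ Log (suc (double n)))          ≈⟨ Exp-cong (*ᶜ-cong {w} {w} {Log (suc (double n))} {Log 1 +ᶜ Log n} ≃-refl (Log-double n)) ⟩
  Exp (w *ᶜ (Log 1 +ᶜ Log n))              ≈⟨ Exp-cong (pointwise {w *ᶜ (Log 1 +ᶜ Log n)} {w *ᶜ Log 1 +ᶜ w *ᶜ Log n} (λ i →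
                                               solveᵢ 3 (λ w a b → w ⊠ (a ⊞ b) ⊜ w ⊠ a ⊞ w ⊠ b) refl
                                                 (approx w i) (approx (Log 1) i) (approx (Log n) i))) ⟩
  Exp (w *ᶜ Log 1 +ᶜ w *ᶜ Log n)           ≈⟨ Exp-+ (w *ᶜ Log 1) (w *ᶜ Log n) ⟨
  Exp (w *ᶜ Log 1) *ᶜ Exp (w *ᶜ Log n)     ≈⟨ *ᶜ-cong {pow 1 w} {Exp (w *ᶜ Log 1)} {pow n w} {Exp (w *ᶜ Log n)} (pow≃Exp 1 w) (pow≃Exp n w) ⟨
  pow 1 w *ᶜ pow n w                       ∎
  where open ≃-Reasoning

pow-inverse : ∀ n w → pow n w *ᶜ pow n (-ᶜ w) ≃ 1ᶜ
pow-inverse n w = begin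
  pow n w *ᶜ pow n (-ᶜ w)                  ≈⟨ *ᶜ-cong {pow n w} {Exp (w *ᶜ Log n)} {pow n (-ᶜ w)} {Exp (-ᶜ w *ᶜ Log n)}
                                               (pow≃Exp n w) (pow≃Exp n (-ᶜ w)) ⟩
  Exp (w *ᶜ Log n) *ᶜ Exp (-ᶜ w *ᶜ Log n)  ≈⟨ Exp-+ (w *ᶜ Log n) (-ᶜ w *ᶜ Log n) ⟩
  Exp (w *ᶜ Log n +ᶜ -ᶜ w *ᶜ Log n)        ≈⟨ Exp-cong (pointwise {w *ᶜ Log n +ᶜ -ᶜ w *ᶜ Log n} {0ᶜ} (λ i →
                                               solveᵢ 2 (λ w l → w ⊠ l ⊞ (⊟ w) ⊠ l ⊜ conᵢ 0ᵢ) refl (approx w i) (approx (Log n) i))) ⟩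
  Exp 0ᶜ                                   ≈⟨ Exp-0 ⟩
  1ᶜ                                       ∎
  where open ≃-Reasoning

-- A lower bound for the modulus of the exponential

normSq : ℚ[i] → ℚ
normSq (a , b) = a * a + b * b

normSq-⊗ : ∀ z w → normSq (z ⊗ w) ≡ normSq z * normSq w
normSq-⊗ (a , b) (c , d) = solve 4 (λ a b c d →
  (a :* c :- b :* d) :* (a :* c :- b :* d) :+ (a :* d :+ b :* c) :* (a :* d :+ b :* c)
  := (a :* a :+ b :* b) :* (c :* c :+ d :* d)) refl a b c d

∣p∣*∣p∣≡p*p : ∀ p → ∣ p ∣ * ∣ p ∣ ≡ p * p
∣p∣*∣p∣≡p*p p with ∣p∣≡p∨∣p∣≡-p p
... | inj₁ eq = cong₂ _*_ eq eq
... | inj₂ eq = trans (cong₂ _*_ eq eq) (solve 1 (λ p → (:- p) :* (:- p) := p :* p) refl p)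

0≤p*p : ∀ p → 0ℚ ≤ p * p
0≤p*p p = ≤-trans (0≤* (0≤∣p∣ p) (0≤∣p∣ p)) (≤-reflexive (∣p∣*∣p∣≡p*p p))

0≤normSq : ∀ z → 0ℚ ≤ normSq z
0≤normSq (a , b) = 0≤+ (0≤p*p a) (0≤p*p b)

proj₁-⊗-conj : ∀ z → proj₁ (z ⊗ conj z) ≡ normSq z
proj₁-⊗-conj (a , b) = solve 2 (λ a b → a :* a :- b :* (:- b) := a :* a :+ b :* b) refl a b

+-cancelʳ-≤ : ∀ r p q → p + r ≤ q + r → p ≤ q
+-cancelʳ-≤ r p q h = subst₂ _≤_ (cancel p) (cancel q) (+-monoˡ-≤ (- r) h)
  where
  cancel : ∀ p → p + r + - r ≡ p
  cancel p = solve 2 (λ p r → p :+ r :+ :- r := p) refl p r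

p≤∣p∣ : ∀ p → p ≤ ∣ p ∣
p≤∣p∣ p with ∣p∣≡p∨∣p∣≡-p p
... | inj₁ eq = ≤-reflexive (sym eq)
... | inj₂ eq = ≤-trans (≤-reflexive (solve 1 (λ p → p := :- (:- p)) refl p))
  (≤-trans (≤-reflexive (cong -_ (sym eq))) (≤-trans (neg-antimono-≤ (0≤∣p∣ p)) (0≤∣p∣ p)))

p≤q+∣p-q∣ : ∀ p q → p ≤ q + ∣ p - q ∣
p≤q+∣p-q∣ p q = ≤-trans (≤-reflexive (solve 2 (λ p q → p := q :+ (p :- q)) refl p q))
  (+-monoʳ-≤ q (p≤∣p∣ (p - q)))

~⇒proj₁-≤ : ∀ {u v} → u ~ v → ∀ ε → 0ℚ < ε → Eventually (λ n → proj₁ (u n) ≤ proj₁ (v n) + ε)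
~⇒proj₁-≤ {u} {v} h ε 0<ε = eventually-map (λ n d<ε →
  ≤-trans (p≤q+∣p-q∣ (proj₁ (u n)) (proj₁ (v n)))
    (+-monoʳ-≤ (proj₁ (v n)) (≤-trans (‖proj₁‖ (u n ⊖ v n)) (<⇒≤ d<ε)))) (h ε 0<ε)

-- The squared modulus is the real part of z · conj z, so the compatibility of products with `≃`
-- carries over to it.
≃⇒normSq-≤ : ∀ {z w} → z ≃ w → ∀ ε → 0ℚ < ε →
  Eventually (λ n → normSq (approx z n) ≤ normSq (approx w n) + ε)
≃⇒normSq-≤ {z} {w} p ε 0<ε = eventually-map (λ n →
    subst₂ (λ x y → x ≤ y + ε) (proj₁-⊗-conj (approx z n)) (proj₁-⊗-conj (approx w n)))
  (~⇒proj₁-≤ {approx (z *ᶜ conjᶜ z)} {approx (w *ᶜ conjᶜ w)} (≃⇒~ (*ᶜ-cong {z} {w} {conjᶜ z} {conjᶜ w} p (conjᶜ-cong {z} {w} p))) ε 0<ε)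

Exp-conj : ∀ z → Exp (conjᶜ z) ≃ conjᶜ (Exp z)
Exp-conj z = pointwise (λ n → trans (approx-Exp (conjᶜ z) n)
  (trans (expSum-conj (approx z n) n) (cong conj (sym (approx-Exp z n)))))

Exp-*-conj : ∀ z → Exp (z +ᶜ conjᶜ z) ≃ Exp z *ᶜ conjᶜ (Exp z)
Exp-*-conj z = ≃-trans (≃-sym (Exp-+ z (conjᶜ z)))
  (*ᶜ-cong {Exp z} {Exp z} {Exp (conjᶜ z)} {conjᶜ (Exp z)} ≃-refl (Exp-conj z))

expSum-ι : ∀ x n → expSum (ι x) n ≡ ι (majSum x n)
expSum-ι x zero    = refl
expSum-ι x (suc n) = cong₂ _⊕_ (expSum-ι x n) (term n)
  where
  term : ∀ k → expTerm (ι x) k ≡ ι (majTerm x k)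
  term zero    = refl
  term (suc k) = trans (cong (λ e → 1/1+ k · (e ⊗ ι x)) (term k)) (cong₂ _,_
    (solve 3 (λ r m x → r :* (m :* x :- con 0ℚ :* con 0ℚ) := r :* (m :* x)) refl (1/1+ k) (majTerm x k) x)
    (solve 3 (λ r m x → r :* (m :* con 0ℚ :+ con 0ℚ :* x) := con 0ℚ) refl (1/1+ k) (majTerm x k) x))

-- At the argument 2x the terms of index 0, 1 and 2 add up to the left side exactly, and all later
-- terms are nonnegative.
majSum-≥ : ∀ x n → 0ℚ ≤ x → 3 ℕ.≤ n → (1ℚ + x) * (1ℚ + x) + x * x ≤ majSum (x + x) n
majSum-≥ x (suc (suc (suc n))) 0≤x _ = go n
  where
  0≤term : ∀ k → 0ℚ ≤ majTerm (x + x) k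
  0≤term zero    = nonNegative⁻¹ 1ℚ
  0≤term (suc k) = 0≤* (0≤1/1+ k) (0≤* (0≤term k) (0≤+ 0≤x 0≤x))
  go : ∀ n → (1ℚ + x) * (1ℚ + x) + x * x ≤ majSum (x + x) (3 ℕ.+ n)
  go zero    = ≤-reflexive (solve 1 (λ x →
    (con 1ℚ :+ x) :* (con 1ℚ :+ x) :+ x :* x
    := con 0ℚ :+ con 1ℚ :+ con 1ℚ :* (con 1ℚ :* (x :+ x))
       :+ con ½ :* ((con 1ℚ :* (con 1ℚ :* (x :+ x))) :* (x :+ x))) refl x)
  go (suc n) = ≤-trans (go n) (p≤p+q (0≤term (3 ℕ.+ n)))
majSum-≥ x 0 _ ()
majSum-≥ x 1 _ (ℕ.s≤s ())
majSum-≥ x 2 _ (ℕ.s≤s (ℕ.s≤s ()))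

-- ∣ exp z ∣² = exp (2 re z) ≥ 1 + 2 re z + 2 (re z)², which leaves room for an error of p².
normSq-Exp-≥ : ∀ {p} z → 0ℚ < p → Eventually (λ n → p ≤ seq (re z) n) →
  Eventually (λ n → (1ℚ + p) * (1ℚ + p) ≤ normSq (approx (Exp z) n))
normSq-Exp-≥ {p} z 0<p h = eventually-map₂ (λ n → lower n)
  (eventually-map₂ (λ _ → _,_) (3 , λ _ → λ 3≤n → 3≤n) h)
  (~⇒proj₁-≤ {approx (Exp (z +ᶜ conjᶜ z))} {approx (Exp z *ᶜ conjᶜ (Exp z))} (≃⇒~ (Exp-*-conj z))
    (p * p) (positive⁻¹ (p * p) {{pos*pos⇒pos p {{ℚ.positive 0<p}} p {{ℚ.positive 0<p}}}}))
  where
  open ≤-Reasoning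
  0≤p = <⇒≤ 0<p
  lower : ∀ n → 3 ℕ.≤ n × p ≤ seq (re z) n →
    proj₁ (approx (Exp (z +ᶜ conjᶜ z)) n) ≤ proj₁ (approx (Exp z) n ⊗ conj (approx (Exp z) n)) + p * p →
    (1ℚ + p) * (1ℚ + p) ≤ normSq (approx (Exp z) n)
  lower n (3≤n , p≤x) e = +-cancelʳ-≤ (p * p) ((1ℚ + p) * (1ℚ + p)) (normSq (approx (Exp z) n)) (begin
    (1ℚ + p) * (1ℚ + p) + p * p
      ≤⟨ +-mono-≤ (*-mono (0≤+ (nonNegative⁻¹ 1ℚ) 0≤p) (0≤+ (nonNegative⁻¹ 1ℚ) 0≤x) (+-monoʳ-≤ 1ℚ p≤x) (+-monoʳ-≤ 1ℚ p≤x))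
                  (*-mono 0≤p 0≤x p≤x p≤x) ⟩
    (1ℚ + x) * (1ℚ + x) + x * x
      ≤⟨ majSum-≥ x n 0≤x 3≤n ⟩
    majSum (x + x) n
      ≡⟨ cong proj₁ (trans (sym (expSum-ι (x + x) n)) (trans (cong (λ b → expSum (x + x , b) n) (sym (+-inverseʳ y)))
           (sym (approx-Exp (z +ᶜ conjᶜ z) n)))) ⟩
    proj₁ (approx (Exp (z +ᶜ conjᶜ z)) n)
      ≤⟨ e ⟩
    proj₁ (approx (Exp z) n ⊗ conj (approx (Exp z) n)) + p * p
      ≡⟨ cong (_+ p * p) (proj₁-⊗-conj (approx (Exp z) n)) ⟩
    normSq (approx (Exp z) n) + p * p ∎)
    where
    x = seq (re z) n
    y = seq (im z) n
    0≤x = ≤-trans 0≤p p≤x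

-- Divergence of the harmonic series and Kummer's comparison sequence

positive-* : ∀ {p q} → 0ℚ < p → 0ℚ < q → 0ℚ < p * q
positive-* {p} {q} 0<p 0<q = positive⁻¹ (p * q) {{pos*pos⇒pos p {{ℚ.positive 0<p}} q {{ℚ.positive 0<q}}}}

0<1/1+ : ∀ n → 0ℚ < 1/1+ n
0<1/1+ n = positive⁻¹ (1/1+ n)

reciprocal : ∀ p → 0ℚ < p → ∃[ r ] 0ℚ < r × p * r ≡ 1ℚ
reciprocal p 0<p = ℚ.1/ p , positive⁻¹ (ℚ.1/ p) {{1/pos⇒pos p {{pos}}}} , *-inverseʳ p
  where
  pos = ℚ.positive 0<p
  instance
    nonZero : ℚ.NonZero p
    nonZero = pos⇒nonZero p {{pos}}

-- Oresme's grouping: the N + 1 terms from 1/(N + 2) to 1/(2N + 2) contribute at least ½.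
harmonic-unbounded : ∀ M → ∃[ N ] fromℕ M * ½ ≤ harmonic 1 N
harmonic-unbounded zero    = 0 , ≤-reflexive (*-zeroˡ ½)
harmonic-unbounded (suc M) = let (N , h) = harmonic-unbounded M in N ℕ.+ suc N , (begin
  fromℕ (suc M) * ½                           ≡⟨ sym (fromℕ-suc-* M ½) ⟩
  fromℕ M * ½ + ½                             ≤⟨ +-mono-≤ h (Refinement.block-≥ N 1) ⟩
  harmonic 1 N + harmonic (1 ℕ.* suc N) (suc N)
    ≡⟨ cong (λ a → harmonic 1 N + harmonic a (suc N)) (ℕP.*-identityˡ (suc N)) ⟩
  harmonic 1 N + harmonic (suc N) (suc N)     ≡⟨ sym (harmonic-split 1 N (suc N)) ⟩
  harmonic 1 (N ℕ.+ suc N)                    ∎)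
  where open ≤-Reasoning

0≤harmonic : ∀ a L → 0ℚ ≤ harmonic a L
0≤harmonic a zero    = ≤-refl
0≤harmonic a (suc L) = 0≤+ (0≤harmonic a L) (0≤1/1+ (a ℕ.+ L))

harmonic-mono : ∀ a {L M} → L ℕ.≤ M → harmonic a L ≤ harmonic a M
harmonic-mono a {L} {M} L≤M = ≤-trans (p≤p+q (0≤harmonic (a ℕ.+ L) (M ∸ L)))
  (≤-reflexive (trans (sym (harmonic-split a L (M ∸ L))) (cong (harmonic a) (ℕP.m+[n∸m]≡n L≤M))))

1/1+-step : ∀ n → 1/1+ suc n * (1ℚ + 1/1+ n) ≡ 1/1+ n
1/1+-step n = begin
  r′ * (1ℚ + r₀)              ≡⟨ cong (λ x → r′ * (x + r₀)) (sym (1/1+-inverse n)) ⟩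
  r′ * (fromℕ (suc n) * r₀ + r₀) ≡⟨ cong (r′ *_) (fromℕ-suc-* (suc n) r₀) ⟩
  r′ * (m * r₀)               ≡⟨ solve 3 (λ a b c → a :* (b :* c) := b :* a :* c) refl r′ m r₀ ⟩
  m * r′ * r₀                 ≡⟨ cong (_* r₀) (1/1+-inverse (suc n)) ⟩
  1ℚ * r₀                     ≡⟨ *-identityˡ r₀ ⟩
  r₀                          ∎
  where
  open ≡-Reasoning
  r₀ = 1/1+ n
  r′ = 1/1+ suc n
  m = fromℕ (suc (suc n))

-- Kummer's test: β decays like n^{-(1+θ)}, its terms are the differences of γ / θ,
-- and γ tends to zero because the harmonic series diverges.
module Kummer (θ : ℚ) (0<θ : 0ℚ < θ) where

  ρ : ℕ → ℚ
  ρ n = 1ℚ + θ * 1/1+ suc n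

  0<ρ : ∀ n → 0ℚ < ρ n
  0<ρ n = +-mono-< (positive⁻¹ 1ℚ) (positive-* 0<θ (0<1/1+ (suc n)))

  ρ⁻¹ : ℕ → ℚ
  ρ⁻¹ n = proj₁ (reciprocal (ρ n) (0<ρ n))

  0<ρ⁻¹ : ∀ n → 0ℚ < ρ⁻¹ n
  0<ρ⁻¹ n = proj₁ (proj₂ (reciprocal (ρ n) (0<ρ n)))

  γ : ℕ → ℚ
  -- Normalised so that `γ 1` is 2 and `β 0` is 1, the modulus of 1⁻ˢ.
  γ zero    = fromℕ 2 * ρ 0
  γ (suc n) = γ n * ρ⁻¹ n

  β : ℕ → ℚ
  β n = γ (suc n) * 1/1+ suc n

  0<γ : ∀ n → 0ℚ < γ n
  0<γ zero    = positive-* {fromℕ 2} (positive⁻¹ (fromℕ 2)) (0<ρ 0)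
  0<γ (suc n) = positive-* (0<γ n) (0<ρ⁻¹ n)

  0<β : ∀ n → 0ℚ < β n
  0<β n = positive-* (0<γ (suc n)) (0<1/1+ (suc n))

  γ-step : ∀ n → γ (suc n) * ρ n ≡ γ n
  γ-step n = trans (solve 3 (λ g r′ r₀ → g :* r′ :* r₀ := g :* (r₀ :* r′)) refl (γ n) (ρ⁻¹ n) (ρ n))
    (trans (cong (γ n *_) (proj₂ (proj₂ (reciprocal (ρ n) (0<ρ n))))) (*-identityʳ (γ n)))

  -- As (1 + 1/(n + 2))/(n + 3) = 1/(n + 2), the factor divided by n + 3 becomes (1 + θ/(n + 3))/(n
  -- + 2), and its numerator `ρ (suc n)` is what one step of `γ` absorbs. The factor is the growth
  -- that the exponential bound guarantees for the ratio of consecutive powers.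
  β-step : ∀ n → β (suc n) * (1ℚ + (1ℚ + θ) * 1/1+ suc n) ≡ β n
  β-step n = begin
    g * r′ * (1ℚ + (1ℚ + θ) * r₀)
      ≡⟨ solve 4 (λ g r′ r₀ θ → g :* r′ :* (con 1ℚ :+ (con 1ℚ :+ θ) :* r₀)
           := g :* (r′ :* (con 1ℚ :+ r₀) :+ θ :* r′ :* r₀)) refl g r′ r₀ θ ⟩
    g * (r′ * (1ℚ + r₀) + θ * r′ * r₀)
      ≡⟨ cong (λ x → g * (x + θ * r′ * r₀)) (1/1+-step (suc n)) ⟩
    g * (r₀ + θ * r′ * r₀)
      ≡⟨ solve 4 (λ g r′ r₀ θ → g :* (r₀ :+ θ :* r′ :* r₀) := g :* (con 1ℚ :+ θ :* r′) :* r₀) refl g r′ r₀ θ ⟩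
    g * ρ (suc n) * r₀
      ≡⟨ cong (_* r₀) (γ-step (suc n)) ⟩
    β n ∎
    where
    open ≡-Reasoning
    g = γ (suc (suc n))
    r₀ = 1/1+ suc n
    r′ = 1/1+ suc (suc n)

  θ*β : ∀ n → θ * β n ≡ γ n - γ (suc n)
  θ*β n = trans (solve 3 (λ θ g r₀ → θ :* (g :* r₀) := g :* (con 1ℚ :+ θ :* r₀) :- g) refl θ (γ (suc n)) (1/1+ suc n))
    (cong (_- γ (suc n)) (γ-step n))

  β0≡1 : β 0 ≡ 1ℚ
  β0≡1 = trans (cong (_* ½) (trans (*-assoc (fromℕ 2) (ρ 0) (ρ⁻¹ 0))
    (cong (fromℕ 2 *_) (proj₂ (proj₂ (reciprocal (ρ 0) (0<ρ 0))))))) refl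

  -- This is ∏ (1 + aᵢ) ≥ 1 + ∑ aᵢ for the product γ 0 / γ n, whose factors are 1 + θ/(i + 2).
  γ-harmonic : ∀ n → γ n * (1ℚ + θ * harmonic 1 n) ≤ γ 0
  γ-harmonic zero    = ≤-reflexive (trans (cong (λ x → γ 0 * (1ℚ + x)) (*-zeroʳ θ)) (*-identityʳ (γ 0)))
  γ-harmonic (suc n) = ≤-trans
    (*-monoˡ-≤-nonNeg g {{ℚ.nonNegative (<⇒≤ (0<γ (suc n)))}} (≤-trans
      (p≤p+q {q = (θ * r₀) * (θ * H)} (0≤* (0≤* 0≤θ (0≤1/1+ (suc n))) (0≤* 0≤θ (0≤harmonic 1 n))))
      (≤-reflexive (solve 3 (λ θ h r₀ → con 1ℚ :+ θ :* (h :+ r₀) :+ (θ :* r₀) :* (θ :* h)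
        := (con 1ℚ :+ θ :* r₀) :* (con 1ℚ :+ θ :* h)) refl θ H r₀))))
    (≤-trans (≤-reflexive (trans (sym (*-assoc g (ρ n) (1ℚ + θ * H))) (cong (_* (1ℚ + θ * H)) (γ-step n))))
      (γ-harmonic n))
    where
    g = γ (suc n)
    r₀ = 1/1+ suc n
    H = harmonic 1 n
    0≤θ = <⇒≤ 0<θ

  γ-null : Null γ
  γ-null ε 0<ε =
    let (θ⁻¹ , 0<θ⁻¹ , inv) = reciprocal θ 0<θ
        0<c = positive-* (0<γ 0) (positive-* (positive⁻¹ (fromℕ 2)) 0<θ⁻¹)
        (j , hj) = null-* (<⇒≤ 0<c) null-1/1+ ε 0<ε
        (N , hN) = harmonic-unbounded (suc j)
    in N , λ n N≤n → ≤-<-trans (bound θ⁻¹ (<⇒≤ 0<θ⁻¹) inv j n (≤-trans hN (harmonic-mono 1 N≤n))) (hj j ℕP.≤-refl)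
    where
    open ≤-Reasoning
    bound : ∀ θ⁻¹ → 0ℚ ≤ θ⁻¹ → θ * θ⁻¹ ≡ 1ℚ → ∀ j n → fromℕ (suc j) * ½ ≤ harmonic 1 n →
      γ n ≤ γ 0 * (fromℕ 2 * θ⁻¹) * 1/1+ j
    bound θ⁻¹ 0≤θ⁻¹ inv j n h = begin
      γ n
        ≡⟨ sym (trans (cong₂ (λ a b → γ n * (a * b)) (1/1+-inverse j) inv) (*-identityʳ (γ n))) ⟩
      γ n * (fromℕ (suc j) * 1/1+ j * (θ * θ⁻¹))
        ≡⟨ solve 5 (λ g m r₀ a b → g :* (m :* r₀ :* (a :* b)) := g :* (a :* (m :* con ½)) :* (con (fromℕ 2) :* b) :* r₀)
             refl (γ n) (fromℕ (suc j)) (1/1+ j) θ θ⁻¹ ⟩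
      γ n * (θ * (fromℕ (suc j) * ½)) * (fromℕ 2 * θ⁻¹) * 1/1+ j
        ≤⟨ *-monoʳ-≤-nonNeg (1/1+ j) (*-monoʳ-≤-nonNeg (fromℕ 2 * θ⁻¹) {{ℚ.nonNegative (0≤* (0≤fromℕ 2) 0≤θ⁻¹)}}
             (≤-trans (*-monoˡ-≤-nonNeg (γ n) {{ℚ.nonNegative (<⇒≤ (0<γ n))}}
               (≤-trans (*-monoˡ-≤-nonNeg θ {{ℚ.nonNegative (<⇒≤ 0<θ)}} h) (q≤p+q (nonNegative⁻¹ 1ℚ))))
               (γ-harmonic n))) ⟩
      γ 0 * (fromℕ 2 * θ⁻¹) * 1/1+ j ∎

-- Decay of n⁻ˢ and limits of sequences

‖‖²≤2normSq : ∀ z → ‖ z ‖ * ‖ z ‖ ≤ normSq z + normSq z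
‖‖²≤2normSq (a , b) = ≤-trans (p≤p+q (0≤p*p (∣ a ∣ - ∣ b ∣)))
  (≤-reflexive (trans
    (solve 2 (λ a b → (a :+ b) :* (a :+ b) :+ (a :- b) :* (a :- b)
      := (a :* a :+ b :* b) :+ (a :* a :+ b :* b)) refl (∣ a ∣) (∣ b ∣))
    (cong₂ (λ x y → (x + y) + (x + y)) (∣p∣*∣p∣≡p*p a) (∣p∣*∣p∣≡p*p b))))

normSq≤‖‖² : ∀ z → normSq z ≤ ‖ z ‖ * ‖ z ‖
normSq≤‖‖² (a , b) = ≤-trans (≤-reflexive (sym (cong₂ _+_ (∣p∣*∣p∣≡p*p a) (∣p∣*∣p∣≡p*p b))))
  (≤-trans (p≤p+q (0≤+ (0≤* (0≤∣p∣ a) (0≤∣p∣ b)) (0≤* (0≤∣p∣ a) (0≤∣p∣ b))))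
    (≤-reflexive (solve 2 (λ a b → (a :* a :+ b :* b) :+ (a :* b :+ a :* b) := (a :+ b) :* (a :+ b))
      refl (∣ a ∣) (∣ b ∣))))

*-self-cancel-≤ : ∀ p q → 0ℚ < q → p * p ≤ q * q → p ≤ q
*-self-cancel-≤ p q 0<q h = ≮⇒≥ λ q<p → <-irrefl refl (<-≤-trans
  (<-≤-trans (*-monoʳ-<-pos q {{ℚ.positive 0<q}} q<p)
    (*-monoʳ-≤-nonNeg p {{ℚ.nonNegative (<⇒≤ (<-trans 0<q q<p))}} (<⇒≤ q<p)))
  h)

-- ∣ z ∣ ≤ c
Dominated : ℂ → ℚ → Set
Dominated z c = ∀ η → 0ℚ < η → Eventually (λ n → normSq (approx z n) ≤ c * c + η)

-- ∣w∣ = ∣z∣ / ∣e∣ ≤ c / μ = b, argued by cancelling μ² instead of dividing. The hypothesis 1 ≤ μ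
-- keeps the error η from growing under the cancellation.
dominated-quotient : ∀ {w e z μ b c} → w *ᶜ e ≃ z → 1ℚ ≤ μ → Eventually (λ n → μ * μ ≤ normSq (approx e n)) →
  b * μ ≡ c → Dominated z c → Dominated w b
dominated-quotient {w} {e} {z} {μ} {b} {c} we≃z 1≤μ μ²≤ bμ≡c dom η 0<η =
  eventually-map₂ (λ n → bound n) μ²≤
    (eventually-map₂ (λ n → _,_) (≃⇒normSq-≤ {w *ᶜ e} {z} we≃z (½ * η) (0<½ε 0<η)) (dom (½ * η) (0<½ε 0<η)))
  where
  open ≤-Reasoning
  0≤η = <⇒≤ 0<η
  1≤μ² : 1ℚ ≤ μ * μ
  1≤μ² = *-mono (nonNegative⁻¹ 1ℚ) (≤-trans (nonNegative⁻¹ 1ℚ) 1≤μ) 1≤μ 1≤μ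
  bound : ∀ n → μ * μ ≤ normSq (approx e n) →
    normSq (approx w n ⊗ approx e n) ≤ normSq (approx z n) + ½ * η × normSq (approx z n) ≤ c * c + ½ * η →
    normSq (approx w n) ≤ b * b + η
  bound n μ²≤E (we≤z , z≤c) = *-cancelʳ-≤-pos (μ * μ) {{ℚ.positive (<-≤-trans (positive⁻¹ 1ℚ) 1≤μ²)}} (begin
    normSq (approx w n) * (μ * μ)
      ≤⟨ *-monoˡ-≤-nonNeg (normSq (approx w n)) {{ℚ.nonNegative (0≤normSq (approx w n))}} μ²≤E ⟩
    normSq (approx w n) * normSq (approx e n)
      ≡⟨ sym (normSq-⊗ (approx w n) (approx e n)) ⟩
    normSq (approx w n ⊗ approx e n)
      ≤⟨ ≤-trans we≤z (+-monoˡ-≤ (½ * η) z≤c) ⟩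
    c * c + ½ * η + ½ * η
      ≡⟨ trans (+-assoc (c * c) (½ * η) (½ * η)) (cong (c * c +_) (½+½ η)) ⟩
    c * c + η
      ≡⟨ cong (λ x → x * x + η) (sym bμ≡c) ⟩
    b * μ * (b * μ) + η
      ≡⟨ cong (b * μ * (b * μ) +_) (sym (*-identityʳ η)) ⟩
    b * μ * (b * μ) + η * 1ℚ
      ≤⟨ +-monoʳ-≤ (b * μ * (b * μ)) (*-monoˡ-≤-nonNeg η {{ℚ.nonNegative 0≤η}} 1≤μ²) ⟩
    b * μ * (b * μ) + η * (μ * μ)
      ≡⟨ solve 3 (λ b μ η → b :* μ :* (b :* μ) :+ η :* (μ :* μ) := (b :* b :+ η) :* (μ :* μ)) refl b μ η ⟩
    (b * b + η) * (μ * μ) ∎)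

-- Spending the slack η = c² gives ∣z∣² ≤ 2c². The ℓ¹ norm is at most √2 times the modulus, so its
-- square is at most 4c², a rational square with root c + c.
dominated⇒‖‖≤ : ∀ {z c} → 0ℚ < c → Dominated z c → Eventually (λ n → ‖ approx z n ‖ ≤ c + c)
dominated⇒‖‖≤ {z} {c} 0<c dom = eventually-map bound (dom (c * c) (positive-* 0<c 0<c))
  where
  bound : ∀ n → normSq (approx z n) ≤ c * c + c * c → ‖ approx z n ‖ ≤ c + c
  bound n h = *-self-cancel-≤ ‖ approx z n ‖ (c + c) (+-mono-< 0<c 0<c) (≤-trans (‖‖²≤2normSq (approx z n))
    (≤-trans (+-mono-≤ h h) (≤-reflexive (solve 1 (λ c →
      (c :* c :+ c :* c) :+ (c :* c :+ c :* c) := (c :+ c) :* (c :+ c)) refl c))))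

logIncrement : ℕ → ℂ
logIncrement n = Log (suc n) -ᶜ Log n

-- The ratio ((n + 2)/(n + 1))ˢ appears as a factor and not as a quotient, the form that
-- `dominated-quotient` consumes.
pow-ratio : ∀ n s → pow (suc n) (-ᶜ s) *ᶜ Exp (s *ᶜ logIncrement n) ≃ pow n (-ᶜ s)
pow-ratio n s = begin
  pow (suc n) (-ᶜ s) *ᶜ Exp (s *ᶜ logIncrement n)
    ≈⟨ *ᶜ-cong {pow (suc n) (-ᶜ s)} {Exp (-ᶜ s *ᶜ Log (suc n))} {Exp (s *ᶜ logIncrement n)} {Exp (s *ᶜ logIncrement n)}
         (pow≃Exp (suc n) (-ᶜ s)) ≃-refl ⟩
  Exp (-ᶜ s *ᶜ Log (suc n)) *ᶜ Exp (s *ᶜ logIncrement n)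
    ≈⟨ Exp-+ (-ᶜ s *ᶜ Log (suc n)) (s *ᶜ logIncrement n) ⟩
  Exp (-ᶜ s *ᶜ Log (suc n) +ᶜ s *ᶜ logIncrement n)
    ≈⟨ Exp-cong (pointwise { -ᶜ s *ᶜ Log (suc n) +ᶜ s *ᶜ logIncrement n} { -ᶜ s *ᶜ Log n} (λ i →
         solveᵢ 3 (λ s a b → (⊟ s) ⊠ a ⊞ s ⊠ (a ⊟ b) ⊜ (⊟ s) ⊠ b) refl
           (approx s i) (approx (Log (suc n)) i) (approx (Log n) i))) ⟩
  Exp (-ᶜ s *ᶜ Log n)
    ≈⟨ pow≃Exp n (-ᶜ s) ⟨
  pow n (-ᶜ s) ∎
  where open ≃-Reasoning

re-*-logIncrement : ∀ n s i →
  seq (re (s *ᶜ logIncrement n)) i ≡ seq (re s) i * (logSeq (suc (suc n)) i - logSeq (suc n) i)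
re-*-logIncrement n s i = trans
  (cong₂ (λ x y → σ * (proj₁ x - proj₁ y) - τ * (proj₂ x - proj₂ y)) (approx-Log (suc n) i) (approx-Log n i))
  (solve 3 (λ σ τ d → σ :* d :- τ :* con 0ℚ := σ :* d) refl σ τ (logSeq (suc (suc n)) i - logSeq (suc n) i))
  where
  σ = seq (re s) i
  τ = seq (im s) i

module Decay (s : ℂ) (θ : ℚ) (0<θ : 0ℚ < θ) (1+θ≤σ : Eventually (λ i → 1ℚ + θ ≤ seq (re s) i)) where
  open Kummer θ 0<θ

  0<1+θ : 0ℚ < 1ℚ + θ
  0<1+θ = +-mono-< (positive⁻¹ 1ℚ) 0<θ

  re-≥ : ∀ n → Eventually (λ i → (1ℚ + θ) * 1/1+ suc n ≤ seq (re (s *ᶜ logIncrement n)) i)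
  re-≥ n = eventually-map (λ i 1+θ≤σᵢ → ≤-trans
    (*-mono (<⇒≤ 0<1+θ) (≤-trans (0≤1/1+ (suc n)) (logSeq-increment n i)) 1+θ≤σᵢ (logSeq-increment n i))
    (≤-reflexive (sym (re-*-logIncrement n s i)))) 1+θ≤σ

  -- Induction on n. At n = 0 the logarithm is an empty sum, so the power is 1 = `β 0`. In the step
  -- the ratio has modulus at least 1 + (1 + θ)/(n + 2), the very factor by which `β` shrinks.
  dominated : ∀ n → Dominated (pow n (-ᶜ s)) (β n)
  dominated zero η 0<η = eventually-map (λ i → subst (λ c → normSq (approx (pow 0 (-ᶜ s)) i) ≤ c * c + η) (sym β0≡1))
    (≃⇒normSq-≤ {pow 0 (-ᶜ s)} {1ᶜ} pow-0≃1 η 0<η)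
    where
    pow-0≃1 : pow 0 (-ᶜ s) ≃ 1ᶜ
    pow-0≃1 = ≃-trans (pow≃Exp 0 (-ᶜ s)) (≃-trans
      (Exp-cong (pointwise { -ᶜ s *ᶜ Log 0} {0ᶜ} (λ i → trans (cong (neg (approx s i) ⊗_) (approx-Log 0 i))
        (solveᵢ 1 (λ x → x ⊠ conᵢ 0ᵢ ⊜ conᵢ 0ᵢ) refl (neg (approx s i))))))
      Exp-0)
  dominated (suc n) = dominated-quotient {pow (suc n) (-ᶜ s)} {Exp (s *ᶜ logIncrement n)} {pow n (-ᶜ s)}
    {b = β (suc n)} {c = β n} (pow-ratio n s) (p≤p+q (<⇒≤ 0<p)) (normSq-Exp-≥ (s *ᶜ logIncrement n) 0<p (re-≥ n)) (β-step n) (dominated n)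
    where
    0<p = positive-* 0<1+θ (0<1/1+ (suc n))

  pow-bound : ∀ n → Eventually (λ i → ‖ approx (pow n (-ᶜ s)) i ‖ ≤ β n + β n)
  pow-bound n = dominated⇒‖‖≤ {pow n (-ᶜ s)} (0<β n) (dominated n)

infix 4 _⇒_

-- The threshold for the approximation index i may depend on N, so no uniformity among the
-- representatives of different terms is required. Being phrased with a rational norm, this form of
-- convergence is easier to compose than `_⟶_`.
_⇒_ : (ℕ → ℂ) → ℂ → Set
z ⇒ w = ∀ ε → 0ℚ < ε → Eventually (λ N → Eventually (λ i → ‖ approx (z N) i ⊖ approx w i ‖ < ε))

module Completion (z : ℕ → ℂ) (κ : ℕ → ℚ) (0≤κ : ∀ N → 0ℚ ≤ κ N) (κ-null : Null κ)
  (gap : ∀ N j → Eventually (λ i → ‖ approx (z (j ℕ.+ N)) i ⊖ approx (z N) i ‖ ≤ κ N)) where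

  opaque
    modulus : ∀ N → ∃[ M ] (∀ m n → M ℕ.≤ m → M ℕ.≤ n → ‖ approx (z N) m ⊖ approx (z N) n ‖ ≤ 1/1+ N)
    modulus N =
      let (M , h) = vanishing-+ (cauchy (re (z N))) (cauchy (im (z N))) (1/1+ N) (0<1/1+ N)
      in M , λ m n p q → <⇒≤ (h m n p q)

  index : ℕ → ℕ
  index N = proj₁ (modulus N)

  oscillation-≤ : ∀ N m n → index N ℕ.≤ m → index N ℕ.≤ n → ‖ approx (z N) m ⊖ approx (z N) n ‖ ≤ 1/1+ N
  oscillation-≤ N = proj₂ (modulus N)

  diagonal : ℕ → ℚ[i]
  diagonal N = approx (z N) (index N)

  diagonal-gap : ∀ {N M} → N ℕ.≤ M → ‖ diagonal M ⊖ diagonal N ‖ ≤ 1/1+ M + (κ N + 1/1+ N)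
  -- The bound does not mention i, so a single index past both moduli and past the threshold of
  -- `gap` suffices.
  diagonal-gap {N} {M} N≤M = eventually-const (eventually-map₂ bound
    (eventually-map₂ (λ _ → _,_) (index M , λ _ h → h) (index N , λ _ h → h))
    (subst (λ K → Eventually (λ i → ‖ approx (z K) i ⊖ approx (z N) i ‖ ≤ κ N)) (ℕP.m∸n+n≡m N≤M) (gap N (M ∸ N))))
    where
    bound : ∀ i → index M ℕ.≤ i × index N ℕ.≤ i → ‖ approx (z M) i ⊖ approx (z N) i ‖ ≤ κ N →
      ‖ diagonal M ⊖ diagonal N ‖ ≤ 1/1+ M + (κ N + 1/1+ N)
    bound i (p , q) h = ≤-trans (‖⊖‖-triangle (diagonal M) (approx (z M) i) (diagonal N))
      (+-mono-≤ (oscillation-≤ M (index M) i ℕP.≤-refl p)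
        (≤-trans (‖⊖‖-triangle (approx (z M) i) (approx (z N) i) (diagonal N))
          (+-mono-≤ h (oscillation-≤ N i (index N) q ℕP.≤-refl))))

  diagonal-vanishing : Vanishing (λ m n → ‖ diagonal m ⊖ diagonal n ‖)
  diagonal-vanishing = vanishing-≤ 0 (λ m n _ _ → bound m n)
    (vanishing-+ (vanishing-+ (null⇒vanishing κ-null) second) vanishing-1/1+)
    where
    second : Vanishing (λ _ n → κ n)
    second ε 0<ε = let (N , h) = κ-null ε 0<ε in N , λ _ n _ N≤n → h n N≤n
    bound : ∀ m n → ‖ diagonal m ⊖ diagonal n ‖ ≤ κ m + κ n + (1/1+ m + 1/1+ n)
    bound m n with ℕP.≤-total n m
    ... | inj₁ n≤m = ≤-trans (diagonal-gap n≤m) (≤-trans (q≤p+q (0≤κ m))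
      (≤-reflexive (solve 4 (λ a b c d → a :+ (c :+ (b :+ d)) := a :+ b :+ (c :+ d)) refl (κ m) (κ n) (1/1+ m) (1/1+ n))))
    ... | inj₂ m≤n = ≤-trans (≤-reflexive (‖⊖‖-sym (diagonal m) (diagonal n)))
      (≤-trans (diagonal-gap m≤n) (≤-trans (q≤p+q (0≤κ n))
        (≤-reflexive (solve 4 (λ a b c d → b :+ (d :+ (a :+ c)) := a :+ b :+ (c :+ d)) refl (κ m) (κ n) (1/1+ m) (1/1+ n)))))

  opaque
    limit : ℂ
    limit =
      mkℝ (λ n → proj₁ (diagonal n))
        (vanishing-≤ 0 (λ m n _ _ → ‖proj₁‖ (diagonal m ⊖ diagonal n)) diagonal-vanishing)
      +i
      mkℝ (λ n → proj₂ (diagonal n))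
        (vanishing-≤ 0 (λ m n _ _ → ‖proj₂‖ (diagonal m ⊖ diagonal n)) diagonal-vanishing)

    converges : z ⇒ limit
    converges ε 0<ε = eventually-map (λ N h → eventually-map₂ (λ i → close N i h) (index N , λ _ p → p) (N , λ _ p → p))
      (null-+ null-1/1+ (null-+ null-1/1+ (null-+ κ-null null-1/1+)) ε 0<ε)
      where
      close : ∀ N i → 1/1+ N + (1/1+ N + (κ N + 1/1+ N)) < ε → index N ℕ.≤ i → N ℕ.≤ i →
        ‖ approx (z N) i ⊖ diagonal i ‖ < ε
      close N i h p N≤i = ≤-<-trans (≤-trans (‖⊖‖-triangle (approx (z N) i) (diagonal N) (diagonal i))
        (+-mono-≤ (oscillation-≤ N i (index N) p ℕP.≤-refl)
          (≤-trans (≤-reflexive (‖⊖‖-sym (diagonal N) (diagonal i))) (≤-trans (diagonal-gap N≤i)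
            (+-monoˡ-≤ (κ N + 1/1+ N) (1/1+-antitone N≤i)))))) h

⇒-≃ : ∀ {z z′ w} → (∀ N → z N ≃ z′ N) → z ⇒ w → z′ ⇒ w
⇒-≃ {z} {z′} {w} p h ε 0<ε = eventually-map
  (λ N → eventually-map₂ (λ i → close N i) (≃⇒~ (p N) (½ * ε) (0<½ε 0<ε))) (h (½ * ε) (0<½ε 0<ε))
  where
  close : ∀ N i → ‖ approx (z N) i ⊖ approx (z′ N) i ‖ < ½ * ε → ‖ approx (z N) i ⊖ approx w i ‖ < ½ * ε →
    ‖ approx (z′ N) i ⊖ approx w i ‖ < ε
  close N i a b = ≤-<-trans (‖⊖‖-triangle (approx (z′ N) i) (approx (z N) i) (approx w i))
    (subst₂ _<_ (cong (_+ ‖ approx (z N) i ⊖ approx w i ‖) (‖⊖‖-sym (approx (z N) i) (approx (z′ N) i))) (½+½ ε)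
      (+-mono-< a b))

-- For a given ε, one common term z N close to both limits is enough; N then disappears from the
-- conclusion.
⇒-unique : ∀ {z w w′} → z ⇒ w → z ⇒ w′ → w ≃ w′
⇒-unique {z} {w} {w′} h h′ = mk≃ λ ε 0<ε → eventually-const (eventually-map₂
  (λ N → eventually-map₂ (λ i a b → ≤-<-trans (‖⊖‖-triangle (approx w i) (approx (z N) i) (approx w′ i))
    (subst₂ _<_ (cong (_+ ‖ approx (z N) i ⊖ approx w′ i ‖) (‖⊖‖-sym (approx (z N) i) (approx w i))) (½+½ ε)
      (+-mono-< a b))))
  (h (½ * ε) (0<½ε 0<ε)) (h′ (½ * ε) (0<½ε 0<ε)))

⇒-+ : ∀ {z z′ w w′} → z ⇒ w → z′ ⇒ w′ → (λ N → z N +ᶜ z′ N) ⇒ w +ᶜ w′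
⇒-+ {z} {z′} {w} {w′} h h′ ε 0<ε = eventually-map₂ (λ N → eventually-map₂ (λ i a b → ≤-<-trans
    (≤-trans (≤-reflexive (cong ‖_‖ (solveᵢ 4 (λ a b c d → (a ⊞ b) ⊟ (c ⊞ d) ⊜ (a ⊟ c) ⊞ (b ⊟ d)) refl
        (approx (z N) i) (approx (z′ N) i) (approx w i) (approx w′ i))))
      (‖⊕‖ (approx (z N) i ⊖ approx w i) (approx (z′ N) i ⊖ approx w′ i)))
    (subst (‖ approx (z N) i ⊖ approx w i ‖ + ‖ approx (z′ N) i ⊖ approx w′ i ‖ <_) (½+½ ε) (+-mono-< a b))))
  (h (½ * ε) (0<½ε 0<ε)) (h′ (½ * ε) (0<½ε 0<ε))

⇒-* : ∀ {z w} c → z ⇒ w → (λ N → c *ᶜ z N) ⇒ c *ᶜ w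
⇒-* {z} {w} c h ε 0<ε =
  let (B , 0≤B , hB) = approx-bounded c
      -- The bound B may be 0, so 1 + B is inverted in its place.
      0<1+B = <-≤-trans (positive⁻¹ 1ℚ) (p≤p+q 0≤B)
      (r₀ , 0<r₀ , inv) = reciprocal (1ℚ + B) 0<1+B
  in eventually-map (λ N → eventually-map (λ i → close B 0<1+B r₀ inv hB N i)) (h (r₀ * ε) (positive-* 0<r₀ 0<ε))
  where
  open ≤-Reasoning
  close : ∀ B → 0ℚ < 1ℚ + B → ∀ r₀ → (1ℚ + B) * r₀ ≡ 1ℚ → (∀ n → ‖ approx c n ‖ ≤ B) → ∀ N i →
    ‖ approx (z N) i ⊖ approx w i ‖ < r₀ * ε → ‖ approx c i ⊗ approx (z N) i ⊖ approx c i ⊗ approx w i ‖ < ε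
  close B 0<1+B r₀ inv hB N i a = begin-strict
    ‖ approx c i ⊗ approx (z N) i ⊖ approx c i ⊗ approx w i ‖
      ≡⟨ cong ‖_‖ (solveᵢ 3 (λ c z w → c ⊠ z ⊟ c ⊠ w ⊜ c ⊠ (z ⊟ w)) refl (approx c i) (approx (z N) i) (approx w i)) ⟩
    ‖ approx c i ⊗ d ‖
      ≤⟨ ‖⊗‖ (approx c i) d ⟩
    ‖ approx c i ‖ * ‖ d ‖
      ≤⟨ *-monoʳ-≤-nonNeg (‖ d ‖) {{ℚ.nonNegative (0≤‖‖ d)}} (≤-trans (hB i) (q≤p+q (nonNegative⁻¹ 1ℚ))) ⟩
    (1ℚ + B) * ‖ d ‖
      <⟨ *-monoʳ-<-pos (1ℚ + B) {{ℚ.positive 0<1+B}} a ⟩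
    (1ℚ + B) * (r₀ * ε)
      ≡⟨ trans (sym (*-assoc (1ℚ + B) r₀ ε)) (trans (cong (_* ε) inv) (*-identityˡ ε)) ⟩
    ε ∎
    where d = approx (z N) i ⊖ approx w i

⇒-subsequence : ∀ {z w} (φ : ℕ → ℕ) → (∀ N → N ℕ.≤ φ N) → z ⇒ w → (λ N → z (φ N)) ⇒ w
⇒-subsequence φ N≤φN h ε 0<ε = let (M , g) = h ε 0<ε in M , λ N M≤N → g (φ N) (ℕP.≤-trans M≤N (N≤φN N))

-- Demanding ½ε in the ℓ¹ norm bounds the squared modulus by ½ε · ε. The remaining ½ε² is the
-- positive gap that `_<ʳ_` asks for.
⇒⇒⟶ : ∀ {z z′ w} → (∀ N i → approx (z N) i ≡ approx (z′ N) i) → z ⇒ w → z′ ⟶ w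
⇒⇒⟶ {z} {z′} {w} p h ε 0<ε = eventually-map (λ N h → ½ * ε * ε , positive-* (0<½ε 0<ε) 0<ε ,
  eventually-map (λ i → bound N i) h) (h (½ * ε) (0<½ε 0<ε))
  where
  open ≤-Reasoning
  0≤ε = <⇒≤ 0<ε
  0≤½ε = <⇒≤ (0<½ε 0<ε)
  bound : ∀ N i → ‖ approx (z N) i ⊖ approx w i ‖ < ½ * ε →
    normSq (approx (z′ N) i ⊖ approx w i) + ½ * ε * ε ≤ ε * ε
  bound N i a = begin
    normSq (approx (z′ N) i ⊖ approx w i) + ½ * ε * ε
      ≡⟨ cong (λ x → normSq (x ⊖ approx w i) + ½ * ε * ε) (sym (p N i)) ⟩
    normSq d + ½ * ε * ε
      ≤⟨ +-monoˡ-≤ (½ * ε * ε) (≤-trans (normSq≤‖‖² d)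
           (*-mono (0≤‖‖ d) 0≤ε (<⇒≤ a) (≤-trans (<⇒≤ a) (≤-trans (p≤p+q 0≤½ε) (≤-reflexive (½+½ ε)))))) ⟩
    ½ * ε * ε + ½ * ε * ε
      ≡⟨ trans (sym (*-distribʳ-+ ε (½ * ε) (½ * ε))) (cong (_* ε) (½+½ ε)) ⟩
    ε * ε ∎
    where d = approx (z N) i ⊖ approx w i

-- The Thue–Morse recursion

digitSum : Expansion 2 → ℕ
digitSum ds = sum (map toℕ ds)

-- Binary expansions of one number agree up to zeros at the most significant end, that is, at the
-- end of the list, and these do not change the sum. Digit sums are thus controlled by the value
-- alone, without following the algorithm of `toDigits`.
digitSum-unique : ∀ ds es → fromDigits ds ≡ fromDigits es → digitSum ds ≡ digitSum es
digitSum-unique [] [] _ = refl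
digitSum-unique [] (Fin.zero ∷ es) eq = digitSum-unique [] es (ℕP.*-cancelʳ-≡ 0 (fromDigits es) 2 eq)
digitSum-unique (Fin.zero ∷ ds) [] eq = digitSum-unique ds [] (ℕP.*-cancelʳ-≡ (fromDigits ds) 0 2 eq)
digitSum-unique (Fin.zero ∷ ds) (Fin.zero ∷ es) eq =
  digitSum-unique ds es (ℕP.*-cancelʳ-≡ (fromDigits ds) (fromDigits es) 2 eq)
digitSum-unique (Fin.suc Fin.zero ∷ ds) (Fin.suc Fin.zero ∷ es) eq =
  cong suc (digitSum-unique ds es (ℕP.*-cancelʳ-≡ (fromDigits ds) (fromDigits es) 2 (ℕP.suc-injective eq)))
digitSum-unique (Fin.zero ∷ ds) (Fin.suc Fin.zero ∷ es) eq = contradiction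
  (trans (ℕP.*-comm 2 (fromDigits ds)) (trans eq (cong suc (ℕP.*-comm (fromDigits es) 2))))
  (ℕP.even≢odd (fromDigits ds) (fromDigits es))
digitSum-unique (Fin.suc Fin.zero ∷ ds) (Fin.zero ∷ es) eq = contradiction
  (trans (ℕP.*-comm 2 (fromDigits es)) (trans (sym eq) (cong suc (ℕP.*-comm (fromDigits ds) 2))))
  (ℕP.even≢odd (fromDigits es) (fromDigits ds))

*2≡double : ∀ n → n ℕ.* 2 ≡ double n
*2≡double zero    = refl
*2≡double (suc n) = cong (λ m → suc (suc m)) (*2≡double n)

-- Digits are listed from the least significant one, so putting `d` in front of the digits of n
-- gives an expansion of d + 2n; uniqueness does the rest.
toDigits-double : ∀ n (d : Fin 2) →
  digitSum (proj₁ (toDigits 2 (toℕ d ℕ.+ double n))) ≡ toℕ d ℕ.+ digitSum (proj₁ (toDigits 2 n))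
toDigits-double n d = digitSum-unique (proj₁ (toDigits 2 (toℕ d ℕ.+ double n))) (d ∷ proj₁ (toDigits 2 n))
  (trans (proj₂ (toDigits 2 (toℕ d ℕ.+ double n))) (sym (cong (toℕ d ℕ.+_)
    (trans (cong (ℕ._* 2) (proj₂ (toDigits 2 n))) (*2≡double n)))))

opaque
  T : ℕ → ℚ
  T n = fromℕ (thueMorse n)

  t≡T : ∀ n i → seq (t n) i ≡ T n
  t≡T n i = refl

  ∣T∣≤1 : ∀ n → ∣ T n ∣ ≤ 1ℚ
  ∣T∣≤1 n = fromℕ-mono (ℕ.s≤s⁻¹ (m%n<n (digitSum (proj₁ (toDigits 2 n))) 2))

  T-0 : T 0 ≡ 0ℚ
  T-0 = refl

  T-double : ∀ n → T (double n) ≡ T n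
  T-double n = cong (λ m → fromℕ (m % 2)) (toDigits-double n Fin.zero)

  T-suc-double : ∀ n → T (suc (double n)) ≡ 1ℚ - T n
  T-suc-double n = trans (cong (λ m → fromℕ (m % 2)) (toDigits-double n (Fin.suc Fin.zero)))
    (suc-parity (digitSum (proj₁ (toDigits 2 n))))
    where
    suc-parity : ∀ m → fromℕ (suc m % 2) ≡ 1ℚ - fromℕ (m % 2)
    suc-parity zero          = refl
    suc-parity (suc zero)    = refl
    suc-parity (suc (suc m)) = suc-parity m

-- partialSum c x N = ∑_{n=1}^N cₙ xₙ₋₁
partialSum : (ℕ → ℝ) → (ℕ → ℂ) → ℕ → ℂ
partialSum c x zero    = 0ᶜ
partialSum c x (suc N) = partialSum c x N +ᶜ fromℝ (c (suc N)) *ᶜ x N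

-- In the application x n is (n + 1)⁻ˢ, so these are the terms (2n + 2)⁻ˢ = 2⁻ˢ (n + 1)⁻ˢ.
evens : (ℕ → ℂ) → ℕ → ℂ
evens x n = x (suc (double n))

partialSum-scale : ∀ c x y Y N → (∀ n → y n ≃ Y *ᶜ x n) → partialSum c y N ≃ Y *ᶜ partialSum c x N
partialSum-scale c x y Y zero    h = pointwise {partialSum c y zero} {Y *ᶜ partialSum c x zero} (λ i →
  solveᵢ 1 (λ Y → conᵢ 0ᵢ ⊜ Y ⊠ conᵢ 0ᵢ) refl (approx Y i))
partialSum-scale c x y Y (suc N) h = begin
  partialSum c y (suc N)
    ≈⟨ pointwise {partialSum c y (suc N)} {partialSum c y N +ᶜ fromℝ (c (suc N)) *ᶜ y N} (λ _ → refl) ⟩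
  partialSum c y N +ᶜ fromℝ (c (suc N)) *ᶜ y N
    ≈⟨ +ᶜ-cong {partialSum c y N} {Y *ᶜ partialSum c x N} {fromℝ (c (suc N)) *ᶜ y N} {fromℝ (c (suc N)) *ᶜ (Y *ᶜ x N)}
         (partialSum-scale c x y Y N h)
         (*ᶜ-cong {fromℝ (c (suc N))} {fromℝ (c (suc N))} {y N} {Y *ᶜ x N} ≃-refl (h N)) ⟩
  Y *ᶜ partialSum c x N +ᶜ fromℝ (c (suc N)) *ᶜ (Y *ᶜ x N)
    ≈⟨ pointwise {Y *ᶜ partialSum c x N +ᶜ fromℝ (c (suc N)) *ᶜ (Y *ᶜ x N)} {Y *ᶜ partialSum c x (suc N)} (λ i →
         solveᵢ 4 (λ Y P c x → Y ⊠ P ⊞ c ⊠ (Y ⊠ x) ⊜ Y ⊠ (P ⊞ c ⊠ x)) refl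
           (approx Y i) (approx (partialSum c x N) i) (approx (fromℝ (c (suc N))) i) (approx (x N) i)) ⟩
  Y *ᶜ partialSum c x (suc N) ∎
  where open ≃-Reasoning

-- Named, because comparing anonymous functions under _*ᶜ_ makes the type checker unfold it.
qₙ₋₁ : ℝ → ℕ → ℝ
qₙ₋₁ k n = q k (n ∸ 1)

signₙ₋₁ ones : ℕ → ℝ
signₙ₋₁ n = sign (n ∸ 1)
ones _ = 1ʳ

-- In steps of two, the values of t cancel by t₂ₙ = tₙ and t₂ₙ₊₁ = 1 - tₙ.
module Splitting (k ℓ : ℝ) (x : ℕ → ℂ) (i : ℕ) where

  S E : (ℕ → ℝ) → ℕ → ℚ[i]
  S c N = approx (partialSum c x N) i
  E c N = approx (partialSum c (evens x) N) i

  κ λ′ : ℚ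
  κ = seq k i
  λ′ = seq ℓ i

  -- Having the value of `t` as a parameter lets the Thue-Morse recursion be substituted before the
  -- ring solver runs; likewise for the next three.
  S-q : ∀ N {τ} → seq (t N) i ≡ τ → S (qₙ₋₁ k) (suc N) ≡ S (qₙ₋₁ k) N ⊕ (ι τ ⊖ ι κ) ⊗ approx (x N) i
  S-q N refl = refl

  S-r : ∀ N {τ} → seq (t (suc N)) i ≡ τ → S (r ℓ) (suc N) ≡ S (r ℓ) N ⊕ (ι τ ⊕ ι λ′) ⊗ approx (x N) i
  S-r N refl = refl

  E-q : ∀ N {τ} → seq (t N) i ≡ τ → E (qₙ₋₁ k) (suc N) ≡ E (qₙ₋₁ k) N ⊕ (ι τ ⊖ ι κ) ⊗ approx (evens x N) i
  E-q N refl = refl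

  E-r : ∀ N {τ} → seq (t (suc N)) i ≡ τ → E (r ℓ) (suc N) ≡ E (r ℓ) N ⊕ (ι τ ⊕ ι λ′) ⊗ approx (evens x N) i
  E-r N refl = refl

  t-double : ∀ n → seq (t (double n)) i ≡ T n
  t-double n = trans (t≡T (double n) i) (T-double n)

  t-suc-double : ∀ n → seq (t (suc (double n))) i ≡ 1ℚ - T n
  t-suc-double n = trans (t≡T (suc (double n)) i) (T-suc-double n)

  -- The series pair tₙ₋₁ with tₙ. For n = 2m + 1 the two values add up to 1; for n = 2m they add up
  -- to 1 + tₘ - tₘ₋₁, and the surplus is cancelled by the m-th terms of the two sums over
  -- `evens x`. In the step, `u` is the term at 2N + 2 and `v` the one at 2N + 3.
  splitting : ∀ N →
    (S (qₙ₋₁ k) (suc (double N)) ⊕ S (r ℓ) (suc (double N))) ⊕ (E (qₙ₋₁ k) N ⊕ neg 1ᵢ ⊗ E (r ℓ) N)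
    ≡ (1ᵢ ⊖ ι κ ⊕ ι λ′) ⊗ S ones (suc (double N)) ⊕ neg (ι κ ⊕ ι λ′) ⊗ E ones N
  splitting zero = trans
    (cong₂ (λ a b → (a ⊕ b) ⊕ (0ᵢ ⊕ neg 1ᵢ ⊗ 0ᵢ)) (S-q 0 (trans (t≡T 0 i) T-0))
      (S-r 0 (trans (t-suc-double 0) (cong (λ p → 1ℚ - p) T-0))))
    (solveᵢ 3 (λ k l x →
        ((conᵢ 0ᵢ ⊞ (conᵢ 0ᵢ ⊟ k) ⊠ x) ⊞ (conᵢ 0ᵢ ⊞ (conᵢ 1ᵢ ⊞ l) ⊠ x)) ⊞ (conᵢ 0ᵢ ⊞ (⊟ conᵢ 1ᵢ) ⊠ conᵢ 0ᵢ)
        ⊜ (conᵢ 1ᵢ ⊟ k ⊞ l) ⊠ (conᵢ 0ᵢ ⊞ conᵢ 1ᵢ ⊠ x) ⊞ (⊟ (k ⊞ l)) ⊠ conᵢ 0ᵢ)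
      refl (ι κ) (ι λ′) (approx (x 0) i))
  splitting (suc N) = begin
    (S (qₙ₋₁ k) M″ ⊕ S (r ℓ) M″) ⊕ (E (qₙ₋₁ k) (suc N) ⊕ neg 1ᵢ ⊗ E (r ℓ) (suc N))
      ≡⟨ cong₂ (λ a b → a ⊕ b)
           (cong₂ _⊕_
             (trans (S-q M′ (t-double (suc N))) (cong (_⊕ (ι τ′ ⊖ ι κ) ⊗ v) (S-q M (t-suc-double N))))
             (trans (S-r M′ (t-suc-double (suc N))) (cong (_⊕ (ι (1ℚ - τ′) ⊕ ι λ′) ⊗ v) (S-r M (t-double (suc N))))))
           (cong₂ (λ a b → a ⊕ neg 1ᵢ ⊗ b) (E-q N (t≡T N i)) (E-r N (t≡T (suc N) i))) ⟩
    ((S (qₙ₋₁ k) M ⊕ (ι (1ℚ - τ) ⊖ ι κ) ⊗ u ⊕ (ι τ′ ⊖ ι κ) ⊗ v)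
      ⊕ (S (r ℓ) M ⊕ (ι τ′ ⊕ ι λ′) ⊗ u ⊕ (ι (1ℚ - τ′) ⊕ ι λ′) ⊗ v))
      ⊕ ((E (qₙ₋₁ k) N ⊕ (ι τ ⊖ ι κ) ⊗ u) ⊕ neg 1ᵢ ⊗ (E (r ℓ) N ⊕ (ι τ′ ⊕ ι λ′) ⊗ u))
      ≡⟨ solveᵢ 10 (λ t t′ k l u v sq sr eq er →
           ((sq ⊞ ((conᵢ 1ᵢ ⊟ t) ⊟ k) ⊠ u ⊞ (t′ ⊟ k) ⊠ v)
             ⊞ (sr ⊞ (t′ ⊞ l) ⊠ u ⊞ ((conᵢ 1ᵢ ⊟ t′) ⊞ l) ⊠ v))
             ⊞ ((eq ⊞ (t ⊟ k) ⊠ u) ⊞ (⊟ conᵢ 1ᵢ) ⊠ (er ⊞ (t′ ⊞ l) ⊠ u))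
           ⊜ ((sq ⊞ sr) ⊞ (eq ⊞ (⊟ conᵢ 1ᵢ) ⊠ er))
             ⊞ ((conᵢ 1ᵢ ⊟ k ⊞ l) ⊠ (u ⊞ v) ⊞ (⊟ (k ⊞ l)) ⊠ u))
           refl (ι τ) (ι τ′) (ι κ) (ι λ′) u v (S (qₙ₋₁ k) M) (S (r ℓ) M) (E (qₙ₋₁ k) N) (E (r ℓ) N) ⟩
    ((S (qₙ₋₁ k) M ⊕ S (r ℓ) M) ⊕ (E (qₙ₋₁ k) N ⊕ neg 1ᵢ ⊗ E (r ℓ) N)) ⊕ (d ⊗ (u ⊕ v) ⊕ e ⊗ u)
      ≡⟨ cong (_⊕ (d ⊗ (u ⊕ v) ⊕ e ⊗ u)) (splitting N) ⟩
    (d ⊗ S ones M ⊕ e ⊗ E ones N) ⊕ (d ⊗ (u ⊕ v) ⊕ e ⊗ u)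
      ≡⟨ solveᵢ 6 (λ d e z w u v → (d ⊠ z ⊞ e ⊠ w) ⊞ (d ⊠ (u ⊞ v) ⊞ e ⊠ u)
           ⊜ d ⊠ (z ⊞ conᵢ 1ᵢ ⊠ u ⊞ conᵢ 1ᵢ ⊠ v) ⊞ e ⊠ (w ⊞ conᵢ 1ᵢ ⊠ u))
           refl d e (S ones M) (E ones N) u v ⟩
    d ⊗ S ones M″ ⊕ e ⊗ E ones (suc N) ∎
    where
    open ≡-Reasoning
    M = suc (double N)
    M′ = suc M
    M″ = suc M′
    τ = T N
    τ′ = T (suc N)
    u = approx (x M) i
    v = approx (x M′) i
    d = 1ᵢ ⊖ ι κ ⊕ ι λ′
    e = neg (ι κ ⊕ ι λ′)

  sign-double : ∀ n → seq (sign (double n)) i ≡ 1ℚ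
  sign-double zero    = refl
  sign-double (suc n) = trans (solve 1 (λ p → :- (:- p) := p) refl (seq (sign (double n)) i)) (sign-double n)

  -- The signs are negative at even n only, so twice the even terms is subtracted from the full sum.
  alternating : ∀ N → S signₙ₋₁ (suc (double N))
    ≡ S ones (suc (double N)) ⊕ neg (ι (fromℕ 2)) ⊗ E ones N
  alternating zero    = solveᵢ 1 (λ x → conᵢ 0ᵢ ⊞ conᵢ 1ᵢ ⊠ x
    ⊜ (conᵢ 0ᵢ ⊞ conᵢ 1ᵢ ⊠ x) ⊞ (⊟ conᵢ (ι (fromℕ 2))) ⊠ conᵢ 0ᵢ) refl (approx (x 0) i)
  alternating (suc N) = trans
    (cong₂ (λ a b → a ⊕ ι (- b) ⊗ u ⊕ ι (- (- b)) ⊗ v) (alternating N) (sign-double N))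
    (solveᵢ 4 (λ z w u v →
        ((z ⊞ (⊟ conᵢ (ι (fromℕ 2))) ⊠ w) ⊞ (⊟ conᵢ 1ᵢ) ⊠ u) ⊞ conᵢ 1ᵢ ⊠ v
        ⊜ ((z ⊞ conᵢ 1ᵢ ⊠ u) ⊞ conᵢ 1ᵢ ⊠ v) ⊞ (⊟ conᵢ (ι (fromℕ 2))) ⊠ (w ⊞ conᵢ 1ᵢ ⊠ u))
      refl (S ones (suc (double N))) (E ones N) u v)
    where
    u = approx (x (suc (double N))) i
    v = approx (x (suc (suc (double N)))) i

-- Convergence of Dirichlet series with bounded coefficients

module Convergence (s : ℂ) (θ : ℚ) (0<θ : 0ℚ < θ) (1+θ≤σ : Eventually (λ i → 1ℚ + θ ≤ seq (re s) i)) where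
  open Kummer θ 0<θ
  open Decay s θ 0<θ 1+θ≤σ

  -- Each term has norm at most 2C β N = (2C/θ)(γ N - γ (N + 1)), the 2 coming from the passage to
  -- the ℓ¹ norm. Blocks therefore telescope to at most K γ N with K = 2C/θ.
  bounded⇒convergent : ∀ c C → (∀ n i → ∣ seq (c (suc n)) i ∣ ≤ C) →
    ∃[ L ] partialSum c (λ n → pow n (-ᶜ s)) ⇒ L
  bounded⇒convergent c C hC = Completion.limit S κ 0≤κ κ-null gap-≤κ , Completion.converges S κ 0≤κ κ-null gap-≤κ
    where
    S : ℕ → ℂ
    S = partialSum c (λ n → pow n (-ᶜ s))
    0≤C : 0ℚ ≤ C
    0≤C = ≤-trans (0≤∣p∣ (seq (c 1) 0)) (hC 0 0)
    θ⁻¹ = proj₁ (reciprocal θ 0<θ)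
    θθ⁻¹≡1 : θ * θ⁻¹ ≡ 1ℚ
    θθ⁻¹≡1 = proj₂ (proj₂ (reciprocal θ 0<θ))
    K : ℚ
    K = C * (fromℕ 2 * θ⁻¹)
    0≤K : 0ℚ ≤ K
    0≤K = 0≤* 0≤C (0≤* (0≤fromℕ 2) (<⇒≤ (proj₁ (proj₂ (reciprocal θ 0<θ)))))
    κ : ℕ → ℚ
    κ N = K * γ N
    0≤κ : ∀ N → 0ℚ ≤ κ N
    0≤κ N = 0≤* 0≤K (<⇒≤ (0<γ N))
    κ-null : Null κ
    κ-null = null-* 0≤K γ-null

    term-≤ : ∀ N i → ‖ approx (pow N (-ᶜ s)) i ‖ ≤ β N + β N →
      ‖ ι (seq (c (suc N)) i) ⊗ approx (pow N (-ᶜ s)) i ‖ ≤ K * (γ N - γ (suc N))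
    term-≤ N i h = begin
      ‖ ι (seq (c (suc N)) i) ⊗ approx (pow N (-ᶜ s)) i ‖
        ≤⟨ ‖⊗‖ (ι (seq (c (suc N)) i)) (approx (pow N (-ᶜ s)) i) ⟩
      ‖ ι (seq (c (suc N)) i) ‖ * ‖ approx (pow N (-ᶜ s)) i ‖
        ≤⟨ *-mono (0≤‖‖ (ι (seq (c (suc N)) i))) (≤-trans (0≤‖‖ (approx (pow N (-ᶜ s)) i)) h)
             (≤-trans (≤-reflexive (+-identityʳ ∣ seq (c (suc N)) i ∣)) (hC N i)) h ⟩
      C * (β N + β N)
        ≡⟨ solve 2 (λ C b → C :* (b :+ b) := C :* con (fromℕ 2) :* (con 1ℚ :* b)) refl C (β N) ⟩
      C * fromℕ 2 * (1ℚ * β N)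
        ≡⟨ cong (λ x → C * fromℕ 2 * (x * β N)) (sym θθ⁻¹≡1) ⟩
      C * fromℕ 2 * (θ * θ⁻¹ * β N)
        ≡⟨ solve 5 (λ C m θ r b → C :* m :* (θ :* r :* b) := C :* (m :* r) :* (θ :* b)) refl C (fromℕ 2) θ θ⁻¹ (β N) ⟩
      K * (θ * β N)
        ≡⟨ cong (K *_) (θ*β N) ⟩
      K * (γ N - γ (suc N)) ∎
      where open ≤-Reasoning

    gap : ∀ N j → Eventually (λ i → ‖ approx (S (j ℕ.+ N)) i ⊖ approx (S N) i ‖ ≤ K * (γ N - γ (j ℕ.+ N)))
    gap N zero    = always (λ i → ≤-reflexive (trans (‖0‖ (approx (S N) i))
      (sym (trans (cong (K *_) (+-inverseʳ (γ N))) (*-zeroʳ K)))))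
    gap N (suc j) = eventually-map₂ (λ i p q → ≤-trans
        (≤-reflexive (cong ‖_‖ (solveᵢ 3 (λ a b c → (a ⊞ b) ⊟ c ⊜ (a ⊟ c) ⊞ b) refl
          (approx (S (j ℕ.+ N)) i) (u i) (approx (S N) i))))
        (≤-trans (‖⊕‖ (approx (S (j ℕ.+ N)) i ⊖ approx (S N) i) (u i))
          (≤-trans (+-mono-≤ p (term-≤ (j ℕ.+ N) i q))
            (≤-reflexive (solve 4 (λ K a b c → K :* (a :- b) :+ K :* (b :- c) := K :* (a :- c)) refl
              K (γ N) (γ (j ℕ.+ N)) (γ (suc j ℕ.+ N)))))))
      (gap N j) (pow-bound (j ℕ.+ N))
      where
      u : ℕ → ℚ[i]
      u i = ι (seq (c (suc (j ℕ.+ N))) i) ⊗ approx (pow (j ℕ.+ N) (-ᶜ s)) i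

    gap-≤κ : ∀ N j → Eventually (λ i → ‖ approx (S (j ℕ.+ N)) i ⊖ approx (S N) i ‖ ≤ κ N)
    gap-≤κ N j = eventually-map (λ i h → ≤-trans h (*-monoˡ-≤-nonNeg K {{ℚ.nonNegative 0≤K}}
      (p≤q+r⇒p-q≤r {γ N} {γ (j ℕ.+ N)} (q≤p+q (<⇒≤ (0<γ (j ℕ.+ N))))))) (gap N j)

approx-step : ∀ {S S′ b x x′} i → approx S i ≡ approx S′ i → x ≡ x′ →
  approx (S +ᶜ b *ᶜ x) i ≡ approx (S′ +ᶜ b *ᶜ x′) i
approx-step {b = b} {x} i p refl = cong (_⊕ approx b i ⊗ approx x i) p

-- The power function is a variable here because the implementation of _^ᶜ_ must not be unfolded.
partialSum-⟶ : ∀ (_^_ : (n : ℕ) .{{_ : NonZero n}} → ℂ → ℂ) c w x L → (∀ n → x n ≡ suc n ^ w) →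
  partialSum c x ⇒ L → ∑₁ (λ n → fromℝ (c n) *ᶜ n ^ w) ⟶ L
partialSum-⟶ _^_ c w x L x≡p = ⇒⇒⟶ {partialSum c x} {∑₁ (λ n → fromℝ (c n) *ᶜ n ^ w)} {L} agree
  where
  agree : ∀ N i → approx (partialSum c x N) i ≡ approx (∑₁ (λ n → fromℝ (c n) *ᶜ n ^ w) N) i
  agree zero    i = refl
  agree (suc N) i = approx-step {partialSum c x N} {∑₁ (λ n → fromℝ (c n) *ᶜ n ^ w) N}
    {fromℝ (c (suc N))} {x N} {suc N ^ w} i (agree N i) (x≡p N)

pow≡^ᶜ : ∀ w n → pow n w ≡ suc n ^ᶜ w
pow≡^ᶜ w n = sym (^ᶜ≡pow n w)

⇒-DirichletSeries : ∀ c s L → partialSum c (λ n → pow n (-ᶜ s)) ⇒ L → DirichletSeries c s L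
⇒-DirichletSeries c s L = partialSum-⟶ _^ᶜ_ c (-ᶜ s) (λ n → pow n (-ᶜ s)) L (pow≡^ᶜ (-ᶜ s))

partialSum-≡ : ∀ c c′ x → (∀ n i → seq (c n) i ≡ seq (c′ n) i) → ∀ N → partialSum c x N ≃ partialSum c′ x N
partialSum-≡ c c′ x c≡c′ N = pointwise (agree N)
  where
  agree : ∀ N i → approx (partialSum c x N) i ≡ approx (partialSum c′ x N) i
  agree zero    i = refl
  agree (suc N) i = cong₂ (λ a b → a ⊕ ι b ⊗ approx (x N) i) (agree N i) (c≡c′ (suc N) i)

-- Inverses of real and complex numbers, and the invertibility of 1 + 2ˢ

0<ʳ⇒reciprocal : ∀ x → 0ʳ <ʳ x → ∃[ y ] fromℝ x *ᶜ fromℝ y ≃ 1ᶜ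
-- From X n · y n = 1 the error of the product is y n (xₙ - X n), which is null because X is a shift
-- of the Cauchy sequence x.
0<ʳ⇒reciprocal x (δ , 0<δ , N₀ , δ≤x) = mkℝ y y-cauchy , mk≃ (null-≤ (always product) (null-* 0≤δ⁻¹ (λ ε 0<ε →
    let (N , h) = cauchy x ε 0<ε in N , λ n N≤n → h n (N₀ ℕ.+ n) N≤n (ℕP.≤-trans N≤n (ℕP.m≤n+m n N₀)))))
  where
  open ≤-Reasoning
  δ⁻¹ = proj₁ (reciprocal δ 0<δ)
  0≤δ⁻¹ = <⇒≤ (proj₁ (proj₂ (reciprocal δ 0<δ)))
  -- Discarding the first N₀ approximations leaves a sequence that is bounded away from 0 throughout.
  X : ℕ → ℚ
  X n = seq x (N₀ ℕ.+ n)
  δ≤X : ∀ n → δ ≤ X n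
  δ≤X n = ≤-trans (≤-reflexive (sym (+-identityˡ δ))) (δ≤x (N₀ ℕ.+ n) (ℕP.m≤m+n N₀ n))
  y : ℕ → ℚ
  y n = proj₁ (reciprocal (X n) (<-≤-trans 0<δ (δ≤X n)))
  0≤y : ∀ n → 0ℚ ≤ y n
  0≤y n = <⇒≤ (proj₁ (proj₂ (reciprocal (X n) (<-≤-trans 0<δ (δ≤X n)))))
  X*y : ∀ n → X n * y n ≡ 1ℚ
  X*y n = proj₂ (proj₂ (reciprocal (X n) (<-≤-trans 0<δ (δ≤X n))))
  y≤δ⁻¹ : ∀ n → y n ≤ δ⁻¹
  y≤δ⁻¹ n = begin
    y n                ≡⟨ trans (sym (*-identityʳ (y n))) (cong (y n *_) (sym (proj₂ (proj₂ (reciprocal δ 0<δ))))) ⟩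
    y n * (δ * δ⁻¹)    ≤⟨ *-monoˡ-≤-nonNeg (y n) {{ℚ.nonNegative (0≤y n)}}
                            (*-monoʳ-≤-nonNeg δ⁻¹ {{ℚ.nonNegative 0≤δ⁻¹}} (δ≤X n)) ⟩
    y n * (X n * δ⁻¹)  ≡⟨ solve 3 (λ y X d → y :* (X :* d) := X :* y :* d) refl (y n) (X n) δ⁻¹ ⟩
    X n * y n * δ⁻¹    ≡⟨ trans (cong (_* δ⁻¹) (X*y n)) (*-identityˡ δ⁻¹) ⟩
    δ⁻¹                ∎

  y-cauchy : IsCauchy y
  y-cauchy = vanishing-≤ 0 (λ m n _ _ → bound m n)
    (vanishing-* (0≤* 0≤δ⁻¹ 0≤δ⁻¹) λ ε 0<ε → let (N , h) = cauchy x ε 0<ε in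
      N , λ m n N≤m N≤n → h (N₀ ℕ.+ n) (N₀ ℕ.+ m) (ℕP.≤-trans N≤n (ℕP.m≤n+m n N₀)) (ℕP.≤-trans N≤m (ℕP.m≤n+m m N₀)))
    where
    bound : ∀ m n → ∣ y m - y n ∣ ≤ δ⁻¹ * δ⁻¹ * ∣ X n - X m ∣
    bound m n = begin
      ∣ y m - y n ∣
        ≡⟨ cong ∣_∣ (trans (solve 2 (λ a b → a :- b := con 1ℚ :* a :- con 1ℚ :* b) refl (y m) (y n))
             (trans (cong₂ (λ a b → a * y m - b * y n) (sym (X*y n)) (sym (X*y m)))
               (solve 4 (λ a b c d → b :* d :* c :- a :* c :* d := c :* d :* (b :- a)) refl (X m) (X n) (y m) (y n)))) ⟩
      ∣ y m * y n * (X n - X m) ∣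
        ≡⟨ trans (∣p*q∣≡∣p∣*∣q∣ (y m * y n) (X n - X m)) (cong (_* ∣ X n - X m ∣) (0≤p⇒∣p∣≡p (0≤* (0≤y m) (0≤y n)))) ⟩
      y m * y n * ∣ X n - X m ∣
        ≤⟨ *-monoʳ-≤-nonNeg ∣ X n - X m ∣ {{∣-∣-nonNeg (X n - X m)}} (*-mono (0≤y m) 0≤δ⁻¹ (y≤δ⁻¹ m) (y≤δ⁻¹ n)) ⟩
      δ⁻¹ * δ⁻¹ * ∣ X n - X m ∣ ∎

  product : ∀ n → ‖ ι (seq x n) ⊗ ι (y n) ⊖ 1ᵢ ‖ ≤ δ⁻¹ * ∣ seq x n - X n ∣
  product n = begin
    ‖ ι (seq x n) ⊗ ι (y n) ⊖ 1ᵢ ‖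
      ≡⟨ cong ‖_‖ (cong₂ _,_
           (trans (cong (λ p → seq x n * y n - 0ℚ * 0ℚ - p) (sym (X*y n)))
             (solve 3 (λ x y X → x :* y :- con 0ℚ :* con 0ℚ :- X :* y := y :* (x :- X)) refl (seq x n) (y n) (X n)))
           (solve 2 (λ x y → x :* con 0ℚ :+ con 0ℚ :* y :- con 0ℚ := con 0ℚ) refl (seq x n) (y n))) ⟩
    ∣ y n * (seq x n - X n) ∣ + 0ℚ
      ≡⟨ trans (+-identityʳ ∣ y n * (seq x n - X n) ∣) (∣p*q∣≡∣p∣*∣q∣ (y n) (seq x n - X n)) ⟩
    ∣ y n ∣ * ∣ seq x n - X n ∣
      ≤⟨ *-monoʳ-≤-nonNeg ∣ seq x n - X n ∣ {{∣-∣-nonNeg (seq x n - X n)}}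
           (≤-trans (≤-reflexive (0≤p⇒∣p∣≡p (0≤y n))) (y≤δ⁻¹ n)) ⟩
    δ⁻¹ * ∣ seq x n - X n ∣ ∎

0<ʳ∣z∣²⇒inverse : ∀ z → 0ʳ <ʳ ∣ z ∣² → ∃[ w ] z *ᶜ w ≃ 1ᶜ
0<ʳ∣z∣²⇒inverse z h = let (y , p) = 0<ʳ⇒reciprocal ∣ z ∣² h in conjᶜ z *ᶜ fromℝ y , ≃-trans (regroup y) p
  where
  regroup : ∀ y → z *ᶜ (conjᶜ z *ᶜ fromℝ y) ≃ fromℝ ∣ z ∣² *ᶜ fromℝ y
  regroup y = pointwise {z *ᶜ (conjᶜ z *ᶜ fromℝ y)} {fromℝ ∣ z ∣² *ᶜ fromℝ y} (λ i → trans
    (solveᵢ 3 (λ a b c → a ⊠ (b ⊠ c) ⊜ (a ⊠ b) ⊠ c) refl (approx z i) (conj (approx z i)) (ι (seq y i)))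
    (cong (_⊗ ι (seq y i)) (norm (seq (re z) i) (seq (im z) i))))
    where
    norm : ∀ a b → (a , b) ⊗ conj (a , b) ≡ ι (a * a + b * b)
    norm a b = cong₂ _,_ (proj₁-⊗-conj (a , b)) (solve 2 (λ a b → a :* (:- b) :+ b :* a := con 0ℚ) refl a b)

module NonvanishingAtTwo (s : ℂ) (1≤σ : Eventually (λ i → 1ℚ ≤ seq (re s) i)) where

  re-≥½ : Eventually (λ i → ½ ≤ seq (re (s *ᶜ Log 1)) i)
  re-≥½ = eventually-map (λ i 1≤σᵢ → ≤-trans
    (*-mono (nonNegative⁻¹ 1ℚ) (≤-trans (0≤1/1+ 1) (½≤log2 i)) 1≤σᵢ (½≤log2 i))
    (≤-reflexive (sym (trans
      (cong (λ z → seq (re s) i * proj₁ z - seq (im s) i * proj₂ z) (approx-Log 1 i))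
      (solve 3 (λ σ τ l → σ :* l :- τ :* con 0ℚ := σ :* l) refl (seq (re s) i) (seq (im s) i) (logSeq 2 i)))))) 1≤σ
    where
    ½≤log2 : ∀ i → ½ ≤ logSeq 2 i
    ½≤log2 i = ≤-trans (logSeq-increment 0 i) (≤-reflexive (+-identityʳ (logSeq 2 i)))

  -- log 2 ≥ ½ and re s ≥ 1 make the real part of the exponent at least ½, whence the modulus 1 + ½.
  normSq-2^s-≥ : Eventually (λ i → (1ℚ + ½) * (1ℚ + ½) ≤ normSq (approx (pow 1 s) i))
  normSq-2^s-≥ = subst (λ z → Eventually (λ i → (1ℚ + ½) * (1ℚ + ½) ≤ normSq (approx z i))) {Exp (s *ᶜ Log 1)} {pow 1 s}
    (Exp≡pow 1 s) (normSq-Exp-≥ (s *ᶜ Log 1) (positive⁻¹ ½) re-≥½)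

  0<∣1+2^s∣² : 0ʳ <ʳ ∣ 1ᶜ +ᶜ pow 1 s ∣²
  0<∣1+2^s∣² = ½ * ½ , positive⁻¹ (½ * ½) ,
    eventually-map (λ i → bound (seq (re (pow 1 s)) i) (seq (im (pow 1 s)) i)) normSq-2^s-≥
    where
    bound : ∀ x y → (1ℚ + ½) * (1ℚ + ½) ≤ x * x + y * y →
      0ℚ + ½ * ½ ≤ (1ℚ + x) * (1ℚ + x) + (0ℚ + y) * (0ℚ + y)
    bound x y h = ≤-trans
      -- A certificate for ∣1 + X∣ ≥ ∣X∣ - 1 ≥ ½ without square roots: ∣1 + X∣² - ¼ = ⅓ ((∣X∣² -
      -- 9/4) + 2 ∣X + 3/2∣²), where X = -3/2 is the case of equality.
      (p≤p+q (0≤* (0≤1/1+ 2) (0≤+ (p≤q⇒0≤q-p h)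
        (0≤* (0≤fromℕ 2) (0≤+ (0≤p*p (x + (1ℚ + ½))) (0≤p*p y))))))
      (≤-reflexive (solve 2 (λ x y →
        con 0ℚ :+ con ½ :* con ½ :+ con (1/1+ 2) :* ((x :* x :+ y :* y :- (con 1ℚ :+ con ½) :* (con 1ℚ :+ con ½))
          :+ con (fromℕ 2) :* ((x :+ (con 1ℚ :+ con ½)) :* (x :+ (con 1ℚ :+ con ½)) :+ y :* y))
        := (con 1ℚ :+ x) :* (con 1ℚ :+ x) :+ (con 0ℚ :+ y) :* (con 0ℚ :+ y)) refl x y))

-- The functional equation

unitˡ : ∀ {W} z → W ≃ 1ᶜ → W *ᶜ z ≃ z
unitˡ {W} z p = ≃-trans (*ᶜ-cong {W} {1ᶜ} {z} {z} p ≃-refl)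
  (pointwise {1ᶜ *ᶜ z} {z} (λ i → solveᵢ 1 (λ z → conᵢ 1ᵢ ⊠ z ⊜ z) refl (approx z i)))

splitting-cong : ∀ {a b Eq Er Ez Yq Yr Yz z d e} → Eq ≃ Yq → Er ≃ Yr → Ez ≃ Yz →
  (a +ᶜ b) +ᶜ (Eq +ᶜ -ᶜ 1ᶜ *ᶜ Er) ≃ d *ᶜ z +ᶜ e *ᶜ Ez →
  (a +ᶜ b) +ᶜ (Yq +ᶜ -ᶜ 1ᶜ *ᶜ Yr) ≃ d *ᶜ z +ᶜ e *ᶜ Yz
splitting-cong {a} {b} {Eq} {Er} {Ez} {Yq} {Yr} {Yz} {z} {d} {e} p q r₁ h = ≃-trans
  (+ᶜ-cong {a +ᶜ b} {a +ᶜ b} {Yq +ᶜ -ᶜ 1ᶜ *ᶜ Yr} {Eq +ᶜ -ᶜ 1ᶜ *ᶜ Er} ≃-refl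
    (+ᶜ-cong {Yq} {Eq} { -ᶜ 1ᶜ *ᶜ Yr} { -ᶜ 1ᶜ *ᶜ Er} (≃-sym p)
      (*ᶜ-cong { -ᶜ 1ᶜ} { -ᶜ 1ᶜ} {Yr} {Er} ≃-refl (≃-sym q))))
  (≃-trans h (+ᶜ-cong {d *ᶜ z} {d *ᶜ z} {e *ᶜ Ez} {e *ᶜ Yz} ≃-refl (*ᶜ-cong {e} {e} {Ez} {Yz} ≃-refl r₁)))

n≤suc-double : ∀ n → n ℕ.≤ suc (double n)
n≤suc-double zero    = ℕ.z≤n
n≤suc-double (suc n) = ℕ.s≤s (ℕP.m≤n⇒m≤1+n (n≤suc-double n))

module Passage {q r z : ℕ → ℂ} {Q R ζ : ℂ} (Y d e : ℂ) (q⇒Q : q ⇒ Q) (r⇒R : r ⇒ R) (z⇒ζ : z ⇒ ζ) where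

  φ : ℕ → ℕ
  φ N = suc (double N)

  along : ∀ {u w} → u ⇒ w → (λ N → u (suc (double N))) ⇒ w
  along {u} {w} = ⇒-subsequence {u} {w} φ n≤suc-double

  -- Sums up to 2N + 1 run through a subsequence and sums up to N through the sequence itself, so
  -- both sides converge, and the uniqueness of limits carries the finite identity over.
  limit-splitting :
    (∀ N → (q (suc (double N)) +ᶜ r (suc (double N))) +ᶜ (Y *ᶜ q N +ᶜ -ᶜ 1ᶜ *ᶜ (Y *ᶜ r N))
           ≃ d *ᶜ z (suc (double N)) +ᶜ e *ᶜ (Y *ᶜ z N)) →
    (Q +ᶜ R) +ᶜ (Y *ᶜ Q +ᶜ -ᶜ 1ᶜ *ᶜ (Y *ᶜ R)) ≃ d *ᶜ ζ +ᶜ e *ᶜ (Y *ᶜ ζ)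
  limit-splitting h = ⇒-unique {right} {(Q +ᶜ R) +ᶜ (Y *ᶜ Q +ᶜ -ᶜ 1ᶜ *ᶜ (Y *ᶜ R))} {d *ᶜ ζ +ᶜ e *ᶜ (Y *ᶜ ζ)}
    (⇒-≃ {left} {right} {(Q +ᶜ R) +ᶜ (Y *ᶜ Q +ᶜ -ᶜ 1ᶜ *ᶜ (Y *ᶜ R))} h left⇒) right⇒
    where
    left right : ℕ → ℂ
    left N = (q (suc (double N)) +ᶜ r (suc (double N))) +ᶜ (Y *ᶜ q N +ᶜ -ᶜ 1ᶜ *ᶜ (Y *ᶜ r N))
    right N = d *ᶜ z (suc (double N)) +ᶜ e *ᶜ (Y *ᶜ z N)
    left⇒ : left ⇒ (Q +ᶜ R) +ᶜ (Y *ᶜ Q +ᶜ -ᶜ 1ᶜ *ᶜ (Y *ᶜ R))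
    left⇒ = ⇒-+ {λ N → q (suc (double N)) +ᶜ r (suc (double N))} {λ N → Y *ᶜ q N +ᶜ -ᶜ 1ᶜ *ᶜ (Y *ᶜ r N)}
      {Q +ᶜ R} {Y *ᶜ Q +ᶜ -ᶜ 1ᶜ *ᶜ (Y *ᶜ R)}
      (⇒-+ {λ N → q (suc (double N))} {λ N → r (suc (double N))} {Q} {R} (along {q} {Q} q⇒Q) (along {r} {R} r⇒R))
      (⇒-+ {λ N → Y *ᶜ q N} {λ N → -ᶜ 1ᶜ *ᶜ (Y *ᶜ r N)} {Y *ᶜ Q} { -ᶜ 1ᶜ *ᶜ (Y *ᶜ R)}
        (⇒-* {q} {Q} Y q⇒Q) (⇒-* {λ N → Y *ᶜ r N} {Y *ᶜ R} (-ᶜ 1ᶜ) (⇒-* {r} {R} Y r⇒R)))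
    right⇒ : right ⇒ d *ᶜ ζ +ᶜ e *ᶜ (Y *ᶜ ζ)
    right⇒ = ⇒-+ {λ N → d *ᶜ z (suc (double N))} {λ N → e *ᶜ (Y *ᶜ z N)} {d *ᶜ ζ} {e *ᶜ (Y *ᶜ ζ)}
      (⇒-* {λ N → z (suc (double N))} {ζ} d (along {z} {ζ} z⇒ζ))
      (⇒-* {λ N → Y *ᶜ z N} {Y *ᶜ ζ} e (⇒-* {z} {ζ} Y z⇒ζ))

limit-alternating : ∀ {h z H ζ} Y e → h ⇒ H → z ⇒ ζ →
  (∀ N → h (suc (double N)) ≃ z (suc (double N)) +ᶜ e *ᶜ (Y *ᶜ z N)) → H ≃ ζ +ᶜ e *ᶜ (Y *ᶜ ζ)
limit-alternating {h} {z} {H} {ζ} Y e h⇒H z⇒ζ p = ⇒-unique {right} {H} {ζ +ᶜ e *ᶜ (Y *ᶜ ζ)}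
  (⇒-≃ {λ N → h (suc (double N))} {right} {H} p (⇒-subsequence {h} {H} (λ N → suc (double N)) n≤suc-double h⇒H))
  (⇒-+ {λ N → z (suc (double N))} {λ N → e *ᶜ (Y *ᶜ z N)} {ζ} {e *ᶜ (Y *ᶜ ζ)}
    (⇒-subsequence {z} {ζ} (λ N → suc (double N)) n≤suc-double z⇒ζ)
    (⇒-* {λ N → Y *ᶜ z N} {Y *ᶜ ζ} e (⇒-* {z} {ζ} Y z⇒ζ)))
  where
  right : ℕ → ℂ
  right N = z (suc (double N)) +ᶜ e *ᶜ (Y *ᶜ z N)

module Scaling (k ℓ : ℝ) (x : ℕ → ℂ) (Y : ℂ) (even : ∀ n → x (suc (double n)) ≃ Y *ᶜ x n) where

  scale : ∀ c N → partialSum c (evens x) N ≃ Y *ᶜ partialSum c x N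
  scale c N = partialSum-scale c x (evens x) Y N even

  evens-scaled : ∀ a b c₁ c₂ c₃ N z d e →
    (a +ᶜ b) +ᶜ (partialSum c₁ (evens x) N +ᶜ -ᶜ 1ᶜ *ᶜ partialSum c₂ (evens x) N)
    ≃ d *ᶜ z +ᶜ e *ᶜ partialSum c₃ (evens x) N →
    (a +ᶜ b) +ᶜ (Y *ᶜ partialSum c₁ x N +ᶜ -ᶜ 1ᶜ *ᶜ (Y *ᶜ partialSum c₂ x N))
    ≃ d *ᶜ z +ᶜ e *ᶜ (Y *ᶜ partialSum c₃ x N)
  evens-scaled a b c₁ c₂ c₃ N z d e = splitting-cong {a} {b}
    {partialSum c₁ (evens x) N} {partialSum c₂ (evens x) N} {partialSum c₃ (evens x) N}
    {Y *ᶜ partialSum c₁ x N} {Y *ᶜ partialSum c₂ x N} {Y *ᶜ partialSum c₃ x N} {z} {d} {e}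
    (scale c₁ N) (scale c₂ N) (scale c₃ N)

  splitting-evens : ∀ N →
    (partialSum (qₙ₋₁ k) x (suc (double N)) +ᶜ partialSum (r ℓ) x (suc (double N)))
      +ᶜ (partialSum (qₙ₋₁ k) (evens x) N +ᶜ -ᶜ 1ᶜ *ᶜ partialSum (r ℓ) (evens x) N)
    ≃ fromℝ (1ʳ -ʳ k +ʳ ℓ) *ᶜ partialSum ones x (suc (double N))
      +ᶜ -ᶜ fromℝ (k +ʳ ℓ) *ᶜ partialSum ones (evens x) N
  splitting-evens N = pointwise (λ i → Splitting.splitting k ℓ x i N)

  splitting-≃ : ∀ N →
    (partialSum (qₙ₋₁ k) x (suc (double N)) +ᶜ partialSum (r ℓ) x (suc (double N)))
      +ᶜ (Y *ᶜ partialSum (qₙ₋₁ k) x N +ᶜ -ᶜ 1ᶜ *ᶜ (Y *ᶜ partialSum (r ℓ) x N))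
    ≃ fromℝ (1ʳ -ʳ k +ʳ ℓ) *ᶜ partialSum ones x (suc (double N))
      +ᶜ -ᶜ fromℝ (k +ʳ ℓ) *ᶜ (Y *ᶜ partialSum ones x N)
  splitting-≃ N = evens-scaled
    (partialSum (qₙ₋₁ k) x (suc (double N))) (partialSum (r ℓ) x (suc (double N))) (qₙ₋₁ k) (r ℓ) ones N
    (partialSum ones x (suc (double N))) (fromℝ (1ʳ -ʳ k +ʳ ℓ)) (-ᶜ fromℝ (k +ʳ ℓ)) (splitting-evens N)

  alternating-≃ : ∀ N →
    partialSum signₙ₋₁ x (suc (double N))
    ≃ partialSum ones x (suc (double N)) +ᶜ -ᶜ 2ᶜ *ᶜ (Y *ᶜ partialSum ones x N)
  alternating-≃ N = ≃-trans
    (pointwise {partialSum signₙ₋₁ x (suc (double N))}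
      {partialSum ones x (suc (double N)) +ᶜ -ᶜ 2ᶜ *ᶜ partialSum ones (evens x) N}
      (λ i → Splitting.alternating k ℓ x i N))
    (+ᶜ-cong {partialSum ones x (suc (double N))} {partialSum ones x (suc (double N))}
      { -ᶜ 2ᶜ *ᶜ partialSum ones (evens x) N} { -ᶜ 2ᶜ *ᶜ (Y *ᶜ partialSum ones x N)} ≃-refl
      (*ᶜ-cong { -ᶜ 2ᶜ} { -ᶜ 2ᶜ} {partialSum ones (evens x) N} {Y *ᶜ partialSum ones x N} ≃-refl
        (scale ones N)))

module FunctionalEquation (k ℓ : ℝ) (X Y Q R ζ η : ℂ) (XY≃1 : X *ᶜ Y ≃ 1ᶜ)
  (splits : (Q +ᶜ R) +ᶜ (Y *ᶜ Q +ᶜ -ᶜ 1ᶜ *ᶜ (Y *ᶜ R)) ≃ fromℝ (1ʳ -ʳ k +ʳ ℓ) *ᶜ ζ +ᶜ -ᶜ fromℝ (k +ʳ ℓ) *ᶜ (Y *ᶜ ζ))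
  (alternates : η ≃ ζ +ᶜ -ᶜ 2ᶜ *ᶜ (Y *ᶜ ζ)) where

  open ≃-Reasoning

  -- Here X is 2ˢ and Y is 2⁻ˢ. Their relation XY = 1 is no ring identity, so it is applied
  -- separately, between rearrangements that the solver can check.
  cancel-XY : ∀ a b → a +ᶜ X *ᶜ Y *ᶜ b ≃ a +ᶜ b
  cancel-XY a b = +ᶜ-cong {a} {a} {X *ᶜ Y *ᶜ b} {b} ≃-refl (unitˡ {X *ᶜ Y} b XY≃1)

  functional : (X +ᶜ 1ᶜ) *ᶜ Q +ᶜ (X -ᶜ 1ᶜ) *ᶜ R ≃ (X -ᶜ (X *ᶜ fromℝ (k -ʳ ℓ) +ᶜ fromℝ (k +ʳ ℓ))) *ᶜ ζ
  functional = begin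
    (X +ᶜ 1ᶜ) *ᶜ Q +ᶜ (X -ᶜ 1ᶜ) *ᶜ R
      ≈⟨ pointwise {(X +ᶜ 1ᶜ) *ᶜ Q +ᶜ (X -ᶜ 1ᶜ) *ᶜ R} {X *ᶜ (Q +ᶜ R) +ᶜ (Q -ᶜ R)} (λ i →
           solveᵢ 3 (λ X Q R → (X ⊞ conᵢ 1ᵢ) ⊠ Q ⊞ (X ⊟ conᵢ 1ᵢ) ⊠ R ⊜ X ⊠ (Q ⊞ R) ⊞ (Q ⊟ R)) refl
             (approx X i) (approx Q i) (approx R i)) ⟩
    X *ᶜ (Q +ᶜ R) +ᶜ (Q -ᶜ R)
      ≈⟨ cancel-XY (X *ᶜ (Q +ᶜ R)) (Q -ᶜ R) ⟨
    X *ᶜ (Q +ᶜ R) +ᶜ X *ᶜ Y *ᶜ (Q -ᶜ R)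
      ≈⟨ pointwise {X *ᶜ (Q +ᶜ R) +ᶜ X *ᶜ Y *ᶜ (Q -ᶜ R)} {X *ᶜ ((Q +ᶜ R) +ᶜ (Y *ᶜ Q +ᶜ -ᶜ 1ᶜ *ᶜ (Y *ᶜ R)))} (λ i →
           solveᵢ 4 (λ X Y Q R → X ⊠ (Q ⊞ R) ⊞ X ⊠ Y ⊠ (Q ⊟ R)
             ⊜ X ⊠ ((Q ⊞ R) ⊞ (Y ⊠ Q ⊞ (⊟ conᵢ 1ᵢ) ⊠ (Y ⊠ R)))) refl
             (approx X i) (approx Y i) (approx Q i) (approx R i)) ⟩
    X *ᶜ ((Q +ᶜ R) +ᶜ (Y *ᶜ Q +ᶜ -ᶜ 1ᶜ *ᶜ (Y *ᶜ R)))
      ≈⟨ *ᶜ-cong {X} {X} {(Q +ᶜ R) +ᶜ (Y *ᶜ Q +ᶜ -ᶜ 1ᶜ *ᶜ (Y *ᶜ R))}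
           {fromℝ (1ʳ -ʳ k +ʳ ℓ) *ᶜ ζ +ᶜ -ᶜ fromℝ (k +ʳ ℓ) *ᶜ (Y *ᶜ ζ)} ≃-refl splits ⟩
    X *ᶜ (fromℝ (1ʳ -ʳ k +ʳ ℓ) *ᶜ ζ +ᶜ -ᶜ fromℝ (k +ʳ ℓ) *ᶜ (Y *ᶜ ζ))
      ≈⟨ pointwise {X *ᶜ (fromℝ (1ʳ -ʳ k +ʳ ℓ) *ᶜ ζ +ᶜ -ᶜ fromℝ (k +ʳ ℓ) *ᶜ (Y *ᶜ ζ))}
           {X *ᶜ (fromℝ (1ʳ -ʳ k +ʳ ℓ) *ᶜ ζ) +ᶜ X *ᶜ Y *ᶜ (-ᶜ fromℝ (k +ʳ ℓ) *ᶜ ζ)} (λ i →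
           solveᵢ 5 (λ X Y d e z → X ⊠ (d ⊠ z ⊞ (⊟ e) ⊠ (Y ⊠ z)) ⊜ X ⊠ (d ⊠ z) ⊞ X ⊠ Y ⊠ ((⊟ e) ⊠ z)) refl
             (approx X i) (approx Y i) (approx (fromℝ (1ʳ -ʳ k +ʳ ℓ)) i) (approx (fromℝ (k +ʳ ℓ)) i) (approx ζ i)) ⟩
    X *ᶜ (fromℝ (1ʳ -ʳ k +ʳ ℓ) *ᶜ ζ) +ᶜ X *ᶜ Y *ᶜ (-ᶜ fromℝ (k +ʳ ℓ) *ᶜ ζ)
      ≈⟨ cancel-XY (X *ᶜ (fromℝ (1ʳ -ʳ k +ʳ ℓ) *ᶜ ζ)) (-ᶜ fromℝ (k +ʳ ℓ) *ᶜ ζ) ⟩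
    X *ᶜ (fromℝ (1ʳ -ʳ k +ʳ ℓ) *ᶜ ζ) +ᶜ -ᶜ fromℝ (k +ʳ ℓ) *ᶜ ζ
      ≈⟨ pointwise {X *ᶜ (fromℝ (1ʳ -ʳ k +ʳ ℓ) *ᶜ ζ) +ᶜ -ᶜ fromℝ (k +ʳ ℓ) *ᶜ ζ}
           {(X -ᶜ (X *ᶜ fromℝ (k -ʳ ℓ) +ᶜ fromℝ (k +ʳ ℓ))) *ᶜ ζ} (λ i →
           solveᵢ 4 (λ X k l z → X ⊠ ((conᵢ 1ᵢ ⊟ k ⊞ l) ⊠ z) ⊞ (⊟ (k ⊞ l)) ⊠ z ⊜ (X ⊟ (X ⊠ (k ⊟ l) ⊞ (k ⊞ l))) ⊠ z) refl
             (approx X i) (ι (seq k i)) (ι (seq ℓ i)) (approx ζ i)) ⟩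
    (X -ᶜ (X *ᶜ fromℝ (k -ʳ ℓ) +ᶜ fromℝ (k +ʳ ℓ))) *ᶜ ζ ∎

  functional-at : ∀ {L} → X -ᶜ (X *ᶜ fromℝ (k -ʳ ℓ) +ᶜ fromℝ (k +ʳ ℓ)) ≃ L →
    (X +ᶜ 1ᶜ) *ᶜ Q +ᶜ (X -ᶜ 1ᶜ) *ᶜ R ≃ L *ᶜ ζ
  functional-at {L} p = ≃-trans functional
    (*ᶜ-cong {X -ᶜ (X *ᶜ fromℝ (k -ʳ ℓ) +ᶜ fromℝ (k +ʳ ℓ))} {L} {ζ} {ζ} p ≃-refl)

  eta : X *ᶜ η ≃ (X -ᶜ 2ᶜ) *ᶜ ζ
  eta = begin
    X *ᶜ η
      ≈⟨ *ᶜ-cong {X} {X} {η} {ζ +ᶜ -ᶜ 2ᶜ *ᶜ (Y *ᶜ ζ)} ≃-refl alternates ⟩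
    X *ᶜ (ζ +ᶜ -ᶜ 2ᶜ *ᶜ (Y *ᶜ ζ))
      ≈⟨ pointwise {X *ᶜ (ζ +ᶜ -ᶜ 2ᶜ *ᶜ (Y *ᶜ ζ))} {X *ᶜ ζ +ᶜ X *ᶜ Y *ᶜ (-ᶜ 2ᶜ *ᶜ ζ)} (λ i →
           solveᵢ 4 (λ X Y m z → X ⊠ (z ⊞ m ⊠ (Y ⊠ z)) ⊜ X ⊠ z ⊞ X ⊠ Y ⊠ (m ⊠ z)) refl
             (approx X i) (approx Y i) (neg (ι (fromℕ 2))) (approx ζ i)) ⟩
    X *ᶜ ζ +ᶜ X *ᶜ Y *ᶜ (-ᶜ 2ᶜ *ᶜ ζ)
      ≈⟨ cancel-XY (X *ᶜ ζ) (-ᶜ 2ᶜ *ᶜ ζ) ⟩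
    X *ᶜ ζ +ᶜ -ᶜ 2ᶜ *ᶜ ζ
      ≈⟨ pointwise {X *ᶜ ζ +ᶜ -ᶜ 2ᶜ *ᶜ ζ} {(X -ᶜ 2ᶜ) *ᶜ ζ} (λ i →
           solveᵢ 3 (λ X m z → X ⊠ z ⊞ (⊟ m) ⊠ z ⊜ (X ⊟ m) ⊠ z) refl (approx X i) (ι (fromℕ 2)) (approx ζ i)) ⟩
    (X -ᶜ 2ᶜ) *ᶜ ζ ∎

  module Vanishing-Λ (J : ℂ) (inverse : (1ᶜ +ᶜ X) *ᶜ J ≃ 1ᶜ)
    (Λ≃0 : X -ᶜ (X *ᶜ fromℝ (k -ʳ ℓ) +ᶜ fromℝ (k +ʳ ℓ)) ≃ 0ᶜ) where

    quotient : (1ᶜ -ᶜ X) *ᶜ J *ᶜ (1ᶜ +ᶜ X) ≃ 1ᶜ -ᶜ X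
    quotient = begin
      (1ᶜ -ᶜ X) *ᶜ J *ᶜ (1ᶜ +ᶜ X)
        ≈⟨ pointwise {(1ᶜ -ᶜ X) *ᶜ J *ᶜ (1ᶜ +ᶜ X)} {(1ᶜ +ᶜ X) *ᶜ J *ᶜ (1ᶜ -ᶜ X)} (λ i →
             solveᵢ 2 (λ X J → (conᵢ 1ᵢ ⊟ X) ⊠ J ⊠ (conᵢ 1ᵢ ⊞ X) ⊜ (conᵢ 1ᵢ ⊞ X) ⊠ J ⊠ (conᵢ 1ᵢ ⊟ X)) refl
               (approx X i) (approx J i)) ⟩
      (1ᶜ +ᶜ X) *ᶜ J *ᶜ (1ᶜ -ᶜ X)
        ≈⟨ unitˡ {(1ᶜ +ᶜ X) *ᶜ J} (1ᶜ -ᶜ X) inverse ⟩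
      1ᶜ -ᶜ X ∎

    -- J inverts 1 + X, and (1 + X) Q is (1 - X) R plus the left side of the functional equation,
    -- which vanishes together with λ.
    Q≃cR : Q ≃ (1ᶜ -ᶜ X) *ᶜ J *ᶜ R
    Q≃cR = begin
      Q
        ≈⟨ unitˡ {(1ᶜ +ᶜ X) *ᶜ J} Q inverse ⟨
      (1ᶜ +ᶜ X) *ᶜ J *ᶜ Q
        ≈⟨ pointwise {(1ᶜ +ᶜ X) *ᶜ J *ᶜ Q} {(1ᶜ -ᶜ X) *ᶜ J *ᶜ R +ᶜ J *ᶜ ((X +ᶜ 1ᶜ) *ᶜ Q +ᶜ (X -ᶜ 1ᶜ) *ᶜ R)} (λ i →
             solveᵢ 4 (λ X J Q R → (conᵢ 1ᵢ ⊞ X) ⊠ J ⊠ Q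
               ⊜ (conᵢ 1ᵢ ⊟ X) ⊠ J ⊠ R ⊞ J ⊠ ((X ⊞ conᵢ 1ᵢ) ⊠ Q ⊞ (X ⊟ conᵢ 1ᵢ) ⊠ R)) refl
               (approx X i) (approx J i) (approx Q i) (approx R i)) ⟩
      (1ᶜ -ᶜ X) *ᶜ J *ᶜ R +ᶜ J *ᶜ ((X +ᶜ 1ᶜ) *ᶜ Q +ᶜ (X -ᶜ 1ᶜ) *ᶜ R)
        ≈⟨ +ᶜ-cong {(1ᶜ -ᶜ X) *ᶜ J *ᶜ R} {(1ᶜ -ᶜ X) *ᶜ J *ᶜ R} {J *ᶜ ((X +ᶜ 1ᶜ) *ᶜ Q +ᶜ (X -ᶜ 1ᶜ) *ᶜ R)} {J *ᶜ (0ᶜ *ᶜ ζ)} ≃-refl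
             (*ᶜ-cong {J} {J} {(X +ᶜ 1ᶜ) *ᶜ Q +ᶜ (X -ᶜ 1ᶜ) *ᶜ R} {0ᶜ *ᶜ ζ} ≃-refl (functional-at {0ᶜ} Λ≃0)) ⟩
      (1ᶜ -ᶜ X) *ᶜ J *ᶜ R +ᶜ J *ᶜ (0ᶜ *ᶜ ζ)
        ≈⟨ pointwise {(1ᶜ -ᶜ X) *ᶜ J *ᶜ R +ᶜ J *ᶜ (0ᶜ *ᶜ ζ)} {(1ᶜ -ᶜ X) *ᶜ J *ᶜ R} (λ i →
             solveᵢ 4 (λ X J R z → (conᵢ 1ᵢ ⊟ X) ⊠ J ⊠ R ⊞ J ⊠ (conᵢ 0ᵢ ⊠ z) ⊜ (conᵢ 1ᵢ ⊟ X) ⊠ J ⊠ R) refl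
               (approx X i) (approx J i) (approx R i) (approx ζ i)) ⟩
      (1ᶜ -ᶜ X) *ᶜ J *ᶜ R ∎

-- Assembly of the theorem

two-power : (_^_ : (n : ℕ) .{{_ : NonZero n}} → ℂ → ℂ) → (∀ n w → suc n ^ w ≡ pow n w) → ∀ w → 2 ^ w ≡ pow 1 w
two-power _^_ h w = h 1 w

2^ᶜ≡pow : ∀ w → 2 ^ᶜ w ≡ pow 1 w
2^ᶜ≡pow = two-power _^ᶜ_ ^ᶜ≡pow

Conclusions : (k ℓ : ℝ) (Q R ζ η X : ℂ) → Set
Conclusions k ℓ Q R ζ η X =
  (X -ᶜ (X *ᶜ fromℝ (k -ʳ ℓ) +ᶜ fromℝ (k +ʳ ℓ)) ≈ᶜ 0ᶜ →
     ∃[ c ] IsQuotient (1ᶜ -ᶜ X) (1ᶜ +ᶜ X) c × Q ≈ᶜ c *ᶜ R)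
  × (X -ᶜ (X *ᶜ fromℝ (k -ʳ ℓ) +ᶜ fromℝ (k +ʳ ℓ)) ≈ᶜ X →
     (X +ᶜ 1ᶜ) *ᶜ Q +ᶜ (X -ᶜ 1ᶜ) *ᶜ R ≈ᶜ X *ᶜ ζ)
  × (X -ᶜ (X *ᶜ fromℝ (k -ʳ ℓ) +ᶜ fromℝ (k +ʳ ℓ)) ≈ᶜ X -ᶜ 2ᶜ →
     (X +ᶜ 1ᶜ) *ᶜ Q +ᶜ (X -ᶜ 1ᶜ) *ᶜ R ≈ᶜ X *ᶜ η)

conclusions : ∀ k ℓ X Y Q R ζ η J → X *ᶜ Y ≃ 1ᶜ → 0ʳ <ʳ ∣ 1ᶜ +ᶜ X ∣² → (1ᶜ +ᶜ X) *ᶜ J ≃ 1ᶜ →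
  (Q +ᶜ R) +ᶜ (Y *ᶜ Q +ᶜ -ᶜ 1ᶜ *ᶜ (Y *ᶜ R)) ≃ fromℝ (1ʳ -ʳ k +ʳ ℓ) *ᶜ ζ +ᶜ -ᶜ fromℝ (k +ʳ ℓ) *ᶜ (Y *ᶜ ζ) →
  η ≃ ζ +ᶜ -ᶜ 2ᶜ *ᶜ (Y *ᶜ ζ) → Conclusions k ℓ Q R ζ η X
conclusions k ℓ X Y Q R ζ η J XY≃1 1+X≢0 inverse splits alternates =
    (λ h → (1ᶜ -ᶜ X) *ᶜ J , (1+X≢0
       , ≃⇒≈ᶜ {(1ᶜ -ᶜ X) *ᶜ J *ᶜ (1ᶜ +ᶜ X)} {1ᶜ -ᶜ X}
           (FE.Vanishing-Λ.quotient J inverse (≈ᶜ⇒≃ {X -ᶜ (X *ᶜ fromℝ (k -ʳ ℓ) +ᶜ fromℝ (k +ʳ ℓ))} {0ᶜ} h)))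
       , ≃⇒≈ᶜ {Q} {(1ᶜ -ᶜ X) *ᶜ J *ᶜ R} (FE.Vanishing-Λ.Q≃cR J inverse (≈ᶜ⇒≃ {X -ᶜ (X *ᶜ fromℝ (k -ʳ ℓ) +ᶜ fromℝ (k +ʳ ℓ))} {0ᶜ} h)))
  , (λ h → ≃⇒≈ᶜ {(X +ᶜ 1ᶜ) *ᶜ Q +ᶜ (X -ᶜ 1ᶜ) *ᶜ R} {X *ᶜ ζ}
       (FE.functional-at {X} (≈ᶜ⇒≃ {X -ᶜ (X *ᶜ fromℝ (k -ʳ ℓ) +ᶜ fromℝ (k +ʳ ℓ))} {X} h)))
  , (λ h → ≃⇒≈ᶜ {(X +ᶜ 1ᶜ) *ᶜ Q +ᶜ (X -ᶜ 1ᶜ) *ᶜ R} {X *ᶜ η}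
       (≃-trans {(X +ᶜ 1ᶜ) *ᶜ Q +ᶜ (X -ᶜ 1ᶜ) *ᶜ R} {(X -ᶜ 2ᶜ) *ᶜ ζ} {X *ᶜ η}
         (FE.functional-at {X -ᶜ 2ᶜ} (≈ᶜ⇒≃ {X -ᶜ (X *ᶜ fromℝ (k -ʳ ℓ) +ᶜ fromℝ (k +ʳ ℓ))} {X -ᶜ 2ᶜ} h))
         (≃-sym {X *ᶜ η} {(X -ᶜ 2ᶜ) *ᶜ ζ} FE.eta)))
  where
  module FE = FunctionalEquation k ℓ X Y Q R ζ η XY≃1 splits alternates

∣t∣≤1 : ∀ n i → ∣ seq (t n) i ∣ ≤ 1ℚ
∣t∣≤1 n i = ≤-trans (≤-reflexive (cong ∣_∣ (t≡T n i))) (∣T∣≤1 n)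

∣sign∣≤1 : ∀ n i → ∣ seq (sign n) i ∣ ≤ 1ℚ
∣sign∣≤1 zero    i = ≤-refl
∣sign∣≤1 (suc n) i = ≤-trans (≤-reflexive (∣-p∣≡∣p∣ (seq (sign n) i))) (∣sign∣≤1 n i)

∣q∣≤ : ∀ k → ∃[ C ] (∀ n i → ∣ seq (qₙ₋₁ k (suc n)) i ∣ ≤ C)
∣q∣≤ k = let (B , hB) = cauchy-bounded {seq k} (cauchy k) in 1ℚ + B , λ n i →
  ≤-trans (∣p-q∣≤∣p∣+∣q∣ (seq (t n) i) (seq k i)) (+-mono-≤ (∣t∣≤1 n i) (hB i))

∣r∣≤ : ∀ ℓ → ∃[ C ] (∀ n i → ∣ seq (r ℓ (suc n)) i ∣ ≤ C)
∣r∣≤ ℓ = let (B , hB) = cauchy-bounded {seq ℓ} (cauchy ℓ) in 1ℚ + B , λ n i →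
  ≤-trans (∣p+q∣≤∣p∣+∣q∣ (seq (t (suc n)) i) (seq ℓ i)) (+-mono-≤ (∣t∣≤1 (suc n) i) (hB i))

module Solution (k ℓ : ℝ) (s : ℂ) (ε : ℚ) (0<ε : 0ℚ < ε) (1+ε≤σ : Eventually (λ i → 1ℚ + ε ≤ seq (re s) i)) where

  sum-of : ∀ c → ∃[ C ] (∀ n i → ∣ seq (c (suc n)) i ∣ ≤ C) → ∃[ L ] partialSum c (λ n → pow n (-ᶜ s)) ⇒ L
  sum-of c (C , hC) = Convergence.bounded⇒convergent s ε 0<ε 1+ε≤σ c C hC

  opaque
    series : ∃[ Q ] ∃[ R ] ∃[ ζ ] ∃[ η ]
      partialSum (qₙ₋₁ k) (λ n → pow n (-ᶜ s)) ⇒ Q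
      × partialSum (r ℓ) (λ n → pow n (-ᶜ s)) ⇒ R
      × partialSum ones (λ n → pow n (-ᶜ s)) ⇒ ζ
      × partialSum signₙ₋₁ (λ n → pow n (-ᶜ s)) ⇒ η
    series =
      let (Q , q⇒Q) = sum-of (qₙ₋₁ k) (∣q∣≤ k)
          (R , r⇒R) = sum-of (r ℓ) (∣r∣≤ ℓ)
          (ζ , z⇒ζ) = sum-of ones (1ℚ , λ _ _ → ≤-refl)
          (η , h⇒η) = sum-of signₙ₋₁ (1ℚ , ∣sign∣≤1)
      in Q , R , ζ , η , q⇒Q , r⇒R , z⇒ζ , h⇒η

  1+2^s-nonzero : 0ʳ <ʳ ∣ 1ᶜ +ᶜ pow 1 s ∣²
  1+2^s-nonzero = NonvanishingAtTwo.0<∣1+2^s∣² s (eventually-map (λ i → ≤-trans (p≤p+q (<⇒≤ 0<ε))) 1+ε≤σ)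

  module _ {Q R ζ η : ℂ}
    (q⇒Q : partialSum (qₙ₋₁ k) (λ n → pow n (-ᶜ s)) ⇒ Q)
    (r⇒R : partialSum (r ℓ) (λ n → pow n (-ᶜ s)) ⇒ R)
    (z⇒ζ : partialSum ones (λ n → pow n (-ᶜ s)) ⇒ ζ)
    (h⇒η : partialSum signₙ₋₁ (λ n → pow n (-ᶜ s)) ⇒ η) where

    module Finite = Scaling k ℓ (λ n → pow n (-ᶜ s)) (pow 1 (-ᶜ s)) (λ n → pow-double n (-ᶜ s))

    equations : Conclusions k ℓ Q R ζ η (pow 1 s)
    equations = let (J , inverse) = 0<ʳ∣z∣²⇒inverse (1ᶜ +ᶜ pow 1 s) 1+2^s-nonzero in
      conclusions k ℓ (pow 1 s) (pow 1 (-ᶜ s)) Q R ζ η J (pow-inverse 1 s) 1+2^s-nonzero inverse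
      (Passage.limit-splitting
        {partialSum (qₙ₋₁ k) (λ n → pow n (-ᶜ s))} {partialSum (r ℓ) (λ n → pow n (-ᶜ s))}
        {partialSum ones (λ n → pow n (-ᶜ s))} {Q} {R} {ζ}
        (pow 1 (-ᶜ s)) (fromℝ (1ʳ -ʳ k +ʳ ℓ)) (-ᶜ fromℝ (k +ʳ ℓ)) q⇒Q r⇒R z⇒ζ Finite.splitting-≃)
      (limit-alternating
        {partialSum signₙ₋₁ (λ n → pow n (-ᶜ s))} {partialSum ones (λ n → pow n (-ᶜ s))} {η} {ζ}
        (pow 1 (-ᶜ s)) (-ᶜ 2ᶜ) h⇒η z⇒ζ Finite.alternating-≃)

    equations-2^ᶜ : Conclusions k ℓ Q R ζ η (2 ^ᶜ s)
    equations-2^ᶜ = subst (Conclusions k ℓ Q R ζ η) {pow 1 s} {2 ^ᶜ s} (sym (2^ᶜ≡pow s)) equations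

coefficients-⇒ : ∀ c c′ s L → (∀ n i → seq (c n) i ≡ seq (c′ n) i) →
  partialSum c (λ n → pow n (-ᶜ s)) ⇒ L → DirichletSeries c′ s L
coefficients-⇒ c c′ s L c≡c′ h = ⇒-DirichletSeries c′ s L
  (⇒-≃ {partialSum c (λ n → pow n (-ᶜ s))} {partialSum c′ (λ n → pow n (-ᶜ s))} {L}
    (partialSum-≡ c c′ (λ n → pow n (-ᶜ s)) c≡c′) h)

theorem4 : (k ℓ : ℝ) → 0ʳ <ʳ k → 0ʳ <ʳ ℓ →
    (s : ℂ) → 1ʳ <ʳ re s →
    ∃[ Q ] ∃[ R ] ∃[ ζ ] ∃[ η ]
    DirichletSeries (λ n → q k (n ∸ 1)) s Q
    × DirichletSeries (λ n → r ℓ n) s R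
    × IsZeta s ζ
    × IsEta s η
    × (Λ s k ℓ ≈ᶜ 0ᶜ →
    ∃[ c ] IsQuotient (1ᶜ -ᶜ 2 ^ᶜ s) (1ᶜ +ᶜ 2 ^ᶜ s) c × Q ≈ᶜ c *ᶜ R)
    × (Λ s k ℓ ≈ᶜ 2 ^ᶜ s →
    (2 ^ᶜ s +ᶜ 1ᶜ) *ᶜ Q +ᶜ (2 ^ᶜ s -ᶜ 1ᶜ) *ᶜ R ≈ᶜ 2 ^ᶜ s *ᶜ ζ)
    × (Λ s k ℓ ≈ᶜ 2 ^ᶜ s -ᶜ 2ᶜ →
    (2 ^ᶜ s +ᶜ 1ᶜ) *ᶜ Q +ᶜ (2 ^ᶜ s -ᶜ 1ᶜ) *ᶜ R ≈ᶜ 2 ^ᶜ s *ᶜ η)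
-- The rational gap contained in `1ʳ <ʳ re s` serves as the θ of Kummer's test.
theorem4 k ℓ _ _ s (ε , 0<ε , 1+ε≤σ) =
  let (Q , R , ζ , η , q⇒Q , r⇒R , z⇒ζ , h⇒η) = Solution.series k ℓ s ε 0<ε 1+ε≤σ
  in Q , R , ζ , η
   , coefficients-⇒ (qₙ₋₁ k) (λ n → q k (n ∸ 1)) s Q (λ _ _ → refl) q⇒Q
   , coefficients-⇒ (r ℓ) (λ n → r ℓ n) s R (λ _ _ → refl) r⇒R
   , coefficients-⇒ ones (λ _ → 1ʳ) s ζ (λ _ _ → refl) z⇒ζ
   , coefficients-⇒ signₙ₋₁ (λ n → sign (n ∸ 1)) s η (λ _ _ → refl) h⇒η
   , Solution.equations-2^ᶜ k ℓ s ε 0<ε 1+ε≤σ {Q} {R} {ζ} {η} q⇒Q r⇒R z⇒ζ h⇒η
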